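{- There exists a polynomial-time algorithm for $1/2$-Consensus-Halving when agents have single-block valuations. That is, there is an algorithm which, given $n$ agents with single-block valuations $\mu_1,\dots,\mu_n$ on $[0,1]$, runs in time polynomial in the input size and outputs a partition of $[0,1]$ into two (not necessarily connected) pieces $I^+$ and $I^-$ using at most $n$ cuts such that $|\mu_j(I^+)-\mu_j(I^-)|\le 1/2$ for all $j\in\{1,\dots,n\}$.
   Context: A valuation is a continuous probability measure $\mu_i$ on $[0,1]$. It is single-block if its density equals a positive constant $v_i$ on a single interval $I_i\subseteq[0,1]$ and $0$ everywhere else; it is represented in the input by the (rational) endpoints of $I_i$ and the height $v_i$. A partition of $[0,1]$ into $I^+$ and $I^-$ "using at most $n$ cuts" is obtained by choosing at most $n$ cut points in $[0,1]$ and assigning a label "$+$" or "$-$" to each of the resulting intervals; $I^+$ (resp. $I^-$) is the union of the intervals labeled $+$ (resp. $-$). -}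

module Defs where

open import Data.Integer.Base as ℤ using (ℤ)
open import Data.List.Base as List using (List; []; _∷_)
open import Data.Nat.Base as ℕ using (ℕ; suc)
open import Data.Nat.Binary.Base as ℕᵇ using (ℕᵇ; 2[1+_]; 1+[2_])
open import Data.Product.Base using (_×_; _,_; proj₁; proj₂)
open import Data.Rational.Unnormalised.Base
  using (ℚᵘ; 0ℚᵘ; 1ℚᵘ; _+_; _*_; _-_; _⊓_; _⊔_; _≤_; _<_; _≃_; ↥_; ↧ₙ_)
open import Data.Sign.Base using (Sign)
open import Data.Sign.Properties using (_≟_)
open import Data.Vec.Base as Vec using (Vec; []; _∷_; _∷ʳ_)
open import Data.Vec.Relation.Unary.Linked using (Linked)
open import Relation.Binary.PropositionalEquality using (_≡_; refl)

------------------------------------------------------------------------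
-- Valuations and partitions

-- Rationals are fractions that need not be in lowest terms, both in the
-- input and in the output of an algorithm.

Interval : Set
Interval = ℚᵘ × ℚᵘ

record SingleBlock : Set where
  field
    left right height : ℚᵘ
    0≤left     : 0ℚᵘ ≤ left
    left≤right : left ≤ right
    right≤1    : right ≤ 1ℚᵘ
    0<height   : 0ℚᵘ < height
    total-mass : height * (right - left) ≃ 1ℚᵘ

open SingleBlock

-- height times the length of [left , right] ∩ [x , y]
measureInterval : SingleBlock → Interval → ℚᵘ
measureInterval μ (x , y) =
  height μ * (0ℚᵘ ⊔ ((right μ ⊓ y) - (left μ ⊔ x)))

-- A list of intervals stands for their union; the intervals are required
-- to overlap at most in endpoints.
measure : SingleBlock → List Interval → ℚᵘ
measure μ is = List.foldr _+_ 0ℚᵘ (List.map (measureInterval μ) is)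

record Partition (n : ℕ) : Set where
  field
    {cutCount} : ℕ
    cutCount≤n : cutCount ℕ.≤ n
    cuts       : Vec ℚᵘ cutCount
    ordered    : Linked _≤_ (0ℚᵘ ∷ (cuts ∷ʳ 1ℚᵘ))
    labels     : Vec Sign (suc cutCount)

open Partition

labelledPieces : ∀ {k} → ℚᵘ → Vec ℚᵘ k → Vec Sign (suc k) →
                 List (Sign × Interval)
labelledPieces x []       (s ∷ []) = (s , (x , 1ℚᵘ)) ∷ []
labelledPieces x (y ∷ ys) (s ∷ ss) = (s , (x , y)) ∷ labelledPieces y ys ss

part : ∀ {n} → Sign → Partition n → List Interval
part s P = List.map proj₂
  (List.filter (λ piece → proj₁ piece ≟ s)
    (labelledPieces 0ℚᵘ (cuts P) (labels P)))

I⁺ I⁻ : ∀ {n} → Partition n → List Interval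
I⁺ = part Sign.+
I⁻ = part Sign.-

------------------------------------------------------------------------
-- The machine model: Jones's WHILE language over binary trees, in
-- variable-free form (a program acts on a single tree)

infixr 5 _∙_

data Tree : Set where
  nil : Tree
  _∙_ : Tree → Tree → Tree

size : Tree → ℕ
size nil     = 1
size (x ∙ y) = suc (size x ℕ.+ size y)

infixr 4 _⨾_

data Program : Set where
  skip mkNil hd tl : Program
  ⟨_,_⟩            : Program → Program → Program
  _⨾_              : Program → Program → Program
  if_then_else_    : Program → Program → Program → Program
  while_loop_      : Program → Program → Program

infix 3 _on_⇓_⟨_⟩

-- "p on x ⇓ y ⟨ t ⟩": p halts on input x with output y, in time t.
-- A test counts as true when its result is not nil.
--
-- Each basic instruction is charged the full size of the tree it is applied
-- to. As a result the running time bounds the size of every tree computed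
-- along the way (repeated duplication by ⟨_,_⟩ is not cheap), so this time is
-- polynomially related to the time of a Turing machine.
data _on_⇓_⟨_⟩ : Program → Tree → Tree → ℕ → Set where
  skip   : ∀ {x} → skip on x ⇓ x ⟨ size x ⟩
  mkNil  : ∀ {x} → mkNil on x ⇓ nil ⟨ size x ⟩
  hd-nil : hd on nil ⇓ nil ⟨ size nil ⟩
  hd-∙   : ∀ {x y} → hd on x ∙ y ⇓ x ⟨ size (x ∙ y) ⟩
  tl-nil : tl on nil ⇓ nil ⟨ size nil ⟩
  tl-∙   : ∀ {x y} → tl on x ∙ y ⇓ y ⟨ size (x ∙ y) ⟩

  pair : ∀ {p q x y z s t} →
         p on x ⇓ y ⟨ s ⟩ → q on x ⇓ z ⟨ t ⟩ →
         ⟨ p , q ⟩ on x ⇓ y ∙ z ⟨ suc (s ℕ.+ t) ⟩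

  seq : ∀ {p q x y z s t} →
        p on x ⇓ y ⟨ s ⟩ → q on y ⇓ z ⟨ t ⟩ →
        (p ⨾ q) on x ⇓ z ⟨ suc (s ℕ.+ t) ⟩

  if-true : ∀ {b p q x y u v s t} →
            b on x ⇓ u ∙ v ⟨ s ⟩ → p on x ⇓ y ⟨ t ⟩ →
            (if b then p else q) on x ⇓ y ⟨ suc (s ℕ.+ t) ⟩

  if-false : ∀ {b p q x y s t} →
             b on x ⇓ nil ⟨ s ⟩ → q on x ⇓ y ⟨ t ⟩ →
             (if b then p else q) on x ⇓ y ⟨ suc (s ℕ.+ t) ⟩

  while-true : ∀ {b p x y z u v r s t} →
               b on x ⇓ u ∙ v ⟨ r ⟩ → p on x ⇓ y ⟨ s ⟩ →
               (while b loop p) on y ⇓ z ⟨ t ⟩ →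
               (while b loop p) on x ⇓ z ⟨ suc (r ℕ.+ s ℕ.+ t) ⟩

  while-false : ∀ {b p x s} →
                b on x ⇓ nil ⟨ s ⟩ →
                (while b loop p) on x ⇓ x ⟨ suc s ⟩

⇓-deterministic : ∀ {p x y z s t} →
                  p on x ⇓ y ⟨ s ⟩ → p on x ⇓ z ⟨ t ⟩ → y ≡ z × s ≡ t
⇓-deterministic skip skip = refl , refl
⇓-deterministic mkNil mkNil = refl , refl
⇓-deterministic hd-nil hd-nil = refl , refl
⇓-deterministic hd-∙ hd-∙ = refl , refl
⇓-deterministic tl-nil tl-nil = refl , refl
⇓-deterministic tl-∙ tl-∙ = refl , refl
⇓-deterministic (pair d e) (pair d′ e′)
  with refl , refl ← ⇓-deterministic d d′
     | refl , refl ← ⇓-deterministic e e′ = refl , refl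
⇓-deterministic (seq d e) (seq d′ e′)
  with refl , refl ← ⇓-deterministic d d′
  with refl , refl ← ⇓-deterministic e e′ = refl , refl
⇓-deterministic (if-true d e) (if-true d′ e′)
  with refl , refl ← ⇓-deterministic d d′
     | refl , refl ← ⇓-deterministic e e′ = refl , refl
⇓-deterministic (if-true d _) (if-false d′ _)
  with () , _ ← ⇓-deterministic d d′
⇓-deterministic (if-false d _) (if-true d′ _)
  with () , _ ← ⇓-deterministic d d′
⇓-deterministic (if-false d e) (if-false d′ e′)
  with refl , refl ← ⇓-deterministic d d′
     | refl , refl ← ⇓-deterministic e e′ = refl , refl
⇓-deterministic (while-true d e f) (while-true d′ e′ f′)
  with refl , refl ← ⇓-deterministic d d′
     | refl , refl ← ⇓-deterministic e e′
  with refl , refl ← ⇓-deterministic f f′ = refl , refl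
⇓-deterministic (while-true d _ _) (while-false d′)
  with () , _ ← ⇓-deterministic d d′
⇓-deterministic (while-false d) (while-true d′ _ _)
  with () , _ ← ⇓-deterministic d d′
⇓-deterministic (while-false d) (while-false d′)
  with refl , refl ← ⇓-deterministic d d′ = refl , refl

------------------------------------------------------------------------
-- Encoding of inputs and outputs, with numbers in binary

encodeSign : Sign → Tree
encodeSign Sign.+ = nil
encodeSign Sign.- = nil ∙ nil

-- The library's binary numerals have digits 1 and 2, least significant
-- first.
encodeℕᵇ : ℕᵇ → Tree
encodeℕᵇ ℕᵇ.zero  = nil
encodeℕᵇ 1+[2 m ] = nil ∙ encodeℕᵇ m
encodeℕᵇ 2[1+ m ] = (nil ∙ nil) ∙ encodeℕᵇ m

encodeℕ : ℕ → Tree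
encodeℕ m = encodeℕᵇ (ℕᵇ.fromℕ m)

encodeℤ : ℤ → Tree
encodeℤ i = encodeSign (ℤ.sign i) ∙ encodeℕ ℤ.∣ i ∣

encodeℚᵘ : ℚᵘ → Tree
encodeℚᵘ q = encodeℤ (↥ q) ∙ encodeℕ (↧ₙ q)

encodeVec : ∀ {A : Set} {k} → (A → Tree) → Vec A k → Tree
encodeVec encode []       = nil
encodeVec encode (x ∷ xs) = encode x ∙ encodeVec encode xs

encodeSingleBlock : SingleBlock → Tree
encodeSingleBlock μ =
  encodeℚᵘ (left μ) ∙ encodeℚᵘ (right μ) ∙ encodeℚᵘ (height μ)

encodeInput : ∀ {n} → Vec SingleBlock n → Tree
encodeInput = encodeVec encodeSingleBlock

encodePartition : ∀ {n} → Partition n → Tree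
encodePartition P =
  encodeVec encodeℚᵘ (cuts P) ∙ encodeVec encodeSign (labels P)

{-# OPTIONS --safe #-}
module Submission where

open import Data.Bool.Base using (Bool; true; false; T; not; _∧_; _xor_)
  renaming (if_then_else_ to when_then_else_)
import Data.Bool.Properties as Boolₚ
open import Data.Empty using (⊥-elim)
open import Data.Fin.Base using (Fin; zero; suc)
open import Data.Integer.Base as ℤ using (ℤ; +_; 0ℤ; ∣_∣; +≤+)
import Data.Integer.Properties as ℤₚ
import Data.Integer.Tactic.RingSolver as IntSolver
open import Data.List.Base as List using (List; []; _∷_; _++_; map; zip)
import Data.List.Properties as Listₚ
open import Data.List.Relation.Binary.Permutation.Propositional as Perm
  using (_↭_; ↭-refl; ↭-trans; prep; swap)
open import Data.List.Relation.Binary.Permutation.Propositional.Properties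
  using (All-resp-↭; ↭-length)
open import Data.List.Relation.Binary.Pointwise.Base using (Pointwise; []; _∷_)
open import Data.List.Relation.Unary.All as All using (All; []; _∷_)
import Data.List.Relation.Unary.All.Properties as Allₚ
open import Data.List.Relation.Unary.AllPairs using (AllPairs; []; _∷_)
open import Data.Nat.Base as ℕ
  using (ℕ; zero; suc; _+_; _*_; _^_; _∸_; _≤_; _<_; z≤n; s≤s; s≤s⁻¹; _⊔_; _≤ᵇ_)
open import Data.Nat.Binary.Base as ℕᵇ using (ℕᵇ; 2[1+_]; 1+[2_])
open import Data.Nat.Binary.Properties using (fromℕ-toℕ; toℕ-fromℕ)
open import Data.Nat.Properties
import Data.Nat.Tactic.RingSolver as NatSolver
open import Data.Product.Base using (_×_; _,_; proj₁; proj₂; ∃-syntax)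
open import Data.Rational.Unnormalised.Base as ℚ
  using (ℚᵘ; mkℚᵘ; 0ℚᵘ; 1ℚᵘ; ½; _≃_; *≡*; *≤*)
import Data.Rational.Unnormalised.Properties as ℚₚ
open import Data.Sign.Base as Sign using (Sign)
import Data.Sign.Properties as Signₚ
open import Data.Sum.Base as Sum using (_⊎_; inj₁; inj₂)
open import Data.Unit.Base using (⊤; tt)
open import Data.Vec.Base as Vec using (Vec; []; _∷_; _∷ʳ_)
open import Data.Vec.Relation.Unary.Linked using (Linked; [-]; _∷_)
open import Function.Base using (_∘_; id)
open import Relation.Binary.PropositionalEquality
  using (_≡_; refl; sym; trans; cong; cong₂; subst; module ≡-Reasoning)
open import Relation.Nullary using (¬_; yes; no)
open import Defs
open SingleBlock

-- Serve the agents in order of increasing block length λ. Throughout there is a set R of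
-- points at which the sign of later cuts is settled up to a flip, such that the signed
-- length E(t) of R ∩ [0 , t] vanishes for t ∉ R and |E(t)| ≤ λ/4 for the current λ. For the
-- next agent with block [a , b], let M be the middle half of [a , b]: one cut outside R is
-- chosen in M so that the signed length of M ∖ R becomes 0 (a discrete intermediate value
-- argument), and M is added to R. The new E returns to 0 at both ends of the stretch that
-- was added, whose length is at most λ/2, so it is still at most λ/4 there.
--
-- With H(t) the signed length of [0 , t] ∖ R, the imbalance of [a , b] is the difference of
-- E(b) + (H(b) - H(v)) and E(a) - (H(u) - H(a)), where M = [u , v]. Each is at most λ/4: if
-- the outer quarter in question meets the complement of R, then E vanishes there. Later
-- cuts lie outside R, where E = 0, hence preserve these bounds for the present R; so every
-- agent remains satisfied although later cuts may fall into its block.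
--
-- All end points of M and [a , b] are integers over a common denominator, and so are the
-- cuts after doubling it. The algorithm is a composition of total functions on trees, each
-- with a program and a polynomial bound; only iterations need a bound on the sizes of
-- intermediate results.

-- Polynomial bounds

-- A cut reverses every sign to its right. It is harmless for R because it is placed where E = 0: a
-- running sum that starts from 0 keeps its absolute values when it is reversed. So an agent has to
-- remember only which segments lay outside the R of its own stage, and the marks on segments record
-- this.
--
-- Adding M can make |E| as large as half the length of M. Serving shorter blocks first makes this
-- at most λ/4 for the current agent, and earlier agents keep the smaller bound of their own stage.
-- The middle half balances the errors: half of M and each outer quarter have length λ/4, and the
-- two ends of the block together contribute at most λ/2, half of the block.
--
-- The cut exists because the signed length to its left minus that to its right, taken over M
-- outside R, runs from -ρ to ρ as the cut moves and stands still on R. Its slope is 2 in absolute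
-- value between integer end points, so a zero lies at a half-integer, which explains the doubling.
--
-- On the machine side, running time bounds output size, so composition is free; a loop, however,
-- could double its accumulator in each round.

infixl 6 _⊕_
infixl 7 _⊗_

data Poly : Set where
  con     : ℕ → Poly
  var     : Poly
  _⊕_ _⊗_ : Poly → Poly → Poly

⟦_⟧ : Poly → ℕ → ℕ
⟦ con k ⟧ n = k
⟦ var ⟧ n   = n
⟦ p ⊕ q ⟧ n = ⟦ p ⟧ n + ⟦ q ⟧ n
⟦ p ⊗ q ⟧ n = ⟦ p ⟧ n * ⟦ q ⟧ n

infixl 8 _[_]

_[_] : Poly → Poly → Poly
con k [ r ]   = con k
var [ r ]     = r
(p ⊕ q) [ r ] = p [ r ] ⊕ q [ r ]
(p ⊗ q) [ r ] = p [ r ] ⊗ q [ r ]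

⟦⟧-subst : ∀ p r n → ⟦ p [ r ] ⟧ n ≡ ⟦ p ⟧ (⟦ r ⟧ n)
⟦⟧-subst (con k) r n = refl
⟦⟧-subst var r n = refl
⟦⟧-subst (p ⊕ q) r n = cong₂ _+_ (⟦⟧-subst p r n) (⟦⟧-subst q r n)
⟦⟧-subst (p ⊗ q) r n = cong₂ _*_ (⟦⟧-subst p r n) (⟦⟧-subst q r n)

⟦⟧-mono : ∀ p {m n} → m ≤ n → ⟦ p ⟧ m ≤ ⟦ p ⟧ n
⟦⟧-mono (con k) le = ≤-refl
⟦⟧-mono var le = le
⟦⟧-mono (p ⊕ q) le = +-mono-≤ (⟦⟧-mono p le) (⟦⟧-mono q le)
⟦⟧-mono (p ⊗ q) le = *-mono-≤ (⟦⟧-mono p le) (⟦⟧-mono q le)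

⟦⟧-mono-subst : ∀ p r n {m} → m ≤ ⟦ r ⟧ n → ⟦ p ⟧ m ≤ ⟦ p [ r ] ⟧ n
⟦⟧-mono-subst p r n le = ≤-trans (⟦⟧-mono p le) (≤-reflexive (sym (⟦⟧-subst p r n)))

-- Only positive arguments are considered: there a power grows with its exponent, so summands of
-- different degrees fit under a common one. Sizes of trees are positive.
⟦⟧-monomial : ∀ p → ∃[ c ] ∃[ d ] (∀ n → ⟦ p ⟧ (suc n) ≤ c * suc n ^ d)
⟦⟧-monomial (con k) = k , 0 , λ n → ≤-reflexive (sym (*-identityʳ k))
⟦⟧-monomial var = 1 , 1 , λ n →
  ≤-reflexive (sym (trans (*-identityˡ (suc n ^ 1)) (*-identityʳ (suc n))))
⟦⟧-monomial (p ⊕ q) with ⟦⟧-monomial p | ⟦⟧-monomial q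
... | c , d , h | c′ , d′ , h′ = c + c′ , d + d′ , λ n → begin
    ⟦ p ⟧ (suc n) + ⟦ q ⟧ (suc n)
      ≤⟨ +-mono-≤ (h n) (h′ n) ⟩
    c * suc n ^ d + c′ * suc n ^ d′
      ≤⟨ +-mono-≤
           (*-monoʳ-≤ c (^-monoʳ-≤ (suc n) (m≤m+n d d′)))
           (*-monoʳ-≤ c′ (^-monoʳ-≤ (suc n) (m≤n+m d′ d))) ⟩
    c * suc n ^ (d + d′) + c′ * suc n ^ (d + d′)
      ≡⟨ *-distribʳ-+ (suc n ^ (d + d′)) c c′ ⟨
    (c + c′) * suc n ^ (d + d′) ∎
  where open ≤-Reasoning
⟦⟧-monomial (p ⊗ q) with ⟦⟧-monomial p | ⟦⟧-monomial q
... | c , d , h | c′ , d′ , h′ = c * c′ , d + d′ , λ n → begin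
    ⟦ p ⟧ (suc n) * ⟦ q ⟧ (suc n)
      ≤⟨ *-mono-≤ (h n) (h′ n) ⟩
    c * suc n ^ d * (c′ * suc n ^ d′)
      ≡⟨ [m*n]*[o*p]≡[m*o]*[n*p] c (suc n ^ d) c′ (suc n ^ d′) ⟩
    c * c′ * (suc n ^ d * suc n ^ d′)
      ≡⟨ cong (c * c′ *_) (^-distribˡ-+-* (suc n) d d′) ⟨
    c * c′ * suc n ^ (d + d′) ∎
  where open ≤-Reasoning

-- Polynomial-time functions on trees

0<size : ∀ x → 1 ≤ size x
0<size nil = s≤s z≤n
0<size (x ∙ y) = s≤s z≤n

size-left : ∀ x y → size x ≤ size (x ∙ y)
size-left x y = m≤n⇒m≤1+n (m≤m+n (size x) (size y))

size-right : ∀ x y → size y ≤ size (x ∙ y)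
size-right x y = m≤n⇒m≤1+n (m≤n+m (size y) (size x))

size-input : ∀ {p x y t} → p on x ⇓ y ⟨ t ⟩ → size x ≤ t
size-input skip = ≤-refl
size-input mkNil = ≤-refl
size-input hd-nil = ≤-refl
size-input hd-∙ = ≤-refl
size-input tl-nil = ≤-refl
size-input tl-∙ = ≤-refl
size-input (pair d e) = ≤-trans (size-input d) (m≤n⇒m≤1+n (m≤m+n _ _))
size-input (seq d e) = ≤-trans (size-input d) (m≤n⇒m≤1+n (m≤m+n _ _))
size-input (if-true d e) = ≤-trans (size-input d) (m≤n⇒m≤1+n (m≤m+n _ _))
size-input (if-false d e) = ≤-trans (size-input d) (m≤n⇒m≤1+n (m≤m+n _ _))
size-input (while-true {r = r} {s} {t} d e f) =
  ≤-trans (size-input d) (m≤n⇒m≤1+n (≤-trans (m≤m+n r s) (m≤m+n (r + s) t)))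
size-input (while-false d) = m≤n⇒m≤1+n (size-input d)

-- Every basic instruction costs at least the size of its result, so a time bound doubles as a bound
-- on the output. This is why `PT` carries no separate size bound and composition can substitute one
-- polynomial into the other.
size-output : ∀ {p x y t} → p on x ⇓ y ⟨ t ⟩ → size y ≤ t
size-output skip = ≤-refl
size-output (mkNil {x}) = 0<size x
size-output hd-nil = ≤-refl
size-output hd-∙ = m≤n⇒m≤1+n (m≤m+n _ _)
size-output tl-nil = ≤-refl
size-output tl-∙ = m≤n⇒m≤1+n (m≤n+m _ _)
size-output (pair d e) = s≤s (+-mono-≤ (size-output d) (size-output e))
size-output (seq d e) = ≤-trans (size-output e) (m≤n⇒m≤1+n (m≤n+m _ _))
size-output (if-true d e) = ≤-trans (size-output e) (m≤n⇒m≤1+n (m≤n+m _ _))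
size-output (if-false d e) = ≤-trans (size-output e) (m≤n⇒m≤1+n (m≤n+m _ _))
size-output (while-true d e f) = ≤-trans (size-output f) (m≤n⇒m≤1+n (m≤n+m _ _))
size-output (while-false d) = m≤n⇒m≤1+n (size-input d)

record PT (f : Tree → Tree) : Set where
  constructor mkPT
  field
    prog  : Program
    bound : Poly
    runs  : ∀ x → ∃[ t ] (prog on x ⇓ f x ⟨ t ⟩) × t ≤ ⟦ bound ⟧ (size x)

open PT

size-PT : ∀ {f} (F : PT f) x → size (f x) ≤ ⟦ bound F ⟧ (size x)
size-PT F x with runs F x
... | t , d , t≤ = ≤-trans (size-output d) t≤

hdT tlT : Tree → Tree
hdT nil     = nil
hdT (x ∙ y) = x
tlT nil     = nil
tlT (x ∙ y) = y

ite : Tree → Tree → Tree → Tree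
ite nil     x y = y
ite (_ ∙ _) x y = x

-- Missing components read as `nil`, so every tree counts as a pair of arguments. Being a record,
-- the type determines `f`, which could not be inferred from `f (hdT x) (tlT x)` alone.
record PT₂ (f : Tree → Tree → Tree) : Set where
  constructor uncurried
  field on-pair : PT (λ x → f (hdT x) (tlT x))

record PT₃ (f : Tree → Tree → Tree → Tree) : Set where
  constructor uncurried
  field on-triple : PT (λ x → f (hdT x) (hdT (tlT x)) (tlT (tlT x)))

open PT₂
open PT₃

idᵖ : PT id
idᵖ = mkPT skip var λ x → size x , skip , ≤-refl

nilᵖ : PT (λ _ → nil)
nilᵖ = mkPT mkNil var λ x → size x , mkNil , ≤-refl

hdᵖ : PT hdT
hdᵖ = mkPT hd var λ
  { nil → 1 , hd-nil , ≤-refl ; (x ∙ y) → size (x ∙ y) , hd-∙ , ≤-refl }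

tlᵖ : PT tlT
tlᵖ = mkPT tl var λ
  { nil → 1 , tl-nil , ≤-refl ; (x ∙ y) → size (x ∙ y) , tl-∙ , ≤-refl }

infixr 9 _∘ᵖ_
infixr 5 _∙ᵖ_

_∘ᵖ_ : ∀ {g f} → PT g → PT f → PT (λ x → g (f x))
_∘ᵖ_ {g} {f} G F = mkPT (prog F ⨾ prog G) (con 1 ⊕ (bound F ⊕ bound G [ bound F ])) go
  where
  go : ∀ x → ∃[ t ] ((prog F ⨾ prog G) on x ⇓ g (f x) ⟨ t ⟩)
           × t ≤ suc (⟦ bound F ⟧ (size x) + ⟦ bound G [ bound F ] ⟧ (size x))
  go x with runs F x | runs G (f x)
  ... | s , d , s≤ | t , e , t≤ = suc (s + t) , seq d e ,
    s≤s (+-mono-≤ s≤ (≤-trans t≤ (⟦⟧-mono-subst (bound G) (bound F) (size x) (size-PT F x))))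

_∙ᵖ_ : ∀ {f g} → PT f → PT g → PT (λ x → f x ∙ g x)
_∙ᵖ_ {f} {g} F G = mkPT ⟨ prog F , prog G ⟩ (con 1 ⊕ (bound F ⊕ bound G)) go
  where
  go : ∀ x → ∃[ t ] (⟨ prog F , prog G ⟩ on x ⇓ f x ∙ g x ⟨ t ⟩)
           × t ≤ suc (⟦ bound F ⟧ (size x) + ⟦ bound G ⟧ (size x))
  go x with runs F x | runs G x
  ... | s , d , s≤ | t , e , t≤ = suc (s + t) , pair d e , s≤s (+-mono-≤ s≤ t≤)

iteᵖ : ∀ {c f g} → PT c → PT f → PT g → PT (λ x → ite (c x) (f x) (g x))
iteᵖ {c} {f} {g} C F G =
  mkPT (if prog C then prog F else prog G) (con 1 ⊕ (bound C ⊕ (bound F ⊕ bound G))) go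
  where
  go : ∀ x → ∃[ t ] ((if prog C then prog F else prog G) on x ⇓ ite (c x) (f x) (g x) ⟨ t ⟩)
           × t ≤ suc (⟦ bound C ⟧ (size x) + (⟦ bound F ⟧ (size x) + ⟦ bound G ⟧ (size x)))
  go x with c x | runs C x
  ... | nil | s , d , s≤ with runs G x
  ...   | t , e , t≤ = suc (s + t) , if-false d e ,
          s≤s (+-mono-≤ s≤ (≤-trans t≤ (m≤n+m _ _)))
  go x | _ ∙ _ | s , d , s≤ with runs F x
  ...   | t , e , t≤ = suc (s + t) , if-true d e ,
          s≤s (+-mono-≤ s≤ (≤-trans t≤ (m≤m+n _ _)))

infixl 1 _$₂_,_

_$₂_,_ : ∀ {h f g} → PT₂ h → PT f → PT g → PT (λ x → h (f x) (g x))
H $₂ F , G = on-pair H ∘ᵖ (F ∙ᵖ G)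

-- A tree is also the list of the left subtrees along its right spine.

st : (Tree → Tree → Tree) → Tree → Tree → Tree
st f s nil     = s
st f s (e ∙ t) = st f (f e s) t

_++ᵀ_ : Tree → Tree → Tree
nil     ++ᵀ u = u
(e ∙ t) ++ᵀ u = e ∙ (t ++ᵀ u)

st-snoc : ∀ f s t e → st f s (t ++ᵀ (e ∙ nil)) ≡ f e (st f s t)
st-snoc f s nil e = refl
st-snoc f s (e′ ∙ t) e = st-snoc f (f e′ s) t e

size-snoc : ∀ t e → size (t ++ᵀ (e ∙ nil)) ≡ suc (size t + size e)
size-snoc nil e = cong suc (+-comm (size e) 1)
size-snoc (e′ ∙ t) e = cong suc
  (trans (cong (λ k → size e′ + k) (size-snoc t e))
    (trans (+-suc (size e′) (size t + size e))
      (cong suc (sym (+-assoc (size e′) (size t) (size e))))))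

-- The loop state is `t ∙ (s ∙ x)`: the elements still to be read, the accumulator, and the
-- parameter, which is carried along because a program acts on a single tree.
stBody : ∀ {f} → PT₃ f →
  PT (λ y → tlT (hdT y) ∙ (f (tlT (tlT y)) (hdT (hdT y)) (hdT (tlT y)) ∙ tlT (tlT y)))
stBody F =
  tlᵖ ∘ᵖ hdᵖ ∙ᵖ
  (on-triple F ∘ᵖ (tlᵖ ∘ᵖ tlᵖ ∙ᵖ hdᵖ ∘ᵖ hdᵖ ∙ᵖ hdᵖ ∘ᵖ tlᵖ)) ∙ᵖ tlᵖ ∘ᵖ tlᵖ

-- `u` records the elements already read, so the accumulator is the fold over `u` and the size
-- hypothesis applies to it in every round. `M` bounds the whole loop state, hence the cost of a
-- round. `u` and `t` together are one list of size at most `K`; the extra 1 in `suc K` is their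
-- second `nil`.
stLoop : ∀ {f} (F : PT₃ f) x s₀ M K →
  (∀ u → size u ≤ K → suc (K + suc (size (st (f x) s₀ u) + size x)) ≤ M) →
  ∀ u s t → s ≡ st (f x) s₀ u → size u + size t ≤ suc K →
  ∃[ τ ] ((while hd loop prog (stBody F)) on t ∙ (s ∙ x) ⇓ nil ∙ (st (f x) s t ∙ x) ⟨ τ ⟩)
       × τ ≤ size t * suc (M + ⟦ bound (stBody F) ⟧ M)
stLoop {f} F x s₀ M K h u s nil refl u≤ = _ , while-false hd-∙ ,
    ≤-trans
      (s≤s (≤-trans (s≤s (+-monoˡ-≤ (suc (size s + size x)) (≤-trans (0<size u) u≤K)))
        (≤-trans (h u u≤K) (m≤m+n M _))))
      (≤-reflexive (sym (*-identityˡ (suc (M + ⟦ bound (stBody F) ⟧ M)))))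
  where
  u≤K : size u ≤ K
  u≤K = s≤s⁻¹ (≤-trans (≤-reflexive (+-comm 1 (size u))) u≤)
stLoop {f} F x s₀ M K h u s (e ∙ t) refl u≤
  with runs (stBody F) ((e ∙ t) ∙ (s ∙ x))
     | stLoop F x s₀ M K h (u ++ᵀ (e ∙ nil)) (f x e s) t
         (sym (st-snoc (f x) s₀ u e))
         (≤-trans (≤-reflexive (trans (cong (_+ size t) (size-snoc u e))
           (trans (cong suc (+-assoc (size u) (size e) (size t)))
             (sym (+-suc (size u) (size e + size t)))))) u≤)
... | τ₁ , d₁ , τ₁≤ | τ₂ , d₂ , τ₂≤ = _ , while-true hd-∙ d₁ d₂ ,
    ≤-trans
      (s≤s (+-mono-≤ (+-mono-≤ state≤M (≤-trans τ₁≤ (⟦⟧-mono (bound (stBody F)) state≤M))) τ₂≤))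
      (*-monoˡ-≤ (suc (M + ⟦ bound (stBody F) ⟧ M)) (s≤s (m≤n+m (size t) (size e))))
  where
  u≤K : size u ≤ K
  u≤K = s≤s⁻¹ (≤-trans (≤-trans (≤-reflexive (+-comm 1 (size u)))
    (+-monoʳ-≤ (size u) (0<size (e ∙ t)))) u≤)
  et≤K : size (e ∙ t) ≤ K
  et≤K = s≤s⁻¹ (≤-trans (+-monoˡ-≤ (size (e ∙ t)) (0<size u)) u≤)
  state≤M : size ((e ∙ t) ∙ (s ∙ x)) ≤ M
  state≤M = ≤-trans (s≤s (+-monoˡ-≤ (suc (size s + size x)) et≤K)) (h u u≤K)

-- Polynomial time per round would permit an accumulator that doubles in every round; the hypothesis
-- on `B` excludes this. It is asked for all lists, and so covers the initial segments that give the
-- intermediate accumulators.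
stᵖ : ∀ {f i l} → PT₃ f → PT i → PT l → (B : Poly) →
  (∀ x t → size (st (f x) (i x) t) ≤ ⟦ B ⟧ (size x + size t)) →
  PT (λ x → st (f x) (i x) (l x))
stᵖ {f} {i} {l} F I L B h =
  mkPT (prog start ⨾ (while hd loop prog (stBody F)) ⨾ prog finish) total go
  where
  start : PT (λ x → l x ∙ (i x ∙ x))
  start = L ∙ᵖ I ∙ᵖ idᵖ
  finish : PT (λ y → hdT (tlT y))
  finish = hdᵖ ∘ᵖ tlᵖ
  M B′ iters total : Poly
  B′ = B [ var ⊕ bound L ]
  M = con 1 ⊕ (bound L ⊕ (con 1 ⊕ (B′ ⊕ var)))
  iters = bound L ⊗ (con 1 ⊕ (M ⊕ bound (stBody F) [ M ]))
  total = con 1 ⊕ (bound start ⊕ (con 1 ⊕ (iters ⊕ bound finish [ M ])))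
  go : ∀ x → ∃[ t ]
    ((prog start ⨾ (while hd loop prog (stBody F)) ⨾ prog finish) on x ⇓ st (f x) (i x) (l x) ⟨ t ⟩)
    × t ≤ ⟦ total ⟧ (size x)
  go x = go′ (runs start x)
             (stLoop F x (i x) (⟦ M ⟧ n) (⟦ bound L ⟧ n) fits nil (i x) (l x) refl (s≤s l≤))
             (runs finish y)
    where
    n = size x
    y = nil ∙ (st (f x) (i x) (l x) ∙ x)
    l≤ : size (l x) ≤ ⟦ bound L ⟧ n
    l≤ = size-PT L x
    st≤ : ∀ u → size u ≤ ⟦ bound L ⟧ n → size (st (f x) (i x) u) ≤ ⟦ B′ ⟧ n
    st≤ u u≤ = ≤-trans (h x u) (⟦⟧-mono-subst B (var ⊕ bound L) n (+-monoʳ-≤ n u≤))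
    fits : ∀ u → size u ≤ ⟦ bound L ⟧ n →
      suc (⟦ bound L ⟧ n + suc (size (st (f x) (i x) u) + n)) ≤ ⟦ M ⟧ n
    fits u u≤ = s≤s (+-monoʳ-≤ (⟦ bound L ⟧ n) (s≤s (+-monoˡ-≤ n (st≤ u u≤))))
    y≤ : size y ≤ ⟦ M ⟧ n
    y≤ = s≤s (+-mono-≤ (≤-trans (0<size (l x)) l≤) (s≤s (+-monoˡ-≤ n (st≤ (l x) l≤))))
    go′ : ∃[ t ] (prog start on x ⇓ l x ∙ (i x ∙ x) ⟨ t ⟩) × t ≤ ⟦ bound start ⟧ n →
      ∃[ t ] ((while hd loop prog (stBody F)) on l x ∙ (i x ∙ x) ⇓ y ⟨ t ⟩)
        × t ≤ size (l x) * suc (⟦ M ⟧ n + ⟦ bound (stBody F) ⟧ (⟦ M ⟧ n)) →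
      ∃[ t ] (prog finish on y ⇓ st (f x) (i x) (l x) ⟨ t ⟩) × t ≤ ⟦ bound finish ⟧ (size y) →
      ∃[ t ]
        ((prog start ⨾ (while hd loop prog (stBody F)) ⨾ prog finish) on x ⇓ st (f x) (i x) (l x) ⟨ t ⟩)
        × t ≤ ⟦ total ⟧ n
    go′ (t₁ , d₁ , t₁≤) (t₂ , d₂ , t₂≤) (t₃ , d₃ , t₃≤) = _ , seq d₁ (seq d₂ d₃) ,
      s≤s (+-mono-≤ t₁≤ (s≤s (+-mono-≤
        (≤-trans t₂≤ (*-mono-≤ l≤ (s≤s (+-monoʳ-≤ (⟦ M ⟧ n)
          (≤-reflexive (sym (⟦⟧-subst (bound (stBody F)) M n)))))))
        (≤-trans t₃≤ (⟦⟧-mono-subst (bound finish) M n y≤)))))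

infixl 1 _$₃_,_,_

_$₃_,_,_ : ∀ {h f g k} → PT₃ h → PT f → PT g → PT k → PT (λ x → h (f x) (g x) (k x))
H $₃ F , G , K = on-triple H ∘ᵖ (F ∙ᵖ G ∙ᵖ K)

PT-ext : ∀ {f g} → (∀ x → f x ≡ g x) → PT f → PT g
PT-ext eq F = mkPT (prog F) (bound F)
  λ x → subst (λ y → ∃[ t ] (prog F on x ⇓ y ⟨ t ⟩) × t ≤ ⟦ bound F ⟧ (size x)) (eq x) (runs F x)

st-additive : ∀ f s t K N → (∀ e s′ → size e ≤ N → size (f e s′) ≤ size s′ + K) →
  size t ≤ N → size (st f s t) ≤ size s + size t * K
st-additive f s nil K N h t≤ = m≤m+n (size s) _
st-additive f s (e ∙ t) K N h t≤ = begin
    size (st f (f e s) t)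
      ≤⟨ st-additive f (f e s) t K N h (≤-trans (size-right e t) t≤) ⟩
    size (f e s) + size t * K
      ≤⟨ +-monoˡ-≤ (size t * K) (h e s (≤-trans (size-left e t) t≤)) ⟩
    size s + K + size t * K
      ≡⟨ +-assoc (size s) K (size t * K) ⟩
    size s + suc (size t) * K
      ≤⟨ +-monoʳ-≤ (size s) (*-monoˡ-≤ K (s≤s (m≤n+m (size t) (size e)))) ⟩
    size s + size (e ∙ t) * K ∎
  where open ≤-Reasoning

-- If a round enlarges the accumulator by an amount that depends only on the parameter and the
-- element read, these amounts add up and cannot compound.
stᵖ-additive : ∀ {f i l} → PT₃ f → PT i → PT l → (K : Poly) →
  (∀ x e s → size (f x e s) ≤ size s + ⟦ K ⟧ (size x + size e)) →
  PT (λ x → st (f x) (i x) (l x))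
stᵖ-additive {f} {i} F I L K h = stᵖ F I L (bound I ⊕ var ⊗ K) λ x t →
  ≤-trans
    (st-additive (f x) (i x) t (⟦ K ⟧ (size x + size t)) (size t)
      (λ e s e≤ → ≤-trans (h x e s)
        (+-monoʳ-≤ (size s) (⟦⟧-mono K (+-monoʳ-≤ (size x) e≤)))) ≤-refl)
    (+-mono-≤ (≤-trans (size-PT I x) (⟦⟧-mono (bound I) (m≤m+n (size x) (size t))))
      (*-monoˡ-≤ (⟦ K ⟧ (size x + size t)) (m≤n+m (size t) (size x))))

-- Reversal, transducers and right folds

revOnto : Tree → Tree → Tree
revOnto u w = st _∙_ w u

size-revOnto : ∀ u w → suc (size (revOnto u w)) ≡ size u + size w
size-revOnto nil w = refl
size-revOnto (e ∙ u) w = trans (size-revOnto u (e ∙ w))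
  (trans (+-suc (size u) (size e + size w))
    (cong suc (trans (sym (+-assoc (size u) (size e) (size w)))
      (cong (_+ size w) (+-comm (size u) (size e))))))

revOntoᵖ : PT₂ revOnto
revOntoᵖ = uncurried (stᵖ-additive {f = λ _ e s → e ∙ s} (uncurried (hdᵖ ∘ᵖ tlᵖ ∙ᵖ tlᵖ ∘ᵖ tlᵖ)) tlᵖ hdᵖ
  (con 1 ⊕ var) λ x e s → ≤-trans (s≤s (+-monoˡ-≤ (size s) (m≤n+m (size e) (size x))))
    (≤-reflexive (+-comm (suc (size x + size e)) (size s))))

-- A Mealy machine: `o` gives the output, `nx` the next state, and `fin` turns the last state into
-- the end of the output list.
transduce : (o nx : Tree → Tree → Tree) (fin : Tree → Tree) → Tree → Tree → Tree
transduce o nx fin s nil     = fin s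
transduce o nx fin s (e ∙ t) = o e s ∙ transduce o nx fin (nx e s) t

-- The machine as a left fold: the state is paired with the output so far, which is built in reverse
-- and turned round at the end by `revOnto`.
emit : (o nx : Tree → Tree → Tree) → Tree → Tree → Tree
emit o nx e z = nx e (hdT z) ∙ o e (hdT z) ∙ tlT z

transduce-st : ∀ o nx fin s w t → let z = st (emit o nx) (s ∙ w) t in
  revOnto (tlT z) (fin (hdT z)) ≡ revOnto w (transduce o nx fin s t)
transduce-st o nx fin s w nil = refl
transduce-st o nx fin s w (e ∙ t) = transduce-st o nx fin (nx e s) (o e s ∙ w) t

st-emit-size : ∀ o nx s₀ C K →
  (∀ e u → size e ≤ K → size u ≤ K → size (o e (st nx s₀ u)) ≤ C) →
  ∀ u s w t → s ≡ st nx s₀ u → size u + size t ≤ suc K →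
  size (st (emit o nx) (s ∙ w) t) ≤ suc (size (st nx s t) + (size w + size t * suc C))
st-emit-size o nx s₀ C K h u s w nil refl le =
  s≤s (+-monoʳ-≤ (size s) (m≤m+n (size w) _))
st-emit-size o nx s₀ C K h u s w (e ∙ t) refl le = ≤-trans
  (st-emit-size o nx s₀ C K h (u ++ᵀ (e ∙ nil)) (nx e s) (o e s ∙ w) t
    (sym (st-snoc nx s₀ u e))
    (≤-trans (≤-reflexive (trans (cong (_+ size t) (size-snoc u e))
           (trans (cong suc (+-assoc (size u) (size e) (size t)))
             (sym (+-suc (size u) (size e + size t)))))) le))
  (s≤s (+-monoʳ-≤ (size (st nx (nx e s) t)) out≤))
  where
  open ≤-Reasoning
  e≤K : size e ≤ K
  e≤K = s≤s⁻¹ (≤-trans (+-mono-≤ (0<size u) (size-left e t)) le)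
  u≤K : size u ≤ K
  u≤K = s≤s⁻¹ (≤-trans (≤-trans (≤-reflexive (+-comm 1 (size u)))
    (+-monoʳ-≤ (size u) (0<size (e ∙ t)))) le)
  out≤ : size (o e s ∙ w) + size t * suc C ≤ size w + size (e ∙ t) * suc C
  out≤ = begin
    suc (size (o e s) + size w) + size t * suc C
      ≤⟨ +-monoˡ-≤ (size t * suc C) (s≤s (+-monoˡ-≤ (size w) (h e u e≤K u≤K))) ⟩
    suc C + size w + size t * suc C
      ≡⟨ cong (_+ size t * suc C) (+-comm (suc C) (size w)) ⟩
    size w + suc C + size t * suc C
      ≡⟨ +-assoc (size w) (suc C) (size t * suc C) ⟩
    size w + suc (size t) * suc C
      ≤⟨ +-monoʳ-≤ (size w) (*-monoˡ-≤ (suc C) (s≤s (m≤n+m (size t) (size e)))) ⟩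
    size w + size (e ∙ t) * suc C ∎

-- Only the states need a bound: an output is no larger than the time of `o` on a state, and outputs
-- are written once and never read again.
transduceᵖ : ∀ {o nx fin i l} → PT₃ o → PT₃ nx → PT₂ fin → PT i → PT l → (B : Poly) →
  (∀ x t → size (st (nx x) (i x) t) ≤ ⟦ B ⟧ (size x + size t)) →
  PT (λ x → transduce (o x) (nx x) (fin x) (i x) (l x))
transduceᵖ {o} {nx} {fin} {i} {l} O N F I L B h =
  PT-ext (λ x → transduce-st (o x) (nx x) (fin x) (i x) nil (l x))
    (revOntoᵖ $₂ tlᵖ ∘ᵖ scan , (F $₂ idᵖ , hdᵖ ∘ᵖ scan))
  where
  C B′ : Poly
  C = bound (on-triple O) [ con 2 ⊕ (var ⊕ (var ⊕ B)) ]
  B′ = con 1 ⊕ (B ⊕ (con 1 ⊕ var ⊗ (con 1 ⊕ C)))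
  emit′ : PT₃ (λ x → emit (o x) (nx x))
  emit′ = uncurried ((N $₃ hdᵖ , hdᵖ ∘ᵖ tlᵖ , hdᵖ ∘ᵖ tlᵖ ∘ᵖ tlᵖ)
    ∙ᵖ (O $₃ hdᵖ , hdᵖ ∘ᵖ tlᵖ , hdᵖ ∘ᵖ tlᵖ ∘ᵖ tlᵖ) ∙ᵖ tlᵖ ∘ᵖ tlᵖ ∘ᵖ tlᵖ)
  out≤ : ∀ x t e u → size e ≤ size t → size u ≤ size t →
    size (o x e (st (nx x) (i x) u)) ≤ ⟦ C ⟧ (size x + size t)
  out≤ x t e u e≤ u≤ = ≤-trans (size-PT (on-triple O) (x ∙ e ∙ st (nx x) (i x) u))
    (⟦⟧-mono-subst (bound (on-triple O)) (con 2 ⊕ (var ⊕ (var ⊕ B))) (size x + size t)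
      (s≤s (≤-trans (≤-reflexive (+-suc (size x) _)) (s≤s
        (+-mono-≤ (m≤m+n (size x) (size t))
          (+-mono-≤ (≤-trans e≤ (m≤n+m (size t) (size x)))
            (≤-trans (h x u) (⟦⟧-mono B (+-monoʳ-≤ (size x) u≤)))))))))
  scan : PT (λ x → st (emit (o x) (nx x)) (i x ∙ nil) (l x))
  scan = stᵖ emit′ (I ∙ᵖ nilᵖ) L B′ λ x t → ≤-trans
    (st-emit-size (o x) (nx x) (i x) (⟦ C ⟧ (size x + size t)) (size t)
      (out≤ x t) nil (i x) nil t refl ≤-refl)
    (s≤s (+-mono-≤ (h x t) (s≤s (*-monoˡ-≤ (suc (⟦ C ⟧ (size x + size t)))
      (m≤n+m (size t) (size x))))))

fr : (Tree → Tree → Tree) → Tree → Tree → Tree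
fr g z nil     = z
fr g z (e ∙ t) = g e (fr g z t)

st-revOnto : ∀ g z w t → st g z (revOnto t w) ≡ st g (fr g z t) w
st-revOnto g z w nil = refl
st-revOnto g z w (e ∙ t) = st-revOnto g z (e ∙ w) t

fr-∙ : ∀ t → fr _∙_ nil t ≡ t
fr-∙ nil = refl
fr-∙ (e ∙ t) = cong (e ∙_) (fr-∙ t)

revOnto-involutive : ∀ t → revOnto (revOnto t nil) nil ≡ t
revOnto-involutive t = trans (st-revOnto _∙_ nil nil t) (fr-∙ t)

size-rev : ∀ t → size (revOnto t nil) ≡ size t
size-rev t = suc-injective (trans (size-revOnto t nil) (+-comm (size t) 1))

-- A right fold is the left fold over the reversed list. The size hypothesis concerns all lists and
-- reversal preserves size, so it transfers.
frᵖ : ∀ {g z l} → PT₃ g → PT z → PT l → (B : Poly) →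
  (∀ x t → size (fr (g x) (z x) t) ≤ ⟦ B ⟧ (size x + size t)) →
  PT (λ x → fr (g x) (z x) (l x))
frᵖ {g} {z} {l} G Z L B h = PT-ext (λ x → st-revOnto (g x) (z x) nil (l x))
  (stᵖ G Z (revOntoᵖ $₂ L , nilᵖ) B λ x t → subst
    (λ u → size (st (g x) (z x) u) ≤ ⟦ B ⟧ (size x + size t)) (revOnto-involutive t)
    (≤-trans (≤-reflexive (cong size (st-revOnto (g x) (z x) nil (revOnto t nil))))
      (≤-trans (h x (revOnto t nil))
        (≤-reflexive (cong (λ k → ⟦ B ⟧ (size x + k)) (size-rev t))))))

fr-additive : ∀ g z t K N → (∀ e r → size e ≤ N → size (g e r) ≤ size r + K) →
  size t ≤ N → size (fr g z t) ≤ size z + size t * K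
fr-additive g z nil K N h t≤ = m≤m+n (size z) _
fr-additive g z (e ∙ t) K N h t≤ = begin
    size (g e (fr g z t))
      ≤⟨ h e (fr g z t) (≤-trans (size-left e t) t≤) ⟩
    size (fr g z t) + K
      ≤⟨ +-monoˡ-≤ K (fr-additive g z t K N h
           (≤-trans (size-right e t) t≤)) ⟩
    size z + size t * K + K
      ≡⟨ trans (+-assoc (size z) (size t * K) K) (cong (λ k → size z + k) (+-comm (size t * K) K)) ⟩
    size z + suc (size t) * K
      ≤⟨ +-monoʳ-≤ (size z) (*-monoˡ-≤ K (s≤s (m≤n+m (size t) (size e)))) ⟩
    size z + size (e ∙ t) * K ∎
  where open ≤-Reasoning

frᵖ-additive : ∀ {g z l} → PT₃ g → PT z → PT l → (K : Poly) →
  (∀ x e r → size (g x e r) ≤ size r + ⟦ K ⟧ (size x + size e)) →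
  PT (λ x → fr (g x) (z x) (l x))
frᵖ-additive {g} {z} G Z L K h = frᵖ G Z L (bound Z ⊕ var ⊗ K) λ x t →
  ≤-trans
    (fr-additive (g x) (z x) t (⟦ K ⟧ (size x + size t)) (size t)
      (λ e r e≤ → ≤-trans (h x e r)
        (+-monoʳ-≤ (size r) (⟦⟧-mono K (+-monoʳ-≤ (size x) e≤)))) ≤-refl)
    (+-mono-≤ (≤-trans (size-PT Z x) (⟦⟧-mono (bound Z) (m≤m+n (size x) (size t))))
      (*-monoˡ-≤ (⟦ K ⟧ (size x + size t)) (m≤n+m (size t) (size x))))

mapT : (Tree → Tree) → Tree → Tree
mapT f = fr (λ e r → f e ∙ r) nil

mapᵖ : ∀ {f l} → PT₂ f → PT l → PT (λ x → mapT (f x) (l x))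
mapᵖ {f} {l} F L = frᵖ-additive {g = λ x e r → f x e ∙ r}
  (uncurried ((F $₂ hdᵖ , hdᵖ ∘ᵖ tlᵖ) ∙ᵖ tlᵖ ∘ᵖ tlᵖ)) nilᵖ L
  (con 1 ⊕ bound (on-pair F) [ con 1 ⊕ var ]) λ x e r →
    ≤-trans (s≤s (+-monoˡ-≤ (size r) (≤-trans (size-PT (on-pair F) (x ∙ e))
      (≤-reflexive (sym (⟦⟧-subst (bound (on-pair F)) (con 1 ⊕ var) (size x + size e)))))))
    (≤-reflexive (+-comm (suc _) (size r)))

transduceᵖ-additive : ∀ {o nx fin i l} → PT₃ o → PT₃ nx → PT₂ fin → PT i → PT l → (K : Poly) →
  (∀ x e s → size (nx x e s) ≤ size s + ⟦ K ⟧ (size x + size e)) →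
  PT (λ x → transduce (o x) (nx x) (fin x) (i x) (l x))
transduceᵖ-additive {nx = nx} {i = i} O N F I L K h =
  transduceᵖ O N F I L (PT.bound I ⊕ var ⊗ K) λ x t → ≤-trans
    (st-additive (nx x) (i x) t (⟦ K ⟧ (size x + size t)) (size t)
      (λ e s e≤ → ≤-trans (h x e s)
        (+-monoʳ-≤ (size s) (⟦⟧-mono K (+-monoʳ-≤ (size x) e≤)))) ≤-refl)
    (+-mono-≤ (≤-trans (size-PT I x) (⟦⟧-mono (PT.bound I) (m≤m+n (size x) (size t))))
      (*-monoˡ-≤ (⟦ K ⟧ (size x + size t)) (m≤n+m (size t) (size x))))

-- Binary arithmetic on trees: a tree is read as the list of its bits, least
-- significant first, where nil is 0 and every other tree is 1.

one : Tree
one = nil ∙ nil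

bit : Tree → ℕ
bit nil     = 0
bit (_ ∙ _) = 1

val : Tree → ℕ
val nil     = 0
val (b ∙ t) = bit b + 2 * val t

len : Tree → ℕ
len nil     = 0
len (_ ∙ t) = suc (len t)

val-hd-tl : ∀ t → bit (hdT t) + 2 * val (tlT t) ≡ val t
val-hd-tl nil     = refl
val-hd-tl (_ ∙ _) = refl

len-tl : ∀ t {k} → len t ≤ suc k → len (tlT t) ≤ k
len-tl nil     _  = z≤n
len-tl (_ ∙ t) le = s≤s⁻¹ le

len≤size : ∀ t → len t ≤ size t
len≤size nil     = z≤n
len≤size (e ∙ t) = s≤s (≤-trans (len≤size t) (m≤n+m (size t) (size e)))

size-hd : ∀ t → size (hdT t) ≤ size t
size-hd nil     = ≤-refl
size-hd (x ∙ y) = size-left x y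

size-tl : ∀ t → size (tlT t) ≤ size t
size-tl nil     = ≤-refl
size-tl (x ∙ y) = size-right x y

xorT andT orT : Tree → Tree → Tree
xorT a b = ite a (ite b nil one) (ite b one nil)
andT a b = ite a (ite b one nil) nil
orT a b  = ite a one (ite b one nil)

xor₃ majority borrow : Tree → Tree → Tree → Tree
xor₃ a b c     = xorT a (xorT b c)
majority a b c = ite a (orT b c) (andT b c)
borrow a b c   = ite a (andT b c) (orT b c)

oneᵖ : PT (λ _ → one)
oneᵖ = nilᵖ ∙ᵖ nilᵖ

xorᵖ : PT₂ xorT
xorᵖ = uncurried (iteᵖ hdᵖ (iteᵖ tlᵖ nilᵖ oneᵖ) (iteᵖ tlᵖ oneᵖ nilᵖ))

andᵖ : PT₂ andT
andᵖ = uncurried (iteᵖ hdᵖ (iteᵖ tlᵖ oneᵖ nilᵖ) nilᵖ)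

orᵖ : PT₂ orT
orᵖ = uncurried (iteᵖ hdᵖ oneᵖ (iteᵖ tlᵖ oneᵖ nilᵖ))

xor₃ᵖ : PT₃ xor₃
xor₃ᵖ = uncurried (xorᵖ $₂ hdᵖ , (xorᵖ $₂ hdᵖ ∘ᵖ tlᵖ , tlᵖ ∘ᵖ tlᵖ))

majorityᵖ : PT₃ majority
majorityᵖ = uncurried
  (iteᵖ hdᵖ (orᵖ $₂ hdᵖ ∘ᵖ tlᵖ , tlᵖ ∘ᵖ tlᵖ) (andᵖ $₂ hdᵖ ∘ᵖ tlᵖ , tlᵖ ∘ᵖ tlᵖ))

borrowᵖ : PT₃ borrow
borrowᵖ = uncurried
  (iteᵖ hdᵖ (andᵖ $₂ hdᵖ ∘ᵖ tlᵖ , tlᵖ ∘ᵖ tlᵖ) (orᵖ $₂ hdᵖ ∘ᵖ tlᵖ , tlᵖ ∘ᵖ tlᵖ))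

size-ite≤ : ∀ c x y {k} → size x ≤ k → size y ≤ k → size (ite c x y) ≤ k
size-ite≤ nil     x y hx hy = hy
size-ite≤ (_ ∙ _) x y hx hy = hx

size-xor : ∀ a b → size (xorT a b) ≤ 3
size-xor a b = size-ite≤ a _ _
  (size-ite≤ b _ _ (s≤s z≤n) ≤-refl) (size-ite≤ b _ _ ≤-refl (s≤s z≤n))

size-and : ∀ a b → size (andT a b) ≤ 3
size-and a b = size-ite≤ a _ _ (size-ite≤ b _ _ ≤-refl (s≤s z≤n)) (s≤s z≤n)

size-or : ∀ a b → size (orT a b) ≤ 3
size-or a b = size-ite≤ a _ _ ≤-refl (size-ite≤ b _ _ ≤-refl (s≤s z≤n))

size-majority : ∀ a b c → size (majority a b c) ≤ 3
size-majority a b c = size-ite≤ a _ _ (size-or b c) (size-and b c)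

size-borrow : ∀ a b c → size (borrow a b c) ≤ 3
size-borrow a b c = size-ite≤ a _ _ (size-and b c) (size-or b c)

bit-xor-and : ∀ a b → bit (xorT a b) + 2 * bit (andT a b) ≡ bit a + bit b
bit-xor-and nil     nil     = refl
bit-xor-and nil     (_ ∙ _) = refl
bit-xor-and (_ ∙ _) nil     = refl
bit-xor-and (_ ∙ _) (_ ∙ _) = refl

bit-xor₃-majority : ∀ a b c →
  bit (xor₃ a b c) + 2 * bit (majority a b c) ≡ bit a + (bit b + bit c)
bit-xor₃-majority nil     nil     nil     = refl
bit-xor₃-majority nil     nil     (_ ∙ _) = refl
bit-xor₃-majority nil     (_ ∙ _) nil     = refl
bit-xor₃-majority nil     (_ ∙ _) (_ ∙ _) = refl
bit-xor₃-majority (_ ∙ _) nil     nil     = refl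
bit-xor₃-majority (_ ∙ _) nil     (_ ∙ _) = refl
bit-xor₃-majority (_ ∙ _) (_ ∙ _) nil     = refl
bit-xor₃-majority (_ ∙ _) (_ ∙ _) (_ ∙ _) = refl

bit-xor₃-borrow : ∀ a b c →
  bit (xor₃ a b c) + (bit b + bit c) ≡ bit a + 2 * bit (borrow a b c)
bit-xor₃-borrow nil     nil     nil     = refl
bit-xor₃-borrow nil     nil     (_ ∙ _) = refl
bit-xor₃-borrow nil     (_ ∙ _) nil     = refl
bit-xor₃-borrow nil     (_ ∙ _) (_ ∙ _) = refl
bit-xor₃-borrow (_ ∙ _) nil     nil     = refl
bit-xor₃-borrow (_ ∙ _) nil     (_ ∙ _) = refl
bit-xor₃-borrow (_ ∙ _) (_ ∙ _) nil     = refl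
bit-xor₃-borrow (_ ∙ _) (_ ∙ _) (_ ∙ _) = refl

carryAdd : Tree → Tree → Tree
carryAdd = transduce xorT andT (λ c → ite c (one ∙ nil) nil)

carryAddᵖ : PT₂ carryAdd
carryAddᵖ = uncurried (transduceᵖ-additive {o = λ _ → xorT} {nx = λ _ → andT}
  {fin = λ _ c → ite c (one ∙ nil) nil}
  (uncurried (xorᵖ $₂ hdᵖ ∘ᵖ tlᵖ , tlᵖ ∘ᵖ tlᵖ))
  (uncurried (andᵖ $₂ hdᵖ ∘ᵖ tlᵖ , tlᵖ ∘ᵖ tlᵖ))
  (uncurried (iteᵖ tlᵖ (oneᵖ ∙ᵖ nilᵖ) nilᵖ)) hdᵖ tlᵖ
  (con 3) λ x e s → ≤-trans (size-and e s) (m≤n+m 3 (size s)))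

val-carryAdd : ∀ c t → val (carryAdd c t) ≡ bit c + val t
val-carryAdd nil     nil     = refl
val-carryAdd (_ ∙ _) nil     = refl
val-carryAdd c       (e ∙ t) = begin
    bit (xorT e c) + 2 * val (carryAdd (andT e c) t)
      ≡⟨ cong (λ k → bit (xorT e c) + 2 * k) (val-carryAdd (andT e c) t) ⟩
    bit (xorT e c) + 2 * (bit (andT e c) + val t)
      ≡⟨ regroup (bit (xorT e c)) (bit (andT e c)) (val t) ⟩
    bit (xorT e c) + 2 * bit (andT e c) + 2 * val t
      ≡⟨ cong (_+ 2 * val t) (trans (bit-xor-and e c) (+-comm (bit e) (bit c))) ⟩
    bit c + bit e + 2 * val t
      ≡⟨ +-assoc (bit c) (bit e) (2 * val t) ⟩
    bit c + (bit e + 2 * val t) ∎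
  where
  open ≡-Reasoning
  regroup : ∀ x a v → x + 2 * (a + v) ≡ x + 2 * a + 2 * v
  regroup = NatSolver.solve-∀

len-carryAdd : ∀ c t → len (carryAdd c t) ≤ suc (len t)
len-carryAdd nil     nil     = z≤n
len-carryAdd (_ ∙ _) nil     = ≤-refl
len-carryAdd c       (e ∙ t) = s≤s (len-carryAdd (andT e c) t)

-- The bits that the arithmetic functions produce are nil or nil ∙ nil.
size-bit-∙ : ∀ {b t n} → size b ≤ 3 → size t ≤ 1 + 4 * n → size (b ∙ t) ≤ 1 + 4 * suc n
size-bit-∙ {b} {t} {n} b≤ t≤ = s≤s (≤-trans (+-mono-≤ b≤ t≤)
  (≤-reflexive (sym (*-suc 4 n))))

size-carryAdd : ∀ c t → size (carryAdd c t) ≤ 1 + 4 * len (carryAdd c t)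
size-carryAdd nil     nil     = ≤-refl
size-carryAdd (_ ∙ _) nil     = ≤-refl
size-carryAdd c       (e ∙ t) = size-bit-∙ (size-xor e c) (size-carryAdd (andT e c) t)

-- The digits of the first summand drive the machine; its state is the unread rest of the second
-- summand with the carry. When the first ends, the carry runs through that rest; a second summand
-- that ends early supplies `nil` digits.
addWith : Tree → Tree → Tree
addWith = transduce
  (λ a s → xor₃ a (hdT (hdT s)) (tlT s))
  (λ a s → tlT (hdT s) ∙ majority a (hdT (hdT s)) (tlT s))
  (λ s → carryAdd (tlT s) (hdT s))

addT : Tree → Tree → Tree
addT a b = addWith (b ∙ nil) a

size-tl-hd : ∀ s → size (tlT (hdT s)) ≤ size s
size-tl-hd s = ≤-trans (size-tl (hdT s)) (size-hd s)

addᵖ : PT₂ addT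
addᵖ = uncurried (transduceᵖ-additive
  {o = λ _ a s → xor₃ a (hdT (hdT s)) (tlT s)}
  {nx = λ _ a s → tlT (hdT s) ∙ majority a (hdT (hdT s)) (tlT s)}
  {fin = λ _ s → carryAdd (tlT s) (hdT s)}
  (uncurried (xor₃ᵖ $₃ hdᵖ ∘ᵖ tlᵖ , hdᵖ ∘ᵖ hdᵖ ∘ᵖ tlᵖ ∘ᵖ tlᵖ , tlᵖ ∘ᵖ tlᵖ ∘ᵖ tlᵖ))
  (uncurried (tlᵖ ∘ᵖ hdᵖ ∘ᵖ tlᵖ ∘ᵖ tlᵖ ∙ᵖ
    (majorityᵖ $₃ hdᵖ ∘ᵖ tlᵖ , hdᵖ ∘ᵖ hdᵖ ∘ᵖ tlᵖ ∘ᵖ tlᵖ , tlᵖ ∘ᵖ tlᵖ ∘ᵖ tlᵖ)))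
  (uncurried (carryAddᵖ $₂ tlᵖ ∘ᵖ tlᵖ , hdᵖ ∘ᵖ tlᵖ)) (tlᵖ ∙ᵖ nilᵖ) hdᵖ
  (con 4) λ x a s → ≤-trans
    (s≤s (+-mono-≤ (size-tl-hd s) (size-majority a (hdT (hdT s)) (tlT s))))
    (≤-reflexive (sym (+-suc (size s) 3))))

val-addWith : ∀ b c a → val (addWith (b ∙ c) a) ≡ val a + (val b + bit c)
val-addWith b c nil = trans (val-carryAdd c b) (+-comm (bit c) (val b))
val-addWith b c (e ∙ a) = begin
    x + 2 * val (addWith (tlT b ∙ m) a)
      ≡⟨ cong (λ k → x + 2 * k) (val-addWith (tlT b) m a) ⟩
    x + 2 * (val a + (val (tlT b) + bit m))
      ≡⟨ regroup₁ x (val a) (val (tlT b)) (bit m) ⟩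
    x + 2 * bit m + (2 * val a + 2 * val (tlT b))
      ≡⟨ cong (_+ (2 * val a + 2 * val (tlT b))) (bit-xor₃-majority e (hdT b) c) ⟩
    bit e + (bit (hdT b) + bit c) + (2 * val a + 2 * val (tlT b))
      ≡⟨ regroup₂ (bit e) (bit (hdT b)) (bit c) (val a) (val (tlT b)) ⟩
    bit e + 2 * val a + (bit (hdT b) + 2 * val (tlT b) + bit c)
      ≡⟨ cong (λ k → bit e + 2 * val a + (k + bit c)) (val-hd-tl b) ⟩
    bit e + 2 * val a + (val b + bit c) ∎
  where
  open ≡-Reasoning
  m = majority e (hdT b) c
  x = bit (xor₃ e (hdT b) c)
  regroup₁ : ∀ x a b m → x + 2 * (a + (b + m)) ≡ x + 2 * m + (2 * a + 2 * b)
  regroup₁ = NatSolver.solve-∀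
  regroup₂ : ∀ e h c a b → e + (h + c) + (2 * a + 2 * b) ≡ e + 2 * a + (h + 2 * b + c)
  regroup₂ = NatSolver.solve-∀

val-add : ∀ a b → val (addT a b) ≡ val a + val b
val-add a b = trans (val-addWith b nil a) (cong (λ k → val a + k) (+-identityʳ (val b)))

len-addWith : ∀ b c a {k} → len a ≤ k → len b ≤ k → len (addWith (b ∙ c) a) ≤ suc k
len-addWith b c nil a≤ b≤ = ≤-trans (len-carryAdd c b) (s≤s b≤)
len-addWith b c (e ∙ a) {suc k} a≤ b≤ =
  s≤s (len-addWith (tlT b) _ a (s≤s⁻¹ a≤) (len-tl b b≤))

len-add : ∀ a b {k} → len a ≤ k → len b ≤ k → len (addT a b) ≤ suc k
len-add a b = len-addWith b nil a

size-addWith : ∀ b c a → size (addWith (b ∙ c) a) ≤ 1 + 4 * len (addWith (b ∙ c) a)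
size-addWith b c nil     = size-carryAdd c b
size-addWith b c (e ∙ a) =
  size-bit-∙ (size-xor e (xorT (hdT b) c)) (size-addWith (tlT b) (majority e (hdT b) c) a)

size-add : ∀ a b → size (addT a b) ≤ 1 + 4 * len (addT a b)
size-add a b = size-addWith b nil a

-- Whatever remains of the subtrahend and the borrow when the minuend ends is dropped, which is
-- correct for nonnegative differences. In return the result is exactly as long as the minuend, and
-- this keeps cut positions short.
subWith : Tree → Tree → Tree
subWith = transduce
  (λ a s → xor₃ a (hdT (hdT s)) (tlT s))
  (λ a s → tlT (hdT s) ∙ borrow a (hdT (hdT s)) (tlT s))
  (λ s → nil)

subT : Tree → Tree → Tree
subT a b = subWith (b ∙ nil) a

subᵖ : PT₂ subT
subᵖ = uncurried (transduceᵖ-additive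
  {o = λ _ a s → xor₃ a (hdT (hdT s)) (tlT s)}
  {nx = λ _ a s → tlT (hdT s) ∙ borrow a (hdT (hdT s)) (tlT s)}
  {fin = λ _ s → nil}
  (uncurried (xor₃ᵖ $₃ hdᵖ ∘ᵖ tlᵖ , hdᵖ ∘ᵖ hdᵖ ∘ᵖ tlᵖ ∘ᵖ tlᵖ , tlᵖ ∘ᵖ tlᵖ ∘ᵖ tlᵖ))
  (uncurried (tlᵖ ∘ᵖ hdᵖ ∘ᵖ tlᵖ ∘ᵖ tlᵖ ∙ᵖ
    (borrowᵖ $₃ hdᵖ ∘ᵖ tlᵖ , hdᵖ ∘ᵖ hdᵖ ∘ᵖ tlᵖ ∘ᵖ tlᵖ , tlᵖ ∘ᵖ tlᵖ ∘ᵖ tlᵖ)))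
  (uncurried nilᵖ) (tlᵖ ∙ᵖ nilᵖ) hdᵖ
  (con 4) λ x a s → ≤-trans
    (s≤s (+-mono-≤ (size-tl-hd s) (size-borrow a (hdT (hdT s)) (tlT s))))
    (≤-reflexive (sym (+-suc (size s) 3))))

bit≤1 : ∀ b → bit b ≤ 1
bit≤1 nil     = z≤n
bit≤1 (_ ∙ _) = ≤-refl

double-cancel-≤ : ∀ {m n} → 2 * m ≤ 1 + 2 * n → m ≤ n
double-cancel-≤ {zero}  {n}     _  = z≤n
double-cancel-≤ {suc m} {zero}  le with s≤s⁻¹ (≤-trans (≤-reflexive (sym (*-suc 2 m))) le)
... | ()
double-cancel-≤ {suc m} {suc n} le = s≤s (double-cancel-≤ (s≤s⁻¹ (s≤s⁻¹
  (≤-trans (≤-reflexive (sym (*-suc 2 m))) (≤-trans le (≤-reflexive (cong suc (*-suc 2 n))))))))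

val-subWith : ∀ b c a → val b + bit c ≤ val a →
  val (subWith (b ∙ c) a) + (val b + bit c) ≡ val a
val-subWith b c nil le = n≤0⇒n≡0 le
val-subWith b c (e ∙ a) le = begin
    x + 2 * r + (val b + bit c)
      ≡⟨ cong (λ k → x + 2 * r + (k + bit c)) (sym (val-hd-tl b)) ⟩
    x + 2 * r + (h + 2 * v + bit c)
      ≡⟨ regroup₁ x r h v (bit c) ⟩
    x + (h + bit c) + (2 * r + 2 * v)
      ≡⟨ cong (_+ (2 * r + 2 * v)) (bit-xor₃-borrow e (hdT b) c) ⟩
    bit e + 2 * bit w + (2 * r + 2 * v)
      ≡⟨ regroup₂ (bit e) (bit w) r v ⟩
    bit e + 2 * (r + (v + bit w))
      ≡⟨ cong (λ k → bit e + 2 * k) (val-subWith (tlT b) w a (double-cancel-≤ ineq)) ⟩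
    bit e + 2 * val a ∎
  where
  open ≡-Reasoning
  w = borrow e (hdT b) c
  x = bit (xor₃ e (hdT b) c)
  r = val (subWith (tlT b ∙ w) a)
  h = bit (hdT b)
  v = val (tlT b)
  regroup₁ : ∀ x r h v c → x + 2 * r + (h + 2 * v + c) ≡ x + (h + c) + (2 * r + 2 * v)
  regroup₁ = NatSolver.solve-∀
  regroup₂ : ∀ e w r v → e + 2 * w + (2 * r + 2 * v) ≡ e + 2 * (r + (v + w))
  regroup₂ = NatSolver.solve-∀
  regroup₃ : ∀ e w v → e + 2 * (v + w) ≡ e + 2 * w + 2 * v
  regroup₃ = NatSolver.solve-∀
  regroup₄ : ∀ x h c v → x + (h + c) + 2 * v ≡ x + (h + 2 * v + c)
  regroup₄ = NatSolver.solve-∀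
  regroup₅ : ∀ e a → 1 + (e + 2 * a) ≡ e + (1 + 2 * a)
  regroup₅ = NatSolver.solve-∀
  chain : bit e + 2 * (v + bit w) ≡ x + (val b + bit c)
  chain = trans (regroup₃ (bit e) (bit w) v)
    (trans (cong (_+ 2 * v) (sym (bit-xor₃-borrow e (hdT b) c)))
      (trans (regroup₄ x h (bit c) v) (cong (λ k → x + (k + bit c)) (val-hd-tl b))))
  ineq : 2 * (v + bit w) ≤ 1 + 2 * val a
  ineq = +-cancelˡ-≤ (bit e) (2 * (v + bit w)) (1 + 2 * val a)
    (≤-trans (≤-reflexive chain) (≤-trans (+-mono-≤ (bit≤1 (xor₃ e (hdT b) c)) le)
      (≤-reflexive (regroup₅ (bit e) (val a)))))

val-sub : ∀ a b → val b ≤ val a → val (subT a b) ≡ val a ℕ.∸ val b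
val-sub a b le = trans (sym (m+n∸n≡m (val (subT a b)) (val b)))
  (cong (ℕ._∸ val b) (trans (cong (λ k → val (subT a b) + k) (sym (+-identityʳ (val b))))
    (val-subWith b nil a (≤-trans (≤-reflexive (+-identityʳ (val b))) le))))

len-subWith : ∀ s a → len (subWith s a) ≡ len a
len-subWith s nil     = refl
len-subWith s (e ∙ a) = cong suc (len-subWith _ a)

truth : Tree → Bool
truth nil     = false
truth (_ ∙ _) = true

-- `r` is the verdict on the lower digits, which a differing pair of higher digits overrules.
leBit : Tree → Tree → Tree → Tree
leBit a b r = ite a (ite b r nil) (ite b one r)

leStep : Tree → Tree → Tree
leStep a s = tlT (hdT s) ∙ leBit a (hdT (hdT s)) (tlT s)

-- The verdict starts at `one` because equal numbers satisfy ≤. Digits of `b` left over after `a`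
-- has ended can only turn it to true; this is the outer fold.
leT : Tree → Tree → Tree
leT a b = st (λ e r → ite e one r) (tlT (st leStep (b ∙ one) a)) (hdT (st leStep (b ∙ one) a))

leᵖ : PT₂ leT
leᵖ = uncurried (stᵖ-additive {f = λ _ e r → ite e one r}
  (uncurried (iteᵖ (hdᵖ ∘ᵖ tlᵖ) oneᵖ (tlᵖ ∘ᵖ tlᵖ))) (tlᵖ ∘ᵖ scan) (hdᵖ ∘ᵖ scan) (con 3)
  λ x e r → size-ite≤ e _ _ (m≤n+m 3 (size r)) (m≤m+n (size r) 3))
  where
  scan : PT (λ x → st leStep (tlT x ∙ one) (hdT x))
  scan = stᵖ-additive {f = λ _ → leStep}
    (uncurried (tlᵖ ∘ᵖ hdᵖ ∘ᵖ tlᵖ ∘ᵖ tlᵖ ∙ᵖ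
      iteᵖ (hdᵖ ∘ᵖ tlᵖ)
        (iteᵖ (hdᵖ ∘ᵖ hdᵖ ∘ᵖ tlᵖ ∘ᵖ tlᵖ) (tlᵖ ∘ᵖ tlᵖ ∘ᵖ tlᵖ) nilᵖ)
        (iteᵖ (hdᵖ ∘ᵖ hdᵖ ∘ᵖ tlᵖ ∘ᵖ tlᵖ) oneᵖ (tlᵖ ∘ᵖ tlᵖ ∘ᵖ tlᵖ))))
    (tlᵖ ∙ᵖ oneᵖ) hdᵖ (con 4) bounded
    where
    leStep-size : ∀ a b c → size (leStep a (b ∙ c)) ≤ size (b ∙ c) + 4
    leStep-size a b c = s≤s (≤-trans (+-mono-≤ (size-tl b)
        (size-ite≤ a _ _
          (size-ite≤ (hdT b) _ _ (m≤m+n (size c) 4) (m≤n⇒m≤o+n (size c) (s≤s z≤n)))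
          (size-ite≤ (hdT b) _ _ (m≤n⇒m≤o+n (size c) (s≤s (s≤s (s≤s z≤n)))) (m≤m+n (size c) 4))))
      (≤-reflexive (sym (+-assoc (size b) (size c) 4))))
    bounded : ∀ x a s → size (leStep a s) ≤ size s + 4
    bounded x nil nil = s≤s (s≤s (s≤s z≤n))
    bounded x (_ ∙ _) nil = s≤s (s≤s (s≤s z≤n))
    bounded x a (b ∙ c) = leStep-size a b c

≤ᵇ-cong : ∀ {m n p q} → (m ≤ n → p ≤ q) → (p ≤ q → m ≤ n) → (m ≤ᵇ n) ≡ (p ≤ᵇ q)
≤ᵇ-cong {m} {n} {p} {q} f g with m ≤ᵇ n in eq | p ≤ᵇ q in eq′
... | true  | true  = refl
... | false | false = refl
... | true  | false with () ← subst T eq′ (≤⇒≤ᵇ (f (≤ᵇ⇒≤ m n (subst T (sym eq) _))))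
... | false | true  with () ← subst T eq (≤⇒≤ᵇ (g (≤ᵇ⇒≤ p q (subst T (sym eq′) _))))

excess : Tree → ℕ
excess r = 1 ℕ.∸ bit r

-- `excess r` is 1 when the lower digits of the first number are the greater ones. The excess passed
-- on is half of `bit e + excess r - bit h`, rounded up, and `δ` is the rounding; `leBit-correct`
-- uses that rounding does not affect a comparison of integers.
leBit-excess : ∀ e h r →
  ∃[ δ ] δ ≤ 1 × bit e + excess r + δ ≡ bit h + 2 * excess (leBit e h r)
leBit-excess nil     nil     nil     = 1 , ≤-refl , refl
leBit-excess nil     nil     (_ ∙ _) = 0 , z≤n , refl
leBit-excess nil     (_ ∙ _) nil     = 0 , z≤n , refl
leBit-excess nil     (_ ∙ _) (_ ∙ _) = 1 , ≤-refl , refl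
leBit-excess (_ ∙ _) nil     nil     = 0 , z≤n , refl
leBit-excess (_ ∙ _) nil     (_ ∙ _) = 1 , ≤-refl , refl
leBit-excess (_ ∙ _) (_ ∙ _) nil     = 1 , ≤-refl , refl
leBit-excess (_ ∙ _) (_ ∙ _) (_ ∙ _) = 0 , z≤n , refl

leBit-correct : ∀ e h r x y →
  (x + excess (leBit e h r) ≤ᵇ y) ≡ (bit e + 2 * x + excess r ≤ᵇ bit h + 2 * y)
leBit-correct e h r x y with leBit-excess e h r
... | δ , δ≤1 , eq = ≤ᵇ-cong {x + ρ} {y}
  (λ le → +-cancelʳ-≤ δ _ _ (≤-trans (≤-reflexive shift)
    (≤-trans (+-monoʳ-≤ (bit h) (*-monoʳ-≤ 2 le)) (m≤m+n _ δ))))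
  (λ le → double-cancel-≤ (+-cancelˡ-≤ (bit h) _ _ (≤-trans (≤-reflexive (sym shift))
    (≤-trans (+-mono-≤ le δ≤1) (≤-reflexive (shuffle (bit h) y))))))
  where
  ρ = excess (leBit e h r)
  regroup₁ : ∀ e x r δ → e + 2 * x + r + δ ≡ e + r + δ + 2 * x
  regroup₁ = NatSolver.solve-∀
  regroup₂ : ∀ h ρ x → h + 2 * ρ + 2 * x ≡ h + 2 * (x + ρ)
  regroup₂ = NatSolver.solve-∀
  shuffle : ∀ h y → h + 2 * y + 1 ≡ h + (1 + 2 * y)
  shuffle = NatSolver.solve-∀
  shift : bit e + 2 * x + excess r + δ ≡ bit h + 2 * (x + ρ)
  shift = trans (regroup₁ (bit e) x (excess r) δ)
    (trans (cong (_+ 2 * x) eq) (regroup₂ (bit h) ρ x))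

truth-anyBit : ∀ r t → truth (st (λ e r → ite e one r) r t) ≡ (excess r ≤ᵇ val t)
truth-anyBit nil nil     = refl
truth-anyBit (_ ∙ _) nil = refl
truth-anyBit r (e ∙ t) = trans (truth-anyBit (ite e one r) t)
  (trans (cong (λ k → 0 + excess k ≤ᵇ val t) (ite-leBit e r))
    (leBit-correct nil e r 0 (val t)))
  where
  ite-leBit : ∀ e r → ite e one r ≡ leBit nil e r
  ite-leBit nil r     = refl
  ite-leBit (_ ∙ _) r = refl

truth-leWith : ∀ a b r → let z = st leStep (b ∙ r) a in
  truth (st (λ e r → ite e one r) (tlT z) (hdT z)) ≡ (val a + excess r ≤ᵇ val b)
truth-leWith nil b r = truth-anyBit r b
truth-leWith (e ∙ a) b r = trans (truth-leWith a (tlT b) (leBit e (hdT b) r))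
  (trans (leBit-correct e (hdT b) r (val a) (val (tlT b)))
    (cong (bit e + 2 * val a + excess r ≤ᵇ_) (val-hd-tl b)))

truth-le : ∀ a b → truth (leT a b) ≡ (val a ≤ᵇ val b)
truth-le a b = trans (truth-leWith a b one) (cong (_≤ᵇ val b) (+-identityʳ (val a)))

mulT : Tree → Tree → Tree
mulT a b = fr (λ e r → addT (ite e b nil) (nil ∙ r)) nil a

val-mul : ∀ a b → val (mulT a b) ≡ val a * val b
val-mul nil b = refl
val-mul (e ∙ a) b = begin
    val (addT (ite e b nil) (nil ∙ mulT a b))
      ≡⟨ val-add (ite e b nil) (nil ∙ mulT a b) ⟩
    val (ite e b nil) + 2 * val (mulT a b)
      ≡⟨ cong₂ (λ x y → x + 2 * y) (choose e) (val-mul a b) ⟩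
    bit e * val b + 2 * (val a * val b)
      ≡⟨ regroup (bit e) (val a) (val b) ⟩
    (bit e + 2 * val a) * val b ∎
  where
  open ≡-Reasoning
  choose : ∀ e → val (ite e b nil) ≡ bit e * val b
  choose nil     = refl
  choose (_ ∙ _) = sym (+-identityʳ (val b))
  regroup : ∀ e a b → e * b + 2 * (a * b) ≡ (e + 2 * a) * b
  regroup = NatSolver.solve-∀

len-mul : ∀ a b → len (mulT a b) ≤ len b + 2 * len a
len-mul nil b = z≤n
len-mul (e ∙ a) b = ≤-trans
  (len-add (ite e b nil) (nil ∙ mulT a b) {suc (len b + 2 * len a)} (shorter e)
    (s≤s (len-mul a b)))
  (≤-reflexive (sym (trans (cong (λ k → len b + k) (*-suc 2 (len a)))
    (trans (+-suc (len b) _) (cong suc (+-suc (len b) _))))))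
  where
  shorter : ∀ e → len (ite e b nil) ≤ suc (len b + 2 * len a)
  shorter nil     = z≤n
  shorter (_ ∙ _) = m≤n⇒m≤1+n (m≤m+n (len b) _)

size-mul : ∀ a b → size (mulT a b) ≤ 1 + 4 * len (mulT a b)
size-mul nil b     = ≤-refl
size-mul (e ∙ a) b = size-add (ite e b nil) (nil ∙ mulT a b)

mulᵖ : PT₂ mulT
mulᵖ = uncurried (frᵖ {g = λ x e r → addT (ite e (tlT x) nil) (nil ∙ r)}
  (uncurried (addᵖ $₂ iteᵖ (hdᵖ ∘ᵖ tlᵖ) (tlᵖ ∘ᵖ hdᵖ) nilᵖ , (nilᵖ ∙ᵖ tlᵖ ∘ᵖ tlᵖ)))
  nilᵖ hdᵖ (con 1 ⊕ con 4 ⊗ (con 2 ⊗ var)) λ x t →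
    ≤-trans (size-mul t (tlT x)) (s≤s (*-monoʳ-≤ 4 (≤-trans (len-mul t (tlT x))
      (≤-trans (+-mono-≤ (≤-trans (len≤size (tlT x)) (size-tl x)) (*-monoʳ-≤ 2 (len≤size t)))
        (≤-trans (+-monoˡ-≤ (2 * size t) (m≤n*m (size x) 2))
          (≤-reflexive (sym (*-distribˡ-+ 2 (size x) (size t))))))))))

-- A bijective base-2 numeral with digits d₀ d₁ … has value Σ dᵢ 2ⁱ = Σ (dᵢ - 1) 2ⁱ + Σ 2ⁱ,
-- and its encoding is the bit list of the first sum.

fromBijective : Tree → Tree
fromBijective t = addT t (mapT (λ _ → one) t)

fromBijectiveᵖ : PT fromBijective
fromBijectiveᵖ = addᵖ $₂ idᵖ , mapᵖ {f = λ _ _ → one} (uncurried oneᵖ) idᵖ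

val-fromBijective : ∀ b → val (fromBijective (encodeℕᵇ b)) ≡ ℕᵇ.toℕ b
val-fromBijective b = trans (val-add (encodeℕᵇ b) _) (digits b)
  where
  digits : ∀ b → val (encodeℕᵇ b) + val (mapT (λ _ → one) (encodeℕᵇ b)) ≡ ℕᵇ.toℕ b
  digits ℕᵇ.zero = refl
  digits 2[1+ b ] = trans (regroup (val (encodeℕᵇ b)) _)
    (cong (λ k → 2 * suc k) (digits b))
    where
    regroup : ∀ x y → 1 + 2 * x + (1 + 2 * y) ≡ 2 * suc (x + y)
    regroup = NatSolver.solve-∀
  digits 1+[2 b ] = trans (regroup (val (encodeℕᵇ b)) _)
    (cong (λ k → suc (2 * k)) (digits b))
    where
    regroup : ∀ x y → 2 * x + (1 + 2 * y) ≡ suc (2 * (x + y))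
    regroup = NatSolver.solve-∀

-- Conversely the bijective digits of v are the binary digits of v + 1 without
-- the leading 1. The result is nil if there is no leading 1, else nil ∙ digits.
dropLeading : Tree → Tree
dropLeading = fr (λ e r → ite r (nil ∙ ite e one nil ∙ tlT r) (ite e one nil)) nil

toBijective : Tree → Tree
toBijective t = tlT (dropLeading (carryAdd one t))

toBijectiveᵖ : PT toBijective
toBijectiveᵖ = tlᵖ ∘ᵖ frᵖ-additive
  {g = λ _ e r → ite r (nil ∙ ite e one nil ∙ tlT r) (ite e one nil)}
  (uncurried (iteᵖ (tlᵖ ∘ᵖ tlᵖ)
    (nilᵖ ∙ᵖ iteᵖ (hdᵖ ∘ᵖ tlᵖ) oneᵖ nilᵖ ∙ᵖ tlᵖ ∘ᵖ tlᵖ ∘ᵖ tlᵖ)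
    (iteᵖ (hdᵖ ∘ᵖ tlᵖ) oneᵖ nilᵖ)))
  nilᵖ (carryAddᵖ $₂ oneᵖ , idᵖ) (con 6)
  λ x e r → size-ite≤ r _ _
    (≤-trans (s≤s (s≤s (s≤s (+-mono-≤ (digit≤ e) (size-tl r))))) (≤-reflexive (+-comm 6 (size r))))
    (≤-trans (digit≤ e) (m≤n⇒m≤o+n (size r) (s≤s (s≤s (s≤s z≤n)))))
  where
  digit≤ : ∀ e → size (ite e one nil) ≤ 3
  digit≤ e = size-ite≤ e _ _ ≤-refl (s≤s z≤n)

dropLeading-spec : ∀ t → (val t ≡ 0 × dropLeading t ≡ nil)
  ⊎ (∃[ b ] dropLeading t ≡ nil ∙ encodeℕᵇ b × val t ≡ suc (ℕᵇ.toℕ b))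
dropLeading-spec nil = inj₁ (refl , refl)
dropLeading-spec (e ∙ t) with dropLeading t | dropLeading-spec t
dropLeading-spec (nil ∙ t) | _ | inj₁ (v , refl) = inj₁ (cong (2 *_) v , refl)
dropLeading-spec ((_ ∙ _) ∙ t) | _ | inj₁ (v , refl) =
  inj₂ (ℕᵇ.zero , refl , cong (λ k → 1 + 2 * k) v)
dropLeading-spec (nil ∙ t) | _ | inj₂ (b , refl , v) =
  inj₂ (1+[2 b ] , refl , trans (cong (2 *_) v) (*-suc 2 (ℕᵇ.toℕ b)))
dropLeading-spec ((_ ∙ _) ∙ t) | _ | inj₂ (b , refl , v) =
  inj₂ (2[1+ b ] , refl , cong (λ k → 1 + 2 * k) v)

toBijective-correct : ∀ t → toBijective t ≡ encodeℕ (val t)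
toBijective-correct t with dropLeading (carryAdd one t) | dropLeading-spec (carryAdd one t)
... | _ | inj₁ (v , refl) with () ← trans (sym (val-carryAdd one t)) v
... | _ | inj₂ (b , refl , v) = cong encodeℕᵇ
  (trans (sym (fromℕ-toℕ b)) (cong ℕᵇ.fromℕ
    (suc-injective (trans (sym v) (val-carryAdd one t)))))

-- The cutting procedure on a subdivided line

data Status : Set where
  free kept : Status
  cutAt     : ℕ → Status

-- Cut positions are measured in half the unit of the grid points lo and hi.
record Seg : Set where
  constructor seg
  field
    lo hi  : ℕ
    status : Status

open Seg

-- Free segments make up the complement of R. Both `kept` and `cutAt` mean membership in R; they
-- differ in whether the sign changes within the segment.
isFree isCut : Status → Bool
isFree free      = true
isFree kept      = false
isFree (cutAt _) = false
isCut free      = false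
isCut kept      = false
isCut (cutAt _) = true

inside : ℕ → ℕ → Seg → Bool
inside u v x = (u ≤ᵇ lo x) ∧ (hi x ≤ᵇ v)

active : ℕ → ℕ → Seg → Bool
active u v x = inside u v x ∧ isFree (status x)

-- The sign true stands for -.
exit : Bool → Seg → Bool
exit s x = s xor isCut (status x)

-- P - N is the signed length of the active segments.
sums : ℕ → ℕ → Bool → ℕ → ℕ → List Seg → ℕ × ℕ
sums u v s P N []       = P , N
sums u v s P N (x ∷ xs) = when active u v x
  then (when s then sums u v s (P + lo x) (N + hi x) xs
             else sums u v s (P + hi x) (N + lo x) xs)
  else sums u v (exit s x) P N xs

-- The potential A - B starts at minus the signed length ρ of the active segments
-- and gains twice the signed length of each active segment, so it ends at ρ.
-- The cut is placed at the first zero.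
place : ℕ → ℕ → Bool → Bool → ℕ → ℕ → List Seg → List Seg
place u v found s A B []       = []
place u v found s A B (x ∷ xs) = when active u v x
  then (when found
    then seg (lo x) (hi x) kept ∷ place u v true s A B xs
    else when crosses
      then seg (lo x) (hi x) (cutAt (2 * lo x + (V ∸ U))) ∷ place u v true s A B xs
      else seg (lo x) (hi x) kept ∷ place u v false s A′ B′ xs)
  else x ∷ place u v found (exit s x) A B xs
  where
  U  = when s then B else A
  V  = when s then A else B
  crosses = (U ≤ᵇ V) ∧ (V + 2 * lo x ≤ᵇ U + 2 * hi x)
  A′ = A + 2 * (when s then lo x else hi x)
  B′ = B + 2 * (when s then hi x else lo x)

step : ℕ → ℕ → List Seg → List Seg
step u v xs = let (P , N) = sums u v false 0 0 xs in place u v false false N P xs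

-- Signed lengths, in the unit of the cut positions

raw : Seg → ℤ
raw (seg l r (cutAt X)) = + (X ∸ 2 * l) ℤ.- + (2 * r ∸ X)
raw (seg l r _)         = + (2 * r ∸ 2 * l)

signed : Bool → ℤ → ℤ
signed true  i = ℤ.- i
signed false i = i

disp : Bool → Seg → ℤ
disp s x = signed s (raw x)

ValidCut : Seg → Set
ValidCut (seg l r (cutAt X)) = 2 * l ≤ X × X ≤ 2 * r
ValidCut _                   = ⊤

Valid : Seg → Set
Valid x = lo x ≤ hi x × ValidCut x

width : Seg → ℕ
width x = 2 * hi x ∸ 2 * lo x

+-∸ : ∀ {m n} → n ≤ m → + (m ∸ n) ≡ + m ℤ.- + n
+-∸ {m} {n} n≤m = trans (sym (ℤₚ.⊖-≥ n≤m)) (sym (ℤₚ.m-n≡m⊖n m n))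

∣raw∣≤width : ∀ x → Valid x → ∣ raw x ∣ ≤ width x
∣raw∣≤width (seg l r free)      _ = ≤-refl
∣raw∣≤width (seg l r kept)      _ = ≤-refl
∣raw∣≤width (seg l r (cutAt X)) (_ , l≤X , X≤r) =
  ≤-trans (ℤₚ.∣i-j∣≤∣i∣+∣j∣ (+ (X ∸ 2 * l)) (+ (2 * r ∸ X)))
    (≤-reflexive (trans (+-comm (X ∸ 2 * l) (2 * r ∸ X))
      (trans (sym (+-∸-assoc (2 * r ∸ X) l≤X)) (cong (_∸ 2 * l) (m∸n+n≡m X≤r)))))

∣signed∣ : ∀ s i → ∣ signed s i ∣ ≡ ∣ i ∣
∣signed∣ true  = ℤₚ.∣-i∣≡∣i∣
∣signed∣ false i = refl

∣disp∣≤width : ∀ s x → Valid x → ∣ disp s x ∣ ≤ width x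
∣disp∣≤width s x v = ≤-trans (≤-reflexive (∣signed∣ s (raw x))) (∣raw∣≤width x v)

signed-not : ∀ s i → signed (not s) i ≡ ℤ.- signed s i
signed-not true  i = sym (ℤₚ.neg-involutive i)
signed-not false i = refl

disp-not : ∀ s x → disp (not s) x ≡ ℤ.- disp s x
disp-not s x = signed-not s (raw x)

exit-not : ∀ s x → exit (not s) x ≡ not (exit s x)
exit-not s x = sym (Boolₚ.not-distribˡ-xor s (isCut (status x)))

-- The mark true is for the segments that were free at some fixed stage of the algorithm.

Marked : Set
Marked = Bool × Seg

free? : Marked → Bool
free? = proj₁

Sum : (Marked → Bool) → Bool → List Marked → ℤ
Sum p s []       = 0ℤ
Sum p s (z ∷ zs) = (when p z then disp s (proj₂ z) else 0ℤ) ℤ.+ Sum p (exit s (proj₂ z)) zs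

total : Bool → List Marked → ℤ
total = Sum (λ _ → true)

exits : Bool → List Marked → Bool
exits s []       = s
exits s (z ∷ zs) = exits (exit s (proj₂ z)) zs

widths : List Marked → ℕ
widths []       = 0
widths (z ∷ zs) = width (proj₂ z) + widths zs

AllValid : List Marked → Set
AllValid = All (Valid ∘ proj₂)

Sum-++ : ∀ p s ys zs → Sum p s (ys ++ zs) ≡ Sum p s ys ℤ.+ Sum p (exits s ys) zs
Sum-++ p s []       zs = sym (ℤₚ.+-identityˡ _)
Sum-++ p s (y ∷ ys) zs = trans
  (cong (λ k → (when p y then disp s (proj₂ y) else 0ℤ) ℤ.+ k) (Sum-++ p (exit s (proj₂ y)) ys zs))
  (sym (ℤₚ.+-assoc (when p y then disp s (proj₂ y) else 0ℤ) _ _))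

Sum-cong : ∀ {p q} s {zs} → All (λ z → p z ≡ q z) zs → Sum p s zs ≡ Sum q s zs
Sum-cong s []                  = refl
Sum-cong s {z ∷ zs} (eq ∷ eqs) = cong₂
  (λ b k → (when b then disp s (proj₂ z) else 0ℤ) ℤ.+ k) eq (Sum-cong (exit s (proj₂ z)) eqs)

Sum-none : ∀ s zs → Sum (λ _ → false) s zs ≡ 0ℤ
Sum-none s []       = refl
Sum-none s (z ∷ zs) = trans (ℤₚ.+-identityˡ _) (Sum-none (exit s (proj₂ z)) zs)

Sum-not : ∀ p s zs → Sum p (not s) zs ≡ ℤ.- Sum p s zs
Sum-not p s []       = refl
Sum-not p s (z ∷ zs) = trans
  (cong₂ ℤ._+_ (head (p z))
    (trans (cong (λ b → Sum p b zs) (exit-not s (proj₂ z))) (Sum-not p (exit s (proj₂ z)) zs)))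
  (sym (ℤₚ.neg-distrib-+ (when p z then disp s (proj₂ z) else 0ℤ) _))
  where
  head : ∀ b → (when b then disp (not s) (proj₂ z) else 0ℤ) ≡ ℤ.- (when b then disp s (proj₂ z) else 0ℤ)
  head true  = disp-not s (proj₂ z)
  head false = refl

∣Sum∣≤widths : ∀ p s zs → AllValid zs → ∣ Sum p s zs ∣ ≤ widths zs
∣Sum∣≤widths p s []       []       = z≤n
∣Sum∣≤widths p s (z ∷ zs) (v ∷ vs) = ≤-trans
  (ℤₚ.∣i+j∣≤∣i∣+∣j∣ (when p z then disp s (proj₂ z) else 0ℤ) _)
  (+-mono-≤ (head (p z)) (∣Sum∣≤widths p (exit s (proj₂ z)) zs vs))
  where
  head : ∀ b → ∣ (when b then disp s (proj₂ z) else 0ℤ) ∣ ≤ width (proj₂ z)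
  head true  = ∣disp∣≤width s (proj₂ z) v
  head false = z≤n

-- E is the signed length of the unmarked segments so far.

advance : ℤ → Bool → Marked → ℤ
advance E s (b , x) = when b then E else E ℤ.+ disp s x

-- The invariant on E for the set R of unmarked segments, tested at segment ends, where all points
-- of interest lie; `m` stands for λ/4.
Cert : ℕ → ℤ → Bool → List Marked → Set
Cert m E s []       = ∣ E ∣ ≤ m
Cert m E s (z ∷ zs) =
  ∣ E ∣ ≤ m × (free? z ≡ true → E ≡ 0ℤ) × Cert m (advance E s z) (exit s (proj₂ z)) zs

final : ℤ → Bool → List Marked → ℤ
final E s []       = E
final E s (z ∷ zs) = final (advance E s z) (exit s (proj₂ z)) zs

Cert-start : ∀ {m E s} zs → Cert m E s zs → ∣ E ∣ ≤ m
Cert-start []       c = c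
Cert-start (_ ∷ _) (c , _) = c

Cert-end : ∀ {m E s} zs → Cert m E s zs → ∣ final E s zs ∣ ≤ m
Cert-end []       c = c
Cert-end (z ∷ zs) (_ , _ , c) = Cert-end zs c

Cert-mono : ∀ {m n E s} zs → m ≤ n → Cert m E s zs → Cert n E s zs
Cert-mono []       m≤n c           = ≤-trans c m≤n
Cert-mono (z ∷ zs) m≤n (b , f , c) = ≤-trans b m≤n , f , Cert-mono zs m≤n c

Cert-++⁻ : ∀ {m E s} ys zs → Cert m E s (ys ++ zs) →
  Cert m E s ys × Cert m (final E s ys) (exits s ys) zs
Cert-++⁻ []       zs c = Cert-start zs c , c
Cert-++⁻ (y ∷ ys) zs (b , f , c) with Cert-++⁻ ys zs c
... | c₁ , c₂ = (b , f , c₁) , c₂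

Cert-++⁺ : ∀ {m E s} ys zs → Cert m E s ys → Cert m (final E s ys) (exits s ys) zs →
  Cert m E s (ys ++ zs)
Cert-++⁺ []       zs c₁ c₂ = c₂
Cert-++⁺ (y ∷ ys) zs (b , f , c₁) c₂ = b , f , Cert-++⁺ ys zs c₁ c₂

advance-not : ∀ E s z → advance (ℤ.- E) (not s) z ≡ ℤ.- advance E s z
advance-not E s (true  , x) = refl
advance-not E s (false , x) = trans (cong (λ k → ℤ.- E ℤ.+ k) (disp-not s x))
  (sym (ℤₚ.neg-distrib-+ E (disp s x)))

Cert-not : ∀ {m E s} zs → Cert m E s zs → Cert m (ℤ.- E) (not s) zs
Cert-not {m} {E} [] c = subst (_≤ m) (sym (ℤₚ.∣-i∣≡∣i∣ E)) c
Cert-not {m} {E} {s} (z ∷ zs) (b , f , c) =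
  subst (_≤ m) (sym (ℤₚ.∣-i∣≡∣i∣ E)) b , (λ eq → cong ℤ.-_ (f eq)) ,
  subst (λ e → Cert m e (exit (not s) (proj₂ z)) zs) (sym (advance-not E s z))
    (subst (λ b → Cert m (ℤ.- advance E s z) b zs) (sym (exit-not s (proj₂ z))) (Cert-not zs c))

-- Each segment is counted either in E or in the marked sum.
final+Sum : ∀ E s zs → final E s zs ℤ.+ Sum free? s zs ≡ E ℤ.+ total s zs
final+Sum E s [] = refl
final+Sum E s ((true , x) ∷ zs) = begin
    f ℤ.+ (d ℤ.+ S)          ≡⟨ lem f d S ⟩
    d ℤ.+ (f ℤ.+ S)          ≡⟨ cong (λ k → d ℤ.+ k) (final+Sum E (exit s x) zs) ⟩
    d ℤ.+ (E ℤ.+ T′)         ≡⟨ lem d E T′ ⟩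
    E ℤ.+ (d ℤ.+ T′)         ∎
  where
  open ≡-Reasoning
  f = final E (exit s x) zs
  d = disp s x
  S = Sum free? (exit s x) zs
  T′ = total (exit s x) zs
  lem : ∀ a b c → a ℤ.+ (b ℤ.+ c) ≡ b ℤ.+ (a ℤ.+ c)
  lem = IntSolver.solve-∀
final+Sum E s ((false , x) ∷ zs) = trans
  (cong (λ k → final (E ℤ.+ disp s x) (exit s x) zs ℤ.+ k) (ℤₚ.+-identityˡ _))
  (trans (final+Sum (E ℤ.+ disp s x) (exit s x) zs) (ℤₚ.+-assoc E (disp s x) _))

≤-swap-+ : ∀ {a b c d e f} → a ≤ b + c → b + d ≤ e → c ≤ f → a + d ≤ f + e
≤-swap-+ {a} {b} {c} {d} {e} {f} h₁ h₂ h₃ = ≤-trans (+-monoˡ-≤ d h₁)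
  (≤-trans (≤-reflexive (lem b c d)) (+-mono-≤ h₃ h₂))
  where
  lem : ∀ b c d → b + c + d ≡ c + (b + d)
  lem = NatSolver.solve-∀

Sum-unmarked : ∀ s x zs → Sum free? s ((false , x) ∷ zs) ≡ Sum free? (exit s x) zs
Sum-unmarked s x zs = ℤₚ.+-identityˡ (Sum free? (exit s x) zs)

-- A marked segment pins E to 0, so on its way there E cannot exceed the distance.
Sum-before : ∀ {m E s} zs → AllValid zs → Cert m E s zs →
  Sum free? s zs ≡ 0ℤ ⊎ ∣ E ∣ + ∣ Sum free? s zs ∣ ≤ widths zs
Sum-before [] _ c = inj₁ refl
Sum-before {E = E} {s} ((true , x) ∷ zs) vs (b , f , c) = inj₂
  (≤-trans (≤-reflexive (cong (λ e → ∣ e ∣ + ∣ Sum free? s ((true , x) ∷ zs) ∣) (f refl)))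
    (∣Sum∣≤widths free? s ((true , x) ∷ zs) vs))
Sum-before {E = E} {s} ((false , x) ∷ zs) (v ∷ vs) (b , f , c)
  with Sum-before zs vs c
... | inj₁ eq = inj₁ (trans (Sum-unmarked s x zs) eq)
... | inj₂ le = inj₂ (≤-swap-+ {b = ∣ E ℤ.+ disp s x ∣} {c = ∣ disp s x ∣}
    (≤-trans (≤-reflexive (cong ∣_∣ (lem E (disp s x)))) (ℤₚ.∣i-j∣≤∣i∣+∣j∣ (E ℤ.+ disp s x) (disp s x)))
    (subst (λ k → ∣ E ℤ.+ disp s x ∣ + ∣ k ∣ ≤ widths zs) (sym (Sum-unmarked s x zs)) le)
    (∣disp∣≤width s x v))
  where
  lem : ∀ e d → e ≡ e ℤ.+ d ℤ.- d
  lem = IntSolver.solve-∀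

-- The mirror image of `Sum-before`: at the first marked segment E is 0, and from there on each
-- segment spends its width on only one of the two quantities, as `split` shows.
Sum-after : ∀ {m E s} zs → AllValid zs → Cert m E s zs →
  Sum free? s zs ≡ 0ℤ ⊎ ∣ final E s zs ∣ + ∣ Sum free? s zs ∣ ≤ widths zs
Sum-after [] _ c = inj₁ refl
Sum-after {E = E} {s} ((true , x) ∷ zs) (v ∷ vs) (b , f , c) = inj₂ (begin
    ∣ final E s′ zs ∣ + ∣ d ℤ.+ S ∣
      ≤⟨ +-monoʳ-≤ (∣ final E s′ zs ∣) (ℤₚ.∣i+j∣≤∣i∣+∣j∣ d S) ⟩
    ∣ final E s′ zs ∣ + (∣ d ∣ + ∣ S ∣)
      ≡⟨ lem (∣ final E s′ zs ∣) (∣ d ∣) (∣ S ∣) ⟩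
    ∣ d ∣ + (∣ final E s′ zs ∣ + ∣ S ∣)
      ≤⟨ +-mono-≤ (∣disp∣≤width s x v)
           (subst (λ e → ∣ final e s′ zs ∣ + ∣ S ∣ ≤ widths zs) (sym (f refl)) (fromZero s′ zs vs)) ⟩
    width x + widths zs ∎)
  where
  open ≤-Reasoning
  s′ = exit s x
  d = disp s x
  S = Sum free? s′ zs
  lem : ∀ a b c → a + (b + c) ≡ b + (a + c)
  lem = NatSolver.solve-∀
  split : ∀ E s zs → AllValid zs → ∣ final E s zs ∣ + ∣ Sum free? s zs ∣ ≤ ∣ E ∣ + widths zs
  split E s [] [] = ≤-reflexive refl
  split E s ((true , x) ∷ zs) (v ∷ vs) = ≤-trans
    (+-monoʳ-≤ (∣ final E (exit s x) zs ∣) (ℤₚ.∣i+j∣≤∣i∣+∣j∣ (disp s x) _))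
    (≤-trans (≤-reflexive (lem (∣ final E (exit s x) zs ∣) (∣ disp s x ∣) _))
      (≤-trans (+-mono-≤ (∣disp∣≤width s x v) (split E (exit s x) zs vs))
        (≤-reflexive (lem (width x) (∣ E ∣) (widths zs)))))
  split E s ((false , x) ∷ zs) (v ∷ vs) = ≤-trans
    (≤-reflexive (cong (λ k → ∣ final (E ℤ.+ disp s x) (exit s x) zs ∣ + ∣ k ∣) (Sum-unmarked s x zs)))
    (≤-trans (split (E ℤ.+ disp s x) (exit s x) zs vs)
      (≤-trans (+-monoˡ-≤ (widths zs) (≤-trans (ℤₚ.∣i+j∣≤∣i∣+∣j∣ E (disp s x))
          (+-monoʳ-≤ (∣ E ∣) (∣disp∣≤width s x v))))
        (≤-reflexive (+-assoc (∣ E ∣) (width x) (widths zs)))))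
  fromZero : ∀ s zs → AllValid zs → ∣ final 0ℤ s zs ∣ + ∣ Sum free? s zs ∣ ≤ widths zs
  fromZero s zs vs = split 0ℤ s zs vs
Sum-after {E = E} {s} ((false , x) ∷ zs) (v ∷ vs) (b , f , c)
  with Sum-after zs vs c
... | inj₁ eq = inj₁ (trans (Sum-unmarked s x zs) eq)
... | inj₂ le = inj₂ (≤-trans
  (≤-reflexive (cong (λ k → ∣ final (E ℤ.+ disp s x) (exit s x) zs ∣ + ∣ k ∣) (Sum-unmarked s x zs)))
  (≤-trans le (m≤n+m (widths zs) (width x))))

≤ᵇ-true : ∀ {m n} → m ≤ n → (m ≤ᵇ n) ≡ true
≤ᵇ-true {m} {n} le with m ≤ᵇ n in eq
... | true  = refl
... | false = ⊥-elim (subst T eq (≤⇒≤ᵇ le))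

≤ᵇ-false : ∀ {m n} → n < m → (m ≤ᵇ n) ≡ false
≤ᵇ-false {m} {n} lt with m ≤ᵇ n in eq
... | false = refl
... | true  = ⊥-elim (<⇒≱ lt (≤ᵇ⇒≤ m n (subst T (sym eq) tt)))

≤ᵇ-true⁻ : ∀ {m n} → (m ≤ᵇ n) ≡ true → m ≤ n
≤ᵇ-true⁻ {m} {n} eq = ≤ᵇ⇒≤ m n (subst T (sym eq) tt)

≤ᵇ-false⁻ : ∀ {m n} → (m ≤ᵇ n) ≡ false → n < m
≤ᵇ-false⁻ {m} {n} eq = ≰⇒> (λ le → case (trans (sym eq) (≤ᵇ-true le)))
  where
  case : ¬ (false ≡ true)
  case ()

-- Chains of adjacent segments and their division at a grid point

Chain : ℕ → List Marked → ℕ → Set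
Chain p []             q = p ≡ q
Chain p ((b , x) ∷ zs) q = lo x ≡ p × lo x ≤ hi x × Chain (hi x) zs q

Avoids : ℕ → List Marked → Set
Avoids t = All (λ z → t ≤ lo (proj₂ z) ⊎ hi (proj₂ z) ≤ t)

Chain-≤ : ∀ {p q} zs → Chain p zs q → p ≤ q
Chain-≤ []             refl          = ≤-refl
Chain-≤ ((b , x) ∷ zs) (refl , h , c) = ≤-trans h (Chain-≤ zs c)

Within : ℕ → ℕ → Marked → Set
Within p q (b , x) = p ≤ lo x × lo x ≤ hi x × hi x ≤ q

Chain-within : ∀ {p q} zs → Chain p zs q → All (Within p q) zs
Chain-within []             c              = []
Chain-within ((b , x) ∷ zs) (refl , h , c) = (≤-refl , h , Chain-≤ zs c) ∷
  All.map (λ (p≤ , r) → ≤-trans h p≤ , r) (Chain-within zs c)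

Chain-widths : ∀ {p q} zs → Chain p zs q → widths zs + 2 * p ≡ 2 * q
Chain-widths []             refl           = refl
Chain-widths {q = q} ((b , x) ∷ zs) (refl , h , c) = begin
    (2 * hi x ∸ 2 * lo x) + widths zs + 2 * lo x   ≡⟨ lem (2 * hi x ∸ 2 * lo x) (widths zs) (2 * lo x) ⟩
    widths zs + (2 * hi x ∸ 2 * lo x + 2 * lo x)   ≡⟨ cong (λ k → widths zs + k) (m∸n+n≡m (*-monoʳ-≤ 2 h)) ⟩
    widths zs + 2 * hi x                           ≡⟨ Chain-widths zs c ⟩
    2 * q ∎
  where
  open ≡-Reasoning
  lem : ∀ a b c → a + b + c ≡ b + (a + c)
  lem = NatSolver.solve-∀

record Split (P R : Marked → Set) (p t q : ℕ) (zs : List Marked) : Set where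
  constructor mkSplit
  field
    pre post  : List Marked
    eq        : zs ≡ pre ++ post
    chainPre  : Chain p pre t
    chainPost : Chain t post q
    allPre    : All P pre
    allPost   : All R post

-- Grid points may coincide, which creates segments of length zero. Those at `t` go to the right
-- part here and to the left part in `splitHigh`; dividing at the left end of an interval by the one
-- and at the right end by the other collects exactly the segments that `inside` accepts.
splitLow : ∀ {p t q} zs → Chain p zs q → Avoids t zs → p ≤ t → t ≤ q →
  Split (λ z → lo (proj₂ z) < t) (λ _ → ⊤) p t q zs
splitLow [] refl [] p≤t t≤q with refl ← ≤-antisym p≤t t≤q = mkSplit [] [] refl refl refl [] []
splitLow {t = t} ((b , x) ∷ zs) (refl , h , c) (av ∷ avs) p≤t t≤q with lo x <? t | av
... | no ≮ | _ with refl ← ≤-antisym p≤t (≮⇒≥ ≮) =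
  mkSplit [] ((b , x) ∷ zs) refl refl (refl , h , c) [] (All.universal (λ _ → tt) _)
... | yes lt | inj₁ t≤lo = ⊥-elim (<⇒≱ lt t≤lo)
... | yes lt | inj₂ hi≤t with splitLow zs c avs hi≤t t≤q
...   | mkSplit ys ws refl c₁ c₂ a₁ a₂ =
  mkSplit ((b , x) ∷ ys) ws refl (refl , h , c₁) c₂ (lt ∷ a₁) a₂

splitHigh : ∀ {p t q} zs → Chain p zs q → Avoids t zs → p ≤ t → t ≤ q →
  Split (λ _ → ⊤) (λ z → t < hi (proj₂ z)) p t q zs
splitHigh [] refl [] p≤t t≤q with refl ← ≤-antisym p≤t t≤q = mkSplit [] [] refl refl refl [] []
splitHigh {t = t} ((b , x) ∷ zs) (refl , h , c) (av ∷ avs) p≤t t≤q with t <? hi x | av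
... | no ≮ | _ with splitHigh zs c avs (≮⇒≥ ≮) t≤q
...   | mkSplit ys ws refl c₁ c₂ a₁ a₂ =
  mkSplit ((b , x) ∷ ys) ws refl (refl , h , c₁) c₂ (tt ∷ a₁) a₂
splitHigh {t = t} ((b , x) ∷ zs) (refl , h , c) (av ∷ avs) p≤t t≤q | yes lt | inj₂ hi≤t = ⊥-elim (<⇒≱ lt hi≤t)
splitHigh {t = t} ((b , x) ∷ zs) (refl , h , c) (av ∷ avs) p≤t t≤q | yes lt | inj₁ t≤lo
  with refl ← ≤-antisym p≤t t≤lo =
  mkSplit [] ((b , x) ∷ zs) refl refl (refl , h , c) []
    (lt ∷ All.map (λ (p≤ , l≤h , _) → <-≤-trans lt (≤-trans p≤ l≤h)) (Chain-within zs c))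

-- Unmarking a stretch on which the marked segments cancel

unmark : Marked → Marked
unmark (b , x) = false , x

final-unmark : ∀ E s zs → final E s (map unmark zs) ≡ E ℤ.+ total s zs
final-unmark E s []             = sym (ℤₚ.+-identityʳ E)
final-unmark E s ((b , x) ∷ zs) = trans (final-unmark (E ℤ.+ disp s x) (exit s x) zs)
  (ℤₚ.+-assoc E (disp s x) _)

exits-map : ∀ (f : Marked → Marked) → (∀ z → proj₂ (f z) ≡ proj₂ z) →
  ∀ s zs → exits s (map f zs) ≡ exits s zs
exits-map f h s []       = refl
exits-map f h s (z ∷ zs) = trans (exits-map f h (exit s (proj₂ (f z))) zs)
  (cong (λ x → exits (exit s x) zs) (h z))

exits-++ : ∀ s ys zs → exits s (ys ++ zs) ≡ exits (exits s ys) zs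
exits-++ s []       zs = refl
exits-++ s (y ∷ ys) zs = exits-++ (exit s (proj₂ y)) ys zs

widths-++ : ∀ ys zs → widths (ys ++ zs) ≡ widths ys + widths zs
widths-++ []       zs = refl
widths-++ (y ∷ ys) zs = trans (cong (λ k → width (proj₂ y) + k) (widths-++ ys zs))
  (sym (+-assoc (width (proj₂ y)) _ _))

double-≤ : ∀ {k a b m} → k ≤ a → k ≤ b → a + b ≤ 2 * m → k ≤ m
double-≤ {k} {a} {b} {m} k≤a k≤b h = *-cancelˡ-≤ 2
  (≤-trans (+-mono-≤ k≤a (≤-trans (≤-reflexive (+-identityʳ k)) k≤b)) h)

-- At a point of M let F be the old E, and X and Y the marked sums of M before and after the point.
-- Then X = -Y, and the new E is F + X. If X or Y is 0, this is F. Otherwise |F| + |X| is at most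
-- the length of M before the point and |F| + |Y| at most the length after it, and the shorter side
-- is at most half of M.
prefix-bound : ∀ {m m′ E s} xs ys → AllValid (xs ++ ys) → Cert m E s (xs ++ ys) →
  Sum free? s (xs ++ ys) ≡ 0ℤ → widths (xs ++ ys) ≤ 2 * m′ → m ≤ m′ →
  ∣ E ℤ.+ total s xs ∣ ≤ m′
prefix-bound {m} {m′} {E} {s} xs ys vs c bal w m≤m′ = goal (Sum-after xs vxs cxs) (Sum-before ys vys cys)
  where
  vxs = Allₚ.++⁻ˡ xs vs
  vys = Allₚ.++⁻ʳ xs vs
  cxs = proj₁ (Cert-++⁻ xs ys c)
  cys = proj₂ (Cert-++⁻ xs ys c)
  F = final E s xs
  X = Sum free? s xs
  Y = Sum free? (exits s xs) ys
  F+X : F ℤ.+ X ≡ E ℤ.+ total s xs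
  F+X = final+Sum E s xs
  X+Y : X ℤ.+ Y ≡ 0ℤ
  X+Y = trans (sym (Sum-++ free? s xs ys)) bal
  X≡-Y : X ≡ ℤ.- Y
  X≡-Y = trans (lem X Y) (trans (cong (λ k → k ℤ.- Y) X+Y) (ℤₚ.+-identityˡ (ℤ.- Y)))
    where
    lem : ∀ a b → a ≡ a ℤ.+ b ℤ.- b
    lem = IntSolver.solve-∀
  flat : X ≡ 0ℤ → ∣ E ℤ.+ total s xs ∣ ≤ m′
  flat eq = subst (λ i → ∣ i ∣ ≤ m′)
    (trans (trans (sym (ℤₚ.+-identityʳ F)) (cong (λ k → F ℤ.+ k) (sym eq))) F+X)
    (≤-trans (Cert-end xs cxs) m≤m′)
  goal : X ≡ 0ℤ ⊎ ∣ F ∣ + ∣ X ∣ ≤ widths xs → Y ≡ 0ℤ ⊎ ∣ F ∣ + ∣ Y ∣ ≤ widths ys →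
    ∣ E ℤ.+ total s xs ∣ ≤ m′
  goal (inj₁ eq) _ = flat eq
  goal (inj₂ _) (inj₁ eq) = flat (trans X≡-Y (cong ℤ.-_ eq))
  goal (inj₂ le) (inj₂ le′) = subst (λ i → ∣ i ∣ ≤ m′) F+X
    (≤-trans (ℤₚ.∣i+j∣≤∣i∣+∣j∣ F X) (double-≤ le
      (subst (λ k → ∣ F ∣ + k ≤ widths ys) (sym (trans (cong ∣_∣ X≡-Y) (ℤₚ.∣-i∣≡∣i∣ Y))) le′)
      (≤-trans (≤-reflexive (sym (widths-++ xs ys))) w)))

-- Once all of M is unmarked, E at a point is its starting value plus the whole signed length up to
-- there, the quantity that `prefix-bound` controls.
Cert-unmark : ∀ {m m′ E s} zs → AllValid zs → Cert m E s zs →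
  Sum free? s zs ≡ 0ℤ → widths zs ≤ 2 * m′ → m ≤ m′ → Cert m′ E s (map unmark zs)
Cert-unmark {m} {m′} {E} {s} zs vs c bal w m≤m′ =
  subst (λ e → Cert m′ e s (map unmark zs)) (ℤₚ.+-identityʳ E) (go [] zs refl)
  where
  Bounded : List Marked → Set
  Bounded xs = ∣ E ℤ.+ total s xs ∣ ≤ m′
  bounded : ∀ xs ys → xs ++ ys ≡ zs → Bounded xs
  bounded xs ys refl = prefix-bound xs ys vs c bal w m≤m′
  total-snoc : ∀ xs y → total s (xs ++ y ∷ []) ≡ total s xs ℤ.+ disp (exits s xs) (proj₂ y)
  total-snoc xs y = trans (Sum-++ (λ _ → true) s xs (y ∷ []))
    (cong (λ k → total s xs ℤ.+ k) (ℤₚ.+-identityʳ _))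
  go : ∀ xs ys → xs ++ ys ≡ zs → Cert m′ (E ℤ.+ total s xs) (exits s xs) (map unmark ys)
  go xs []       eq = bounded xs [] eq
  go xs (y ∷ ys) eq = bounded xs (y ∷ ys) eq , (λ ()) ,
    subst (λ e → Cert m′ e (exit (exits s xs) (proj₂ y)) (map unmark ys))
      (trans (cong (λ k → E ℤ.+ k) (total-snoc xs y)) (sym (ℤₚ.+-assoc E (total s xs) _)))
      (subst (λ b → Cert m′ (E ℤ.+ total s (xs ++ y ∷ [])) b (map unmark ys))
        (exits-++ s xs (y ∷ []))
        (go (xs ++ y ∷ []) ys (trans (Listₚ.++-assoc xs (y ∷ []) ys) eq)))

-- Adding a middle half to R

inside-true : ∀ {u v} x → u ≤ lo x → hi x ≤ v → inside u v x ≡ true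
inside-true x h₁ h₂ = cong₂ _∧_ (≤ᵇ-true h₁) (≤ᵇ-true h₂)

inside-false-lo : ∀ {u} v x → lo x < u → inside u v x ≡ false
inside-false-lo v x lt = cong (_∧ (hi x ≤ᵇ v)) (≤ᵇ-false lt)

inside-false-hi : ∀ u {v} x → v < hi x → inside u v x ≡ false
inside-false-hi u x lt = trans (cong ((u ≤ᵇ lo x) ∧_) (≤ᵇ-false lt)) (Boolₚ.∧-zeroʳ _)

remark : ℕ → ℕ → Marked → Marked
remark u v (b , x) = b ∧ not (inside u v x) , x

remark-out : ∀ u v z → inside u v (proj₂ z) ≡ false → remark u v z ≡ z
remark-out u v (b , x) eq = cong (_, x) (trans (cong (λ i → b ∧ not i) eq) (Boolₚ.∧-identityʳ b))

remark-in : ∀ u v z → inside u v (proj₂ z) ≡ true → remark u v z ≡ unmark z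
remark-in u v (b , x) eq = cong (_, x) (trans (cong (λ i → b ∧ not i) eq) (Boolₚ.∧-zeroʳ b))

map-cong-All : ∀ {f g : Marked → Marked} {zs} → All (λ z → f z ≡ g z) zs → map f zs ≡ map g zs
map-cong-All []         = refl
map-cong-All (eq ∷ eqs) = cong₂ _∷_ eq (map-cong-All eqs)

activeSum : ℕ → ℕ → Bool → List Marked → ℤ
activeSum u v = Sum (λ z → free? z ∧ inside u v (proj₂ z))

-- Outside [u , v] nothing changes: the marked segments within cancel, so E leaves [u , v] with the
-- same value as before they were unmarked.
Cert-remark : ∀ {m m′ E s p q u v} zs → Chain p zs q → AllValid zs →
  Avoids u zs → Avoids v zs → p ≤ u → u ≤ v → v ≤ q → v ≤ u + m′ → m ≤ m′ →
  activeSum u v s zs ≡ 0ℤ → Cert m E s zs → Cert m′ E s (map (remark u v) zs)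
Cert-remark {m} {m′} {E} {s} {p} {q} {u} {v} zs ch vs au av p≤u u≤v v≤q v≤ m≤ bal c
  with splitLow zs ch au p≤u (≤-trans u≤v v≤q)
... | mkSplit P R refl chP chR below _
  with splitHigh R chR (Allₚ.++⁻ʳ P av) u≤v v≤q
... | mkSplit M Q refl chM chQ _ above =
  subst (Cert m′ E s) (sym mapped) (Cert-++⁺ P (map unmark M ++ Q) (Cert-mono P m≤ cP)
    (Cert-++⁺ (map unmark M) Q (Cert-unmark M vM cM balM widthM m≤)
      (subst (λ b → Cert m′ (final F t (map unmark M)) b Q) (sym (exits-map unmark (λ _ → refl) t M))
        (subst (λ e → Cert m′ e (exits t M) Q) (sym finalM) (Cert-mono Q m≤ cQ)))))
  where
  F = final E s P
  t = exits s P
  cP = proj₁ (Cert-++⁻ P (M ++ Q) c)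
  cM = proj₁ (Cert-++⁻ M Q (proj₂ (Cert-++⁻ P (M ++ Q) c)))
  cQ = proj₂ (Cert-++⁻ M Q (proj₂ (Cert-++⁻ P (M ++ Q) c)))
  vM = Allₚ.++⁻ˡ M (Allₚ.++⁻ʳ P vs)
  outP : All (λ z → inside u v (proj₂ z) ≡ false) P
  outP = All.map (λ {z} lt → inside-false-lo v (proj₂ z) lt) below
  outQ : All (λ z → inside u v (proj₂ z) ≡ false) Q
  outQ = All.map (λ {z} lt → inside-false-hi u (proj₂ z) lt) above
  inM : All (λ z → inside u v (proj₂ z) ≡ true) M
  inM = All.map (λ {z} (l , _ , h) → inside-true (proj₂ z) l h) (Chain-within M chM)
  mapped : map (remark u v) (P ++ M ++ Q) ≡ P ++ map unmark M ++ Q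
  mapped = trans (Listₚ.map-++ (remark u v) P (M ++ Q)) (cong₂ _++_
    (trans (map-cong-All (All.map (λ {z} → remark-out u v z) outP)) (Listₚ.map-id P))
    (trans (Listₚ.map-++ (remark u v) M Q) (cong₂ _++_
      (map-cong-All (All.map (λ {z} → remark-in u v z) inM))
      (trans (map-cong-All (All.map (λ {z} → remark-out u v z) outQ)) (Listₚ.map-id Q)))))
  noneOut : ∀ b {ws} → All (λ z → inside u v (proj₂ z) ≡ false) ws → activeSum u v b ws ≡ 0ℤ
  noneOut b {ws} out = trans (Sum-cong b (All.map
    (λ {z} eq → trans (cong (free? z ∧_) eq) (Boolₚ.∧-zeroʳ (free? z))) out)) (Sum-none b ws)
  balM : Sum free? t M ≡ 0ℤ
  balM = begin
      Sum free? t M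
        ≡⟨ Sum-cong t (All.map (λ {z} eq → sym (trans (cong (free? z ∧_) eq) (Boolₚ.∧-identityʳ (free? z)))) inM) ⟩
      activeSum u v t M
        ≡⟨ lem (activeSum u v t M) ⟩
      0ℤ ℤ.+ (activeSum u v t M ℤ.+ 0ℤ)
        ≡⟨ cong₂ (λ i j → i ℤ.+ (activeSum u v t M ℤ.+ j)) (noneOut s outP) (noneOut (exits t M) outQ) ⟨
      activeSum u v s P ℤ.+ (activeSum u v t M ℤ.+ activeSum u v (exits t M) Q)
        ≡⟨ cong (λ k → activeSum u v s P ℤ.+ k) (Sum-++ _ t M Q) ⟨
      activeSum u v s P ℤ.+ activeSum u v t (M ++ Q)
        ≡⟨ Sum-++ _ s P (M ++ Q) ⟨
      activeSum u v s (P ++ M ++ Q)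
        ≡⟨ bal ⟩
      0ℤ ∎
    where
    open ≡-Reasoning
    lem : ∀ a → a ≡ 0ℤ ℤ.+ (a ℤ.+ 0ℤ)
    lem a = sym (trans (ℤₚ.+-identityˡ _) (ℤₚ.+-identityʳ a))
  widthM : widths M ≤ 2 * m′
  widthM = +-cancelʳ-≤ (2 * u) _ _ (≤-trans (≤-reflexive (Chain-widths M chM))
    (≤-trans (*-monoʳ-≤ 2 v≤) (≤-reflexive (trans (*-distribˡ-+ 2 u m′) (+-comm (2 * u) (2 * m′))))))
  finalM : final F t (map unmark M) ≡ final F t M
  finalM = trans (final-unmark F t M) (trans (sym (final+Sum F t M))
    (trans (cong (λ k → final F t M ℤ.+ k) balM) (ℤₚ.+-identityʳ _)))

≤-half : ∀ {b m i} j → i ≡ 0ℤ ⊎ ∣ j ∣ + ∣ i ∣ ≤ b → ∣ j ∣ ≤ m → b ≤ m →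
  ∣ j ℤ.+ i ∣ ≤ m × ∣ j ℤ.- i ∣ ≤ m
≤-half {m = m} j (inj₁ refl) a≤ b≤ =
  subst (λ k → ∣ k ∣ ≤ m) (sym (ℤₚ.+-identityʳ j)) a≤ ,
  subst (λ k → ∣ k ∣ ≤ m) (sym (ℤₚ.+-identityʳ j)) a≤
≤-half {i = i} j (inj₂ le) a≤ b≤ =
  ≤-trans (ℤₚ.∣i+j∣≤∣i∣+∣j∣ j i) (≤-trans le b≤) ,
  ≤-trans (ℤₚ.∣i-j∣≤∣i∣+∣j∣ j i) (≤-trans le b≤)

Reserved : ℕ → ℕ → List Marked → Set
Reserved u v = All (λ z → inside u v (proj₂ z) ≡ true → free? z ≡ false)

-- With E the signed length of the unmarked segments and H that of the marked ones, the
-- signed length of [a , b] is (E b + H (v , b)) - (E a - H (a , u)), since H (u , v) = 0.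
satisfied : ∀ {m E s p q a u v b} zs → Chain p zs q → AllValid zs → Cert m E s zs →
  Avoids a zs → Avoids u zs → Avoids v zs → Avoids b zs → Reserved u v zs →
  p ≤ a → a ≤ u → u ≤ v → v ≤ b → b ≤ q → 2 * u ≤ 2 * a + m → 2 * b ≤ 2 * v + m →
  ∣ Sum (λ z → inside a b (proj₂ z)) s zs ∣ ≤ 2 * m
satisfied {m} {E} {s} {p} {q} {a} {u} {v} {b} zs ch vs c aa au av ab res p≤a a≤u u≤v v≤b b≤q left right
  with splitLow zs ch aa p≤a (≤-trans a≤u (≤-trans u≤v (≤-trans v≤b b≤q)))
... | mkSplit P R refl chP chR below _
  with splitHigh R chR (Allₚ.++⁻ʳ P ab) (≤-trans a≤u (≤-trans u≤v v≤b)) b≤q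
... | mkSplit J Q refl chJ chQ _ above
  with splitLow J chJ (Allₚ.++⁻ˡ J (Allₚ.++⁻ʳ P au)) a≤u (≤-trans u≤v v≤b)
... | mkSplit L K refl chL chK _ _
  with splitHigh K chK (Allₚ.++⁻ʳ L (Allₚ.++⁻ˡ (L ++ K) (Allₚ.++⁻ʳ P av))) u≤v v≤b
... | mkSplit M N refl chM chN _ _ = goal
  where
  vJ : AllValid (L ++ M ++ N)
  vJ = Allₚ.++⁻ˡ (L ++ M ++ N) (Allₚ.++⁻ʳ P vs)
  cJ = proj₁ (Cert-++⁻ (L ++ M ++ N) Q (proj₂ (Cert-++⁻ P ((L ++ M ++ N) ++ Q) c)))
  F = final E s P
  t = exits s P
  cL = proj₁ (Cert-++⁻ L (M ++ N) cJ)
  cN = proj₂ (Cert-++⁻ M N (proj₂ (Cert-++⁻ L (M ++ N) cJ)))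
  t₁ = exits t L
  t₂ = exits t₁ M
  F₁ = final F t L
  F₂ = final F₁ t₁ M
  F₃ = final F₂ t₂ N
  rM : Reserved u v M
  rM = Allₚ.++⁻ˡ M (Allₚ.++⁻ʳ L (Allₚ.++⁻ˡ (L ++ M ++ N) (Allₚ.++⁻ʳ P res)))
  SL = Sum free? t L
  SN = Sum free? t₂ N
  widthL : widths L ≤ m
  widthL = +-cancelʳ-≤ (2 * a) _ _ (≤-trans (≤-reflexive (Chain-widths L chL))
    (≤-trans left (≤-reflexive (+-comm (2 * a) m))))
  widthN : widths N ≤ m
  widthN = +-cancelʳ-≤ (2 * v) _ _ (≤-trans (≤-reflexive (Chain-widths N chN))
    (≤-trans right (≤-reflexive (+-comm (2 * v) m))))
  leftBound : ∣ F ℤ.- SL ∣ ≤ m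
  leftBound = proj₂ (≤-half F (Sum-before L (Allₚ.++⁻ˡ L vJ) cL) (Cert-start L cL) widthL)
  rightBound : ∣ F₃ ℤ.+ SN ∣ ≤ m
  rightBound = proj₁ (≤-half F₃ (Sum-after N (Allₚ.++⁻ʳ M (Allₚ.++⁻ʳ L vJ)) cN) (Cert-end N cN) widthN)
  middle : Sum free? t₁ M ≡ 0ℤ
  middle = trans (Sum-cong t₁ (All.map (λ {z} (r , l , _ , h) → r (inside-true (proj₂ z) l h))
    (All.zip (rM , Chain-within M chM)))) (Sum-none t₁ M)
  none : ∀ s {ws} → All (λ z → inside a b (proj₂ z) ≡ false) ws →
    Sum (λ z → inside a b (proj₂ z)) s ws ≡ 0ℤ
  none s {ws} out = trans (Sum-cong s out) (Sum-none s ws)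
  onlyJ : Sum (λ z → inside a b (proj₂ z)) s (P ++ (L ++ M ++ N) ++ Q) ≡ total t (L ++ M ++ N)
  onlyJ = begin
      Sum p′ s (P ++ (L ++ M ++ N) ++ Q)
        ≡⟨ Sum-++ p′ s P _ ⟩
      Sum p′ s P ℤ.+ Sum p′ t ((L ++ M ++ N) ++ Q)
        ≡⟨ cong₂ ℤ._+_ (none s (All.map (λ {z} lt → inside-false-lo b (proj₂ z) lt) below))
             (Sum-++ p′ t (L ++ M ++ N) Q) ⟩
      0ℤ ℤ.+ (Sum p′ t (L ++ M ++ N) ℤ.+ Sum p′ (exits t (L ++ M ++ N)) Q)
        ≡⟨ cong₂ (λ i j → 0ℤ ℤ.+ (i ℤ.+ j))
             (Sum-cong t (All.map (λ {z} (l , _ , h) → inside-true (proj₂ z) l h) (Chain-within _ chJ)))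
             (none _ (All.map (λ {z} lt → inside-false-hi a (proj₂ z) lt) above)) ⟩
      0ℤ ℤ.+ (total t (L ++ M ++ N) ℤ.+ 0ℤ)
        ≡⟨ trans (ℤₚ.+-identityˡ _) (ℤₚ.+-identityʳ _) ⟩
      total t (L ++ M ++ N) ∎
    where
    open ≡-Reasoning
    p′ : Marked → Bool
    p′ z = inside a b (proj₂ z)
  -- Adding and subtracting E at u and v lets `final+Sum` trade the total on each of the three
  -- stretches for a difference of values of E and a marked sum; the marked sum on [u , v] is 0.
  ends : total t (L ++ M ++ N) ≡ (F₃ ℤ.+ SN) ℤ.- (F ℤ.- SL)
  ends = begin
      total t (L ++ M ++ N)
        ≡⟨ trans (Sum-++ _ t L (M ++ N)) (cong (λ k → total t L ℤ.+ k) (Sum-++ _ t₁ M N)) ⟩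
      TL ℤ.+ (TM ℤ.+ TN)
        ≡⟨ lem F F₁ F₂ TL TM TN ⟩
      (F ℤ.+ TL ℤ.- F₁) ℤ.+ ((F₁ ℤ.+ TM ℤ.- F₂) ℤ.+ (F₂ ℤ.+ TN)) ℤ.- F
        ≡⟨ cong₂ (λ i j → (i ℤ.- F₁) ℤ.+ j ℤ.- F) (sym (final+Sum F t L))
             (cong₂ (λ i j → (i ℤ.- F₂) ℤ.+ j) (sym (trans (cong (λ k → F₂ ℤ.+ k) (sym middle)) (final+Sum F₁ t₁ M)))
               (sym (final+Sum F₂ t₂ N))) ⟩
      (F₁ ℤ.+ SL ℤ.- F₁) ℤ.+ ((F₂ ℤ.+ 0ℤ ℤ.- F₂) ℤ.+ (F₃ ℤ.+ SN)) ℤ.- F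
        ≡⟨ lem′ F F₁ F₂ F₃ SL SN ⟩
      (F₃ ℤ.+ SN) ℤ.- (F ℤ.- SL) ∎
    where
    open ≡-Reasoning
    TL = total t L
    TM = total t₁ M
    TN = total t₂ N
    lem : ∀ F F₁ F₂ L M N → L ℤ.+ (M ℤ.+ N)
      ≡ (F ℤ.+ L ℤ.- F₁) ℤ.+ ((F₁ ℤ.+ M ℤ.- F₂) ℤ.+ (F₂ ℤ.+ N)) ℤ.- F
    lem = IntSolver.solve-∀
    lem′ : ∀ F F₁ F₂ F₃ L N → (F₁ ℤ.+ L ℤ.- F₁) ℤ.+ ((F₂ ℤ.+ 0ℤ ℤ.- F₂) ℤ.+ (F₃ ℤ.+ N)) ℤ.- F
      ≡ (F₃ ℤ.+ N) ℤ.- (F ℤ.- L)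
    lem′ = IntSolver.solve-∀
  goal : ∣ Sum (λ z → inside a b (proj₂ z)) s (P ++ (L ++ M ++ N) ++ Q) ∣ ≤ 2 * m
  goal = subst (λ i → ∣ i ∣ ≤ 2 * m) (sym (trans onlyJ ends))
    (≤-trans (ℤₚ.∣i-j∣≤∣i∣+∣j∣ (F₃ ℤ.+ SN) (F ℤ.- SL))
      (+-mono-≤ rightBound (≤-trans leftBound (≤-reflexive (sym (+-identityʳ m))))))

-- One step of the algorithm

-- The invariants of earlier agents depend on a step only through this relation, so the rule that
-- chooses the cut stays out of their proofs.
data Stepped (u v : ℕ) (x : Seg) : Seg → Set where
  same    : active u v x ≡ false → Stepped u v x x
  changed : ∀ {st} → active u v x ≡ true → isFree st ≡ false → Stepped u v x (seg (lo x) (hi x) st)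

place-stepped : ∀ u v f s A B xs → Pointwise (Stepped u v) xs (place u v f s A B xs)
place-stepped u v f s A B [] = []
place-stepped u v f s A B (x ∷ xs) with active u v x in eq
... | false = same eq ∷ place-stepped u v f (exit s x) A B xs
... | true with f
...   | true = changed eq refl ∷ place-stepped u v true s A B xs
...   | false with ((when s then B else A) ≤ᵇ (when s then A else B))
                 ∧ ((when s then A else B) + 2 * lo x ≤ᵇ (when s then B else A) + 2 * hi x)
...     | true  = changed eq refl ∷ place-stepped u v true s A B xs
...     | false = changed eq refl ∷ place-stepped u v false s _ _ xs

flags : List Seg → List Bool
flags = map (isFree ∘ status)

marked : List Seg → List Marked
marked xs = zip (flags xs) xs

∧-trueˡ : ∀ {a b} → a ∧ b ≡ true → a ≡ true
∧-trueˡ {true} eq = refl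

∧-trueʳ : ∀ {a b} → a ∧ b ≡ true → b ≡ true
∧-trueʳ {true} eq = eq

-- The flags fs of an earlier stage
Earlier : List Bool → List Seg → Set
Earlier = Pointwise (λ f x → isFree (status x) ≡ true → f ≡ true)

Earlier-stepped : ∀ {u v fs xs ys} → Pointwise (Stepped u v) xs ys → Earlier fs xs → Earlier fs ys
Earlier-stepped []                  []       = []
Earlier-stepped (same _ ∷ ps)       (e ∷ es) = e ∷ Earlier-stepped ps es
Earlier-stepped (changed _ eq ∷ ps) (e ∷ es) =
  (λ eq′ → ⊥-elim (Boolₚ.not-¬ (trans (sym eq) eq′) refl)) ∷ Earlier-stepped ps es

Earlier-refl : ∀ xs → Earlier (flags xs) xs
Earlier-refl []       = []
Earlier-refl (x ∷ xs) = id ∷ Earlier-refl xs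

-- Flipping the entry sign negates every later E, and negation fixes the starting value 0.
Cert-exit : ∀ {m s t} zs → Cert m 0ℤ s zs → Cert m 0ℤ t zs
Cert-exit {s = true}  {true}  zs c = c
Cert-exit {s = true}  {false} zs c = Cert-not zs c
Cert-exit {s = false} {true}  zs c = Cert-not zs c
Cert-exit {s = false} {false} zs c = c

-- Cuts are only placed where E = 0; they can only change the sign of E afterwards.
Cert-stepped : ∀ {m E s u v fs xs ys} → Pointwise (Stepped u v) xs ys → Earlier fs xs →
  Cert m E s (zip fs xs) → Cert m E s (zip fs ys)
Cert-stepped [] [] c = c
Cert-stepped (same _ ∷ ps) (e ∷ es) (b , f , c) = b , f , Cert-stepped ps es c
Cert-stepped {fs = true ∷ fs} {xs = x ∷ xs} (changed act _ ∷ ps) (e ∷ es) (b , f , c)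
  with refl ← f refl = b , f , Cert-exit (zip fs _) (Cert-stepped ps es c)
Cert-stepped {u = u} {v} {fs = false ∷ fs} {xs = x ∷ xs} (changed act _ ∷ ps) (e ∷ es) (b , f , c)
  with () ← e (∧-trueʳ {inside u v x} act)

marked-stepped : ∀ {u v xs ys} → Pointwise (Stepped u v) xs ys →
  marked ys ≡ map (remark u v) (zip (flags xs) ys)
marked-stepped [] = refl
marked-stepped {u} {v} {x ∷ xs} (same eq ∷ ps) = cong₂ _∷_ (cong (_, x) (head (isFree (status x)) eq)) (marked-stepped ps)
  where
  head : ∀ f → inside u v x ∧ f ≡ false → f ≡ f ∧ not (inside u v x)
  head f eq with inside u v x
  head f eq | true = trans eq (sym (Boolₚ.∧-zeroʳ f))
  head f eq | false = sym (Boolₚ.∧-identityʳ f)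
marked-stepped {u} {v} {x ∷ xs} (changed {st} eq nf ∷ ps) = cong₂ _∷_
  (cong (_, seg (lo x) (hi x) st) (trans nf (sym (trans
    (cong (λ b → isFree (status x) ∧ not b) (∧-trueˡ {inside u v x} eq)) (Boolₚ.∧-zeroʳ _)))))
  (marked-stepped ps)

-- The flag is that of `x`, the displacement that of its replacement `y`. As the ends agree, the
-- condition becomes `active u v x`, on which `place` branches.
headSum : ∀ u v s x y fs ys → lo y ≡ lo x → hi y ≡ hi x →
  activeSum u v s ((isFree (status x) , y) ∷ zip fs ys)
    ≡ (when active u v x then disp s y else 0ℤ) ℤ.+ activeSum u v (exit s y) (zip fs ys)
headSum u v s x y fs ys refl refl =
  cong (λ b → (when b then disp s y else 0ℤ) ℤ.+ activeSum u v (exit s y) (zip fs ys))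
    (Boolₚ.∧-comm (isFree (status x)) (inside u v x))

active-free : ∀ {u v} x → active u v x ≡ true → x ≡ seg (lo x) (hi x) free
active-free (seg l r free)      eq = refl
active-free {u} {v} (seg l r kept)      eq with () ← ∧-trueʳ {inside u v (seg l r kept)} eq
active-free {u} {v} (seg l r (cutAt X)) eq with () ← ∧-trueʳ {inside u v (seg l r (cutAt X))} eq

xor-false : ∀ s → s xor false ≡ s
xor-false true  = refl
xor-false false = refl

xor-true : ∀ s → s xor true ≡ not s
xor-true true  = refl
xor-true false = refl

sums-correct : ∀ u v s P N xs → All Valid xs → let (P′ , N′) = sums u v s P N xs in
  + (2 * P′) ℤ.- + (2 * N′) ≡ (+ (2 * P) ℤ.- + (2 * N)) ℤ.+ activeSum u v s (marked xs)
sums-correct u v s P N [] [] = sym (ℤₚ.+-identityʳ _)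
sums-correct u v s P N (x ∷ xs) (w ∷ ws)
  rewrite headSum u v s x x (flags xs) xs refl refl with active u v x in eq
... | false = trans (sums-correct u v (exit s x) P N xs ws)
  (cong (λ k → (+ (2 * P) ℤ.- + (2 * N)) ℤ.+ k) (sym (ℤₚ.+-identityˡ _)))
... | true with refl ← active-free {u} {v} x eq rewrite xor-false s with s
...   | false = trans (sums-correct u v false _ _ xs ws) (trans
        (cong (λ k → k ℤ.+ activeSum u v false (marked xs)) (trans
          (cong₂ (λ i j → + i ℤ.- + j) (*-distribˡ-+ 2 P (hi x)) (*-distribˡ-+ 2 N (lo x)))
          (trans (lem (+ (2 * P)) (+ (2 * hi x)) (+ (2 * N)) (+ (2 * lo x)))
            (cong (λ k → (+ (2 * P) ℤ.- + (2 * N)) ℤ.+ k) (sym (+-∸ (*-monoʳ-≤ 2 (proj₁ w))))))))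
        (ℤₚ.+-assoc (+ (2 * P) ℤ.- + (2 * N)) _ _))
  where
  lem : ∀ p h n l → (p ℤ.+ h) ℤ.- (n ℤ.+ l) ≡ (p ℤ.- n) ℤ.+ (h ℤ.- l)
  lem = IntSolver.solve-∀
...   | true = trans (sums-correct u v true _ _ xs ws) (trans
        (cong (λ k → k ℤ.+ activeSum u v true (marked xs)) (trans
          (cong₂ (λ i j → + i ℤ.- + j) (*-distribˡ-+ 2 P (lo x)) (*-distribˡ-+ 2 N (hi x)))
          (trans (lem (+ (2 * P)) (+ (2 * hi x)) (+ (2 * N)) (+ (2 * lo x)))
            (cong (λ k → (+ (2 * P) ℤ.- + (2 * N)) ℤ.+ ℤ.- k) (sym (+-∸ (*-monoʳ-≤ 2 (proj₁ w))))))))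
        (ℤₚ.+-assoc (+ (2 * P) ℤ.- + (2 * N)) _ _))
  where
  lem : ∀ p h n l → (p ℤ.+ l) ℤ.- (n ℤ.+ h) ≡ (p ℤ.- n) ℤ.+ ℤ.- (h ℤ.- l)
  lem = IntSolver.solve-∀

place-found-sum : ∀ u v s A B xs →
  activeSum u v s (zip (flags xs) (place u v true s A B xs)) ≡ activeSum u v s (marked xs)
place-found-sum u v s A B [] = refl
place-found-sum u v s A B (x ∷ xs)
  rewrite headSum u v s x x (flags xs) xs refl refl with active u v x in eq
... | false = trans
  (headSum u v s x x (flags xs) (place u v true (exit s x) A B xs) refl refl)
  (cong₂ (λ b k → (when b then disp s x else 0ℤ) ℤ.+ k) eq (place-found-sum u v (exit s x) A B xs))
... | true with refl ← active-free {u} {v} x eq = trans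
  (headSum u v s x (seg (lo x) (hi x) kept) (flags xs) (place u v true s A B xs) refl refl)
  (cong₂ (λ b k → (when b then disp s x else 0ℤ) ℤ.+ k) eq
    (trans (cong (λ t → activeSum u v t (zip (flags xs) (place u v true s A B xs))) (xor-false s))
      (trans (place-found-sum u v s A B xs)
        (cong (λ t → activeSum u v t (marked xs)) (sym (xor-false s))))))

-- Without a zero crossing, the potential A - B keeps its strict sign or has not moved.
SameSide : (A B A′ B′ : ℕ) → Set
SameSide A B A′ B′ = (B < A × B′ < A′) ⊎ (A < B × A′ < B′) ⊎ (A′ ≡ A × B′ ≡ B)

-- `T` and `T′` are the signed lengths of the active segments before and after the cut. With G = A -
-- B at the current position, `crossed` says T′ = -T - 2G. At the start of the scan G is minus half
-- of `T`, as `T` is counted in half units, and the equation becomes T′ = 0.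
data Outcome (A B : ℕ) (T T′ : ℤ) : Set where
  crossed : (T′ ℤ.+ T) ℤ.+ ((+ A ℤ.- + B) ℤ.+ (+ A ℤ.- + B)) ≡ 0ℤ → Outcome A B T T′
  missed  : ∀ A′ B′ → T′ ≡ T → (+ A′ ℤ.- + B′) ≡ (+ A ℤ.- + B) ℤ.+ T →
            SameSide A B A′ B′ → Outcome A B T T′

SameSide-trans : ∀ {A B A₁ B₁ A₂ B₂} →
  (B < A × B₁ < A₁) ⊎ (A < B × A₁ < B₁) → SameSide A₁ B₁ A₂ B₂ → SameSide A B A₂ B₂
SameSide-trans (inj₁ (h , h₁)) (inj₁ (_ , h₂)) = inj₁ (h , h₂)
SameSide-trans (inj₁ (h , h₁)) (inj₂ (inj₁ (h₂ , _))) = ⊥-elim (<-asym h₁ h₂)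
SameSide-trans (inj₁ (h , h₁)) (inj₂ (inj₂ (refl , refl))) = inj₁ (h , h₁)
SameSide-trans (inj₂ (h , h₁)) (inj₁ (h₂ , _)) = ⊥-elim (<-asym h₁ h₂)
SameSide-trans (inj₂ (h , h₁)) (inj₂ (inj₁ (_ , h₂))) = inj₂ (inj₁ (h , h₂))
SameSide-trans (inj₂ (h , h₁)) (inj₂ (inj₂ (refl , refl))) = inj₂ (inj₁ (h , h₁))

-- An active segment passed without a cut contributes `d` to both sums and to the potential G, so T
-- + T′ + 2G for the whole list equals the same expression for the rest.
Outcome-step : ∀ {A B A₁ B₁ d T T′} →
  (+ A₁ ℤ.- + B₁) ≡ (+ A ℤ.- + B) ℤ.+ d →
  (B < A × B₁ < A₁) ⊎ (A < B × A₁ < B₁) →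
  Outcome A₁ B₁ T T′ → Outcome A B (d ℤ.+ T) (d ℤ.+ T′)
Outcome-step {A} {B} {A₁} {B₁} {d} {T} {T′} eq h (crossed c) = crossed
  (trans (lem (+ A ℤ.- + B) d T T′)
    (trans (cong (λ g → (T′ ℤ.+ T) ℤ.+ (g ℤ.+ g)) (sym eq)) c))
  where
  lem : ∀ g d T T′ → ((d ℤ.+ T′) ℤ.+ (d ℤ.+ T)) ℤ.+ (g ℤ.+ g)
    ≡ (T′ ℤ.+ T) ℤ.+ ((g ℤ.+ d) ℤ.+ (g ℤ.+ d))
  lem = IntSolver.solve-∀
Outcome-step {A} {B} {d = d} {T} eq h (missed A′ B′ t g side) = missed A′ B′
  (cong (λ k → d ℤ.+ k) t)
  (trans g (trans (cong (λ k → k ℤ.+ T) eq) (lem (+ A ℤ.- + B) d T)))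
  (SameSide-trans h side)
  where
  lem : ∀ g d T → (g ℤ.+ d) ℤ.+ T ≡ g ℤ.+ (d ℤ.+ T)
  lem = ℤₚ.+-assoc

-- The new displacement is chosen to compensate the potential.
cut-disp : ∀ {A B l r s T} → l ≤ r →
  let U = when s then B else A
      V = when s then A else B in
  U ≤ V → V + 2 * l ≤ U + 2 * r →
  (disp s (seg l r (cutAt (2 * l + (V ∸ U)))) ℤ.+ ℤ.- T ℤ.+ (disp s (seg l r free) ℤ.+ T))
    ℤ.+ ((+ A ℤ.- + B) ℤ.+ (+ A ℤ.- + B)) ≡ 0ℤ
cut-disp {A} {B} {l} {r} {false} {T} l≤r U≤V le = begin
    ((i (2 * l + D ∸ 2 * l) ℤ.- i (2 * r ∸ (2 * l + D))) ℤ.+ ℤ.- T ℤ.+ (i (2 * r ∸ 2 * l) ℤ.+ T)) ℤ.+ (G ℤ.+ G)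
      ≡⟨ cong (λ k → ((i (2 * l + D ∸ 2 * l) ℤ.- i (2 * r ∸ (2 * l + D))) ℤ.+ ℤ.- T ℤ.+ (k ℤ.+ T)) ℤ.+ (G ℤ.+ G))
           (+-∸ (*-monoʳ-≤ 2 l≤r)) ⟩
    ((i (2 * l + D ∸ 2 * l) ℤ.- i (2 * r ∸ (2 * l + D))) ℤ.+ ℤ.- T ℤ.+ ((i (2 * r) ℤ.- i (2 * l)) ℤ.+ T)) ℤ.+ (G ℤ.+ G)
      ≡⟨ cong₂ (λ j k → ((i j ℤ.- k) ℤ.+ ℤ.- T ℤ.+ ((i (2 * r) ℤ.- i (2 * l)) ℤ.+ T)) ℤ.+ (G ℤ.+ G))
           (m+n∸m≡n (2 * l) D) (+-∸ fits) ⟩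
    ((i D ℤ.- (i (2 * r) ℤ.- (i (2 * l) ℤ.+ i D))) ℤ.+ ℤ.- T ℤ.+ ((i (2 * r) ℤ.- i (2 * l)) ℤ.+ T)) ℤ.+ (G ℤ.+ G)
      ≡⟨ lem (i D) (i (2 * r)) (i (2 * l)) T G ⟩
    (i D ℤ.+ G) ℤ.+ (i D ℤ.+ G)
      ≡⟨ cong (λ k → (k ℤ.+ G) ℤ.+ (k ℤ.+ G)) (+-∸ U≤V) ⟩
    ((i B ℤ.- i A) ℤ.+ G) ℤ.+ ((i B ℤ.- i A) ℤ.+ G)
      ≡⟨ lem′ (i A) (i B) ⟩
    0ℤ ∎
  where
  open ≡-Reasoning
  i : ℕ → ℤ
  i = +_
  D = B ∸ A
  G = + A ℤ.- + B
  fits : 2 * l + D ≤ 2 * r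
  fits = +-cancelˡ-≤ A _ _ (≤-trans (≤-reflexive (trans (lemℕ A (2 * l) D)
    (cong (λ k → k + 2 * l) (m+[n∸m]≡n U≤V)))) le)
    where
    lemℕ : ∀ a l d → a + (l + d) ≡ a + d + l
    lemℕ = NatSolver.solve-∀
  lem : ∀ d r l T G → ((d ℤ.- (r ℤ.- (l ℤ.+ d))) ℤ.+ ℤ.- T ℤ.+ ((r ℤ.- l) ℤ.+ T)) ℤ.+ (G ℤ.+ G)
    ≡ (d ℤ.+ G) ℤ.+ (d ℤ.+ G)
  lem = IntSolver.solve-∀
  lem′ : ∀ a b → ((b ℤ.- a) ℤ.+ (a ℤ.- b)) ℤ.+ ((b ℤ.- a) ℤ.+ (a ℤ.- b)) ≡ 0ℤ
  lem′ = IntSolver.solve-∀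
cut-disp {A} {B} {l} {r} {true} {T} l≤r U≤V le =
  trans (lem (raw (seg l r free)) (raw (seg l r (cutAt (2 * l + (A ∸ B))))) (+ A) (+ B) T)
    (cong ℤ.-_ (cut-disp {B} {A} {l} {r} {false} {ℤ.- T} l≤r U≤V le))
  where
  lem : ∀ x y a b T → ((ℤ.- y ℤ.+ ℤ.- T) ℤ.+ (ℤ.- x ℤ.+ T)) ℤ.+ ((a ℤ.- b) ℤ.+ (a ℤ.- b))
    ≡ ℤ.- (((y ℤ.+ ℤ.- (ℤ.- T)) ℤ.+ (x ℤ.+ ℤ.- T)) ℤ.+ ((b ℤ.- a) ℤ.+ (b ℤ.- a)))
  lem = IntSolver.solve-∀

-- V - U is the distance to 0 in the direction in which the potential moves. Without a crossing it
-- is either negative already or greater than the distance travelled.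
not-crossing : ∀ {U V l r} → l ≤ r → (U ≤ᵇ V) ∧ (V + 2 * l ≤ᵇ U + 2 * r) ≡ false →
  (V < U × V + 2 * l < U + 2 * r) ⊎ (U < V × U + 2 * r < V + 2 * l)
not-crossing {U} {V} {l} {r} l≤r eq with U ≤ᵇ V in le
... | false = inj₁ (≤ᵇ-false⁻ le , +-mono-<-≤ (≤ᵇ-false⁻ {U} {V} le) (*-monoʳ-≤ 2 l≤r))
... | true  = inj₂ (≤∧≢⇒< (≤ᵇ-true⁻ {U} {V} le) (λ { refl → <⇒≱ U+r<V+l (+-monoʳ-≤ U (*-monoʳ-≤ 2 l≤r)) }) , U+r<V+l)
  where
  U+r<V+l : U + 2 * r < V + 2 * l
  U+r<V+l = ≤ᵇ-false⁻ eq

-- After the cut no other segment is cut and all later ones are seen with the opposite sign;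
-- `Sum-not` turns this into a negated sum, and `cut-disp` settles the cut segment itself. Inactive
-- segments leave the potential alone, so no zero is missed between active ones.
place-outcome : ∀ u v s A B xs → All Valid xs → Outcome A B
  (activeSum u v s (marked xs)) (activeSum u v s (zip (flags xs) (place u v false s A B xs)))
place-outcome u v s A B [] [] =
  missed A B refl (sym (ℤₚ.+-identityʳ _)) (inj₂ (inj₂ (refl , refl)))
place-outcome u v s A B (x ∷ xs) (w ∷ ws)
  rewrite headSum u v s x x (flags xs) xs refl refl with active u v x in eq
... | false rewrite headSum u v s x x (flags xs) (place u v false (exit s x) A B xs) refl refl | eq
      | ℤₚ.+-identityˡ (activeSum u v (exit s x) (marked xs))
      | ℤₚ.+-identityˡ (activeSum u v (exit s x) (zip (flags xs) (place u v false (exit s x) A B xs)))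
  = place-outcome u v (exit s x) A B xs ws
... | true with refl ← active-free {u} {v} x eq
  with ((when s then B else A) ≤ᵇ (when s then A else B))
     ∧ ((when s then A else B) + 2 * lo x ≤ᵇ (when s then B else A) + 2 * hi x) in cr
...   | true rewrite
          headSum u v s x (seg (lo x) (hi x) (cutAt (2 * lo x + ((when s then A else B) ∸ (when s then B else A)))))
            (flags xs) (place u v true s A B xs) refl refl
        | eq | xor-false s | xor-true s
        | Sum-not (λ z → free? z ∧ inside u v (proj₂ z)) s (zip (flags xs) (place u v true s A B xs))
        | place-found-sum u v s A B xs
  = crossed (cut-disp {A} {B} {lo x} {hi x} {s} (proj₁ w) (≤ᵇ-true⁻ (∧-trueˡ cr)) (≤ᵇ-true⁻ (∧-trueʳ cr)))
...   | false rewrite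
          headSum u v s x (seg (lo x) (hi x) kept) (flags xs)
            (place u v false s (A + 2 * (when s then lo x else hi x)) (B + 2 * (when s then hi x else lo x)) xs) refl refl
        | eq | xor-false s
  = Outcome-step (gain s) (sides s (not-crossing (proj₁ w) cr)) (place-outcome u v s _ _ xs ws)
  where
  gain : ∀ s → + (A + 2 * (when s then lo x else hi x)) ℤ.- + (B + 2 * (when s then hi x else lo x))
    ≡ (+ A ℤ.- + B) ℤ.+ disp s x
  gain false = trans (lem (+ A) (+ (2 * hi x)) (+ B) (+ (2 * lo x)))
    (cong (λ k → (+ A ℤ.- + B) ℤ.+ k) (sym (+-∸ (*-monoʳ-≤ 2 (proj₁ w)))))
    where
    lem : ∀ p h n l → (p ℤ.+ h) ℤ.- (n ℤ.+ l) ≡ (p ℤ.- n) ℤ.+ (h ℤ.- l)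
    lem = IntSolver.solve-∀
  gain true = trans (lem (+ A) (+ (2 * hi x)) (+ B) (+ (2 * lo x)))
    (cong (λ k → (+ A ℤ.- + B) ℤ.+ ℤ.- k) (sym (+-∸ (*-monoʳ-≤ 2 (proj₁ w)))))
    where
    lem : ∀ p h n l → (p ℤ.+ l) ℤ.- (n ℤ.+ h) ≡ (p ℤ.- n) ℤ.+ ℤ.- (h ℤ.- l)
    lem = IntSolver.solve-∀
  sides : ∀ s → let U = when s then B else A
                    V = when s then A else B
                    A₁ = A + 2 * (when s then lo x else hi x)
                    B₁ = B + 2 * (when s then hi x else lo x) in
    (V < U × V + 2 * lo x < U + 2 * hi x) ⊎ (U < V × U + 2 * hi x < V + 2 * lo x) →
    (B < A × B₁ < A₁) ⊎ (A < B × A₁ < B₁)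
  sides false h = h
  sides true (inj₁ h) = inj₂ h
  sides true (inj₂ h) = inj₁ h

-- The potential runs from -ρ to ρ and so cannot keep one strict sign: either a cut was placed, or
-- the potential has not moved and ρ = -ρ.
step-balanced : ∀ u v xs → All Valid xs → activeSum u v false (zip (flags xs) (step u v xs)) ≡ 0ℤ
step-balanced u v xs ws with sums u v false 0 0 xs | sums-correct u v false 0 0 xs ws
... | P , N | τ≡ = conclude (place-outcome u v false N P xs ws)
  where
  τ = activeSum u v false (marked xs)
  p = + P
  n = + N
  τ≡2ρ : τ ≡ (p ℤ.- n) ℤ.+ (p ℤ.- n)
  τ≡2ρ = trans (sym (ℤₚ.+-identityˡ τ)) (trans (sym τ≡)
    (trans (cong₂ (λ i j → i ℤ.- j) (twice P) (twice N)) (lem p n)))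
    where
    twice : ∀ k → + (2 * k) ≡ + k ℤ.+ + k
    twice k = cong (λ j → + (k + j)) (+-identityʳ k)
    lem : ∀ p n → (p ℤ.+ p) ℤ.- (n ℤ.+ n) ≡ (p ℤ.- n) ℤ.+ (p ℤ.- n)
    lem = IntSolver.solve-∀
  conclude : ∀ {τ′} → Outcome N P τ τ′ → τ′ ≡ 0ℤ
  conclude {τ′} (crossed c) = begin
      τ′
        ≡⟨ lem τ′ τ (n ℤ.- p) ⟩
      ((τ′ ℤ.+ τ) ℤ.+ ((n ℤ.- p) ℤ.+ (n ℤ.- p))) ℤ.- (τ ℤ.+ ((n ℤ.- p) ℤ.+ (n ℤ.- p)))
        ≡⟨ cong₂ (λ i j → i ℤ.- (j ℤ.+ ((n ℤ.- p) ℤ.+ (n ℤ.- p)))) c τ≡2ρ ⟩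
      0ℤ ℤ.- (((p ℤ.- n) ℤ.+ (p ℤ.- n)) ℤ.+ ((n ℤ.- p) ℤ.+ (n ℤ.- p)))
        ≡⟨ lem′ p n ⟩
      0ℤ ∎
    where
    open ≡-Reasoning
    lem : ∀ a b c → a ≡ ((a ℤ.+ b) ℤ.+ (c ℤ.+ c)) ℤ.- (b ℤ.+ (c ℤ.+ c))
    lem = IntSolver.solve-∀
    lem′ : ∀ p n → 0ℤ ℤ.- (((p ℤ.- n) ℤ.+ (p ℤ.- n)) ℤ.+ ((n ℤ.- p) ℤ.+ (n ℤ.- p))) ≡ 0ℤ
    lem′ = IntSolver.solve-∀
  conclude {τ′} (missed A′ B′ t g side) = trans t (trans τ≡2ρ (cong₂ ℤ._+_ ρ≡0 ρ≡0))
    where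
    end : A′ + N ≡ P + B′
    end = ℤₚ.+-injective (begin
        + A′ ℤ.+ n
          ≡⟨ lem (+ A′) (+ B′) n ⟩
        (+ A′ ℤ.- + B′) ℤ.+ (+ B′ ℤ.+ n)
          ≡⟨ cong (λ k → k ℤ.+ (+ B′ ℤ.+ n)) (trans g (cong (λ k → (n ℤ.- p) ℤ.+ k) τ≡2ρ)) ⟩
        ((n ℤ.- p) ℤ.+ ((p ℤ.- n) ℤ.+ (p ℤ.- n))) ℤ.+ (+ B′ ℤ.+ n)
          ≡⟨ lem′ p n (+ B′) ⟩
        p ℤ.+ + B′ ∎)
      where
      open ≡-Reasoning
      lem : ∀ a b n → a ℤ.+ n ≡ (a ℤ.- b) ℤ.+ (b ℤ.+ n)
      lem = IntSolver.solve-∀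
      lem′ : ∀ p n b → ((n ℤ.- p) ℤ.+ ((p ℤ.- n) ℤ.+ (p ℤ.- n))) ℤ.+ (b ℤ.+ n) ≡ p ℤ.+ b
      lem′ = IntSolver.solve-∀
    equal : SameSide N P A′ B′ → P ≡ N
    equal (inj₁ (P<N , B<A)) = ⊥-elim (<-irrefl (sym end)
      (≤-trans (+-mono-< P<N B<A) (≤-reflexive (+-comm N A′))))
    equal (inj₂ (inj₁ (N<P , A<B))) = ⊥-elim (<-irrefl end
      (≤-trans (+-mono-< A<B N<P) (≤-reflexive (+-comm B′ P))))
    equal (inj₂ (inj₂ (refl , refl))) = *-cancelˡ-≡ P N 2
      (trans (cong (λ k → P + k) (+-identityʳ P)) (trans (sym end) (cong (λ k → N + k) (sym (+-identityʳ N)))))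
    ρ≡0 : p ℤ.- n ≡ 0ℤ
    ρ≡0 = trans (cong (λ k → + k ℤ.- n) (equal side)) (ℤₚ.+-inverseʳ n)

-- Number and validity of the cuts

cutsOf : List Seg → List ℕ
cutsOf []                         = []
cutsOf (seg l r (cutAt X) ∷ xs) = X ∷ cutsOf xs
cutsOf (seg l r free ∷ xs)      = cutsOf xs
cutsOf (seg l r kept ∷ xs)      = cutsOf xs

place-found-cuts : ∀ u v s A B xs → cutsOf (place u v true s A B xs) ≡ cutsOf xs
place-found-cuts u v s A B [] = refl
place-found-cuts u v s A B (x ∷ xs) with active u v x in eq
... | true with refl ← active-free {u} {v} x eq = place-found-cuts u v s A B xs
place-found-cuts u v s A B (seg l r free ∷ xs)      | false = place-found-cuts u v _ A B xs
place-found-cuts u v s A B (seg l r kept ∷ xs)      | false = place-found-cuts u v _ A B xs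
place-found-cuts u v s A B (seg l r (cutAt X) ∷ xs) | false = cong (X ∷_) (place-found-cuts u v _ A B xs)

place-cuts : ∀ u v s A B xs →
  List.length (cutsOf (place u v false s A B xs)) ≤ suc (List.length (cutsOf xs))
place-cuts u v s A B [] = z≤n
place-cuts u v s A B (x ∷ xs) with active u v x in eq
place-cuts u v s A B (seg l r free ∷ xs)      | false = place-cuts u v _ A B xs
place-cuts u v s A B (seg l r kept ∷ xs)      | false = place-cuts u v _ A B xs
place-cuts u v s A B (seg l r (cutAt X) ∷ xs) | false = s≤s (place-cuts u v _ A B xs)
... | true with refl ← active-free {u} {v} x eq
  with ((when s then B else A) ≤ᵇ (when s then A else B))
     ∧ ((when s then A else B) + 2 * lo x ≤ᵇ (when s then B else A) + 2 * hi x)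
...   | true  = s≤s (≤-reflexive (cong List.length (place-found-cuts u v s A B xs)))
...   | false = place-cuts u v s _ _ xs

place-valid : ∀ u v f s A B xs → All Valid xs → All Valid (place u v f s A B xs)
place-valid u v f s A B [] [] = []
place-valid u v f s A B (x ∷ xs) (w ∷ ws) with active u v x
... | false = w ∷ place-valid u v f (exit s x) A B xs ws
... | true with f
...   | true = (proj₁ w , tt) ∷ place-valid u v true s A B xs ws
...   | false with ((when s then B else A) ≤ᵇ (when s then A else B))
                 ∧ ((when s then A else B) + 2 * lo x ≤ᵇ (when s then B else A) + 2 * hi x) in cr
...     | true  = (proj₁ w , m≤m+n _ _ , fits) ∷ place-valid u v true s A B xs ws
  where
  U V : ℕ
  U = when s then B else A
  V = when s then A else B
  fits : 2 * lo x + (V ∸ U) ≤ 2 * hi x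
  fits = +-cancelˡ-≤ U _ _ (≤-trans (≤-reflexive (trans (lem U (2 * lo x) (V ∸ U))
    (cong (λ k → k + 2 * lo x) (m+[n∸m]≡n (≤ᵇ-true⁻ {U} {V} (∧-trueˡ cr))))))
    (≤ᵇ-true⁻ {V + 2 * lo x} {U + 2 * hi x} (∧-trueʳ {U ≤ᵇ V} cr)))
    where
    lem : ∀ a l d → a + (l + d) ≡ a + d + l
    lem = NatSolver.solve-∀
...     | false = (proj₁ w , tt) ∷ place-valid u v false s _ _ xs ws

Links : ℕ → List Seg → ℕ → Set
Links p []       q = p ≡ q
Links p (x ∷ xs) q = lo x ≡ p × lo x ≤ hi x × Links (hi x) xs q

Clears : ℕ → List Seg → Set
Clears t = All (λ x → t ≤ lo x ⊎ hi x ≤ t)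

Links-stepped : ∀ {u v p q xs ys} → Pointwise (Stepped u v) xs ys → Links p xs q → Links p ys q
Links-stepped []                 c           = c
Links-stepped (same _ ∷ ps)      (e , h , c) = e , h , Links-stepped ps c
Links-stepped (changed _ _ ∷ ps) (e , h , c) = e , h , Links-stepped ps c

Clears-stepped : ∀ {u v t xs ys} → Pointwise (Stepped u v) xs ys → Clears t xs → Clears t ys
Clears-stepped []                 []       = []
Clears-stepped (same _ ∷ ps)      (c ∷ cs) = c ∷ Clears-stepped ps cs
Clears-stepped (changed _ _ ∷ ps) (c ∷ cs) = c ∷ Clears-stepped ps cs

Links-zip : ∀ {p q fs xs} → Earlier fs xs → Links p xs q → Chain p (zip fs xs) q
Links-zip []       c           = c
Links-zip (e ∷ es) (eq , h , c) = eq , h , Links-zip es c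

All-zip : ∀ {P : Seg → Set} {fs xs} → Earlier fs xs → All P xs → All (P ∘ proj₂) (zip fs xs)
All-zip []       []       = []
All-zip (e ∷ es) (p ∷ ps) = p ∷ All-zip es ps

Reserved-stepped : ∀ u v {u′ v′ fs xs ys} → Pointwise (Stepped u′ v′) xs ys → Earlier fs xs →
  Reserved u v (zip fs xs) → Reserved u v (zip fs ys)
Reserved-stepped u v []                 []       []       = []
Reserved-stepped u v (same _ ∷ ps)      (e ∷ es) (r ∷ rs) = r ∷ Reserved-stepped u v ps es rs
Reserved-stepped u v (changed _ _ ∷ ps) (e ∷ es) (r ∷ rs) = r ∷ Reserved-stepped u v ps es rs

-- In units of 1/(4D), the grid points of an agent with block [α/D , β/D]: the endpoints
-- of its block and of the middle half of its block.

Agent : Set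
Agent = ℕ × ℕ

endˡ midˡ midʳ endʳ span : Agent → ℕ
endˡ (α , β) = 2 * (2 * α)
midˡ (α , β) = (α + 2 * α) + β
midʳ (α , β) = α + (β + 2 * β)
endʳ (α , β) = 2 * (2 * β)
span (α , β) = β ∸ α

-- A right fold serves the last agent first, so the list has to be sorted from the longest block to
-- the shortest.
run : List Agent → List Seg → List Seg
run js xs = List.foldr (λ j → step (midˡ j) (midʳ j)) xs js

record OnGrid (p q : ℕ) (xs : List Seg) (j : Agent) : Set where
  field
    ordered : proj₁ j ≤ proj₂ j
    first   : p ≤ endˡ j
    last    : endʳ j ≤ q
    clear-endˡ : Clears (endˡ j) xs
    clear-midˡ : Clears (midˡ j) xs
    clear-midʳ : Clears (midʳ j) xs
    clear-endʳ : Clears (endʳ j) xs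

-- `stage` fixes R as it was right after the step of `j`; `cert` and `reserved` speak of this R with
-- the present cuts. Signed lengths are in units of 1/(8D), in which the block has length 8 times
-- its span, so λ/4 is `2 * span j`.
record Served (j : Agent) (xs : List Seg) : Set where
  field
    stage    : List Bool
    earlier  : Earlier stage xs
    cert     : Cert (2 * span j) 0ℤ false (zip stage xs)
    reserved : Reserved (midˡ j) (midʳ j) (zip stage xs)

Served-stepped : ∀ {u v j xs ys} → Pointwise (Stepped u v) xs ys → Served j xs → Served j ys
Served-stepped {j = j} ps sv = record
  { stage    = stage
  ; earlier  = Earlier-stepped ps earlier
  ; cert     = Cert-stepped ps earlier cert
  ; reserved = Reserved-stepped (midˡ j) (midʳ j) ps earlier reserved
  }
  where open Served sv

OnGrid-stepped : ∀ {u v p q j xs ys} → Pointwise (Stepped u v) xs ys → OnGrid p q xs j → OnGrid p q ys j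
OnGrid-stepped ps g = record
  { ordered = ordered
  ; first   = first
  ; last    = last
  ; clear-endˡ = Clears-stepped ps clear-endˡ
  ; clear-midˡ = Clears-stepped ps clear-midˡ
  ; clear-midʳ = Clears-stepped ps clear-midʳ
  ; clear-endʳ = Clears-stepped ps clear-endʳ
  }
  where open OnGrid g

endˡ-span : ∀ j → proj₁ j ≤ proj₂ j → midˡ j ≡ endˡ j + span j
endˡ-span (α , β) le = trans (cong (λ b → (α + 2 * α) + b) (sym (m+[n∸m]≡n le))) (lem α (β ∸ α))
  where
  lem : ∀ a d → (a + 2 * a) + (a + d) ≡ 2 * (2 * a) + d
  lem = NatSolver.solve-∀

midˡ-span : ∀ j → proj₁ j ≤ proj₂ j → midʳ j ≡ midˡ j + 2 * span j
midˡ-span (α , β) le = trans (cong (λ b → α + (b + 2 * b)) (sym (m+[n∸m]≡n le)))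
  (trans (lem α (β ∸ α)) (cong (λ b → (α + 2 * α) + b + 2 * (β ∸ α)) (m+[n∸m]≡n le)))
  where
  lem : ∀ a d → a + ((a + d) + 2 * (a + d)) ≡ (a + 2 * a) + (a + d) + 2 * d
  lem = NatSolver.solve-∀

midʳ-span : ∀ j → proj₁ j ≤ proj₂ j → endʳ j ≡ midʳ j + span j
midʳ-span (α , β) le = trans (cong (λ b → 2 * (2 * b)) (sym (m+[n∸m]≡n le)))
  (trans (lem α (β ∸ α)) (cong (λ b → α + (b + 2 * b) + (β ∸ α)) (m+[n∸m]≡n le)))
  where
  lem : ∀ a d → 2 * (2 * (a + d)) ≡ a + ((a + d) + 2 * (a + d)) + d
  lem = NatSolver.solve-∀

endˡ≤midˡ : ∀ {p q xs j} → OnGrid p q xs j → endˡ j ≤ midˡ j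
endˡ≤midˡ {j = j} g = ≤-trans (m≤m+n _ _) (≤-reflexive (sym (endˡ-span j (OnGrid.ordered g))))

midˡ≤midʳ : ∀ {p q xs j} → OnGrid p q xs j → midˡ j ≤ midʳ j
midˡ≤midʳ {j = j} g = ≤-trans (m≤m+n _ _) (≤-reflexive (sym (midˡ-span j (OnGrid.ordered g))))

midʳ≤endʳ : ∀ {p q xs j} → OnGrid p q xs j → midʳ j ≤ endʳ j
midʳ≤endʳ {j = j} g = ≤-trans (m≤m+n _ _) (≤-reflexive (sym (midʳ-span j (OnGrid.ordered g))))

-- `cert` ranges over every `m` above the bounds of all agents served. This spares naming a maximum
-- and covers the start, where E is 0 throughout and any `m` will do.
record Invariant (p q : ℕ) (js : List Agent) (xs ys : List Seg) : Set where
  field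
    links    : Links p ys q
    valid    : All Valid ys
    grid     : ∀ {j} → OnGrid p q xs j → OnGrid p q ys j
    cert     : ∀ m → All (λ j → 2 * span j ≤ m) js → Cert m 0ℤ false (marked ys)
    served   : All (λ j → Served j ys) js
    few-cuts : List.length (cutsOf ys) ≤ List.length js

AllFree : List Seg → Set
AllFree = All (λ x → status x ≡ free)

Cert-free : ∀ {m xs} s → AllFree xs → Cert m 0ℤ s (marked xs)
Cert-free s []                          = z≤n
Cert-free {xs = seg l r free ∷ xs} s (refl ∷ fr) = z≤n , (λ _ → refl) , Cert-free _ fr

valid-free : ∀ {p q xs} → Links p xs q → AllFree xs → All Valid xs
valid-free {xs = []} c [] = []
valid-free {xs = seg l r free ∷ xs} (_ , h , c) (refl ∷ fr) = (h , tt) ∷ valid-free c fr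

cuts-free : ∀ {xs} → AllFree xs → cutsOf xs ≡ []
cuts-free []                                 = refl
cuts-free {seg l r free ∷ xs} (refl ∷ fr) = cuts-free fr

-- The block of `j` is at least as long as all blocks served so far, so its own λ/4 is an admissible
-- `m` for the old R. `Cert-remark` gives the same bound after M is added, and the new R becomes the
-- stage of `j`.
invariant-step : ∀ {p q js xs ys} j → OnGrid p q xs j → All (λ k → span k ≤ span j) js →
  Invariant p q js xs ys → Invariant p q (j ∷ js) xs (step (midˡ j) (midʳ j) ys)
invariant-step {p} {q} {js} {xs} {ys} j onGrid longest inv = record
  { links    = links′
  ; valid    = valid′
  ; grid     = λ g → OnGrid-stepped ps (grid g)
  ; cert     = λ { m (j≤ ∷ _) → Cert-mono (marked zs) j≤ cert′ }
  ; served   = record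
      { stage = flags zs ; earlier = Earlier-refl zs ; cert = cert′
      ; reserved = subst (Reserved u v) (sym remarked) (Allₚ.map⁺ (All.universal unmarks _)) }
      ∷ All.map (Served-stepped ps) served
  ; few-cuts = ≤-trans (place-cuts u v false _ _ ys) (s≤s few-cuts)
  }
  where
  open Invariant inv
  open OnGrid (grid onGrid) using (ordered; first; last; clear-midˡ; clear-midʳ)
  u = midˡ j
  v = midʳ j
  m′ = 2 * span j
  zs = step u v ys
  ps : Pointwise (Stepped u v) ys zs
  ps = place-stepped u v false false _ _ ys
  early : Earlier (flags ys) zs
  early = Earlier-stepped ps (Earlier-refl ys)
  links′ : Links p zs q
  links′ = Links-stepped ps links
  valid′ : All Valid zs
  valid′ = place-valid u v false false _ _ ys valid
  remarked : marked zs ≡ map (remark u v) (zip (flags ys) zs)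
  remarked = marked-stepped ps
  cert′ : Cert m′ 0ℤ false (marked zs)
  cert′ = subst (Cert m′ 0ℤ false) (sym remarked)
    (Cert-remark (zip (flags ys) zs) (Links-zip early links′) (All-zip early valid′)
      (All-zip early (Clears-stepped ps clear-midˡ)) (All-zip early (Clears-stepped ps clear-midʳ))
      (≤-trans first (endˡ≤midˡ (grid onGrid))) (midˡ≤midʳ (grid onGrid))
      (≤-trans (midʳ≤endʳ (grid onGrid)) last)
      (≤-reflexive (midˡ-span j ordered)) ≤-refl (step-balanced u v ys valid)
      (Cert-stepped ps (Earlier-refl ys) (cert m′ (All.map (*-monoʳ-≤ 2) longest))))
  unmarks : ∀ z → inside u v (proj₂ z) ≡ true → free? (remark u v z) ≡ false
  unmarks z eq = cong free? (remark-in u v z eq)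

invariant-run : ∀ {p q xs} js → Links p xs q → AllFree xs →
  AllPairs (λ j k → span k ≤ span j) js → All (OnGrid p q xs) js → Invariant p q js xs (run js xs)
invariant-run {xs = xs} [] links fr sorted grids = record
  { links    = links
  ; valid    = valid-free links fr
  ; grid     = λ g → g
  ; cert     = λ m _ → Cert-free false fr
  ; served   = []
  ; few-cuts = ≤-reflexive (cong List.length (cuts-free fr))
  }
invariant-run (j ∷ js) links fr (longest ∷ sorted) (g ∷ grids) =
  invariant-step j g longest (invariant-run js links fr sorted grids)

spanSum : ℕ → ℕ → Bool → List Seg → ℤ
spanSum a b s []       = 0ℤ
spanSum a b s (x ∷ xs) = (when inside a b x then disp s x else 0ℤ) ℤ.+ spanSum a b (exit s x) xs

Sum-spanSum : ∀ {fs xs} a b s → Earlier fs xs →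
  Sum (λ z → inside a b (proj₂ z)) s (zip fs xs) ≡ spanSum a b s xs
Sum-spanSum a b s []       = refl
Sum-spanSum {xs = x ∷ xs} a b s (e ∷ es) =
  cong (λ k → (when inside a b x then disp s x else 0ℤ) ℤ.+ k) (Sum-spanSum a b (exit s x) es)

-- The bound 2m of `satisfied` with m = 2 times the span is half the length of the block.
run-halves : ∀ {p q xs} js → Links p xs q → AllFree xs →
  AllPairs (λ j k → span k ≤ span j) js → All (OnGrid p q xs) js →
  All (λ j → ∣ spanSum (endˡ j) (endʳ j) false (run js xs) ∣ ≤ 4 * span j) js
run-halves {p} {q} {xs} js links₀ fr sorted grids = All.map halves (All.zip (grids , served))
  where
  open Invariant (invariant-run js links₀ fr sorted grids)
  halves : ∀ {j} → OnGrid p q xs j × Served j (run js xs) →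
    ∣ spanSum (endˡ j) (endʳ j) false (run js xs) ∣ ≤ 4 * span j
  halves {j} (g₀ , sv) = subst (λ i → ∣ i ∣ ≤ 4 * span j) (Sum-spanSum (endˡ j) (endʳ j) false earlier)
    (≤-trans (satisfied (zip stage (run js xs)) (Links-zip earlier links) (All-zip earlier valid) certⱼ
        (All-zip earlier clear-endˡ) (All-zip earlier clear-midˡ)
        (All-zip earlier clear-midʳ) (All-zip earlier clear-endʳ) reserved
        first (endˡ≤midˡ (grid g₀)) (midˡ≤midʳ (grid g₀)) (midʳ≤endʳ (grid g₀)) last
        (double (endˡ-span j ordered)) (double (midʳ-span j ordered)))
      (≤-reflexive (sym (*-assoc 2 2 (span j)))))
    where
    open Served sv renaming (cert to certⱼ)
    open OnGrid (grid g₀)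
    double : ∀ {k n} → k ≡ n + span j → 2 * k ≤ 2 * n + 2 * span j
    double {n = n} refl = ≤-reflexive (*-distribˡ-+ 2 n (span j))

-- Insertion sort in the form of a transducer: the carried element is exchanged at each position.

insertBy : {A : Set} → (A → A → Bool) → A → List A → List A
insertBy le s []       = s ∷ []
insertBy le s (e ∷ es) = (when le s e then s else e) ∷ insertBy le (when le s e then e else s) es

sortBy : {A : Set} → (A → A → Bool) → List A → List A
sortBy le = List.foldr (insertBy le) []

insertBy-↭ : ∀ {A : Set} (le : A → A → Bool) s es → insertBy le s es ↭ s ∷ es
insertBy-↭ le s []       = ↭-refl
insertBy-↭ le s (e ∷ es) with le s e
... | true  = prep s (insertBy-↭ le e es)
... | false = ↭-trans (prep e (insertBy-↭ le s es)) (swap e s ↭-refl)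

sortBy-↭ : ∀ {A : Set} (le : A → A → Bool) es → sortBy le es ↭ es
sortBy-↭ le []       = ↭-refl
sortBy-↭ le (e ∷ es) = ↭-trans (insertBy-↭ le e (sortBy le es)) (prep e (sortBy-↭ le es))

module _ {A : Set} (le : A → A → Bool) (_≼_ : A → A → Set)
  (yes≼ : ∀ {x y} → le x y ≡ true → x ≼ y) (no≼ : ∀ {x y} → le x y ≡ false → y ≼ x)
  (≼-trans : ∀ {x y z} → x ≼ y → y ≼ z → x ≼ z) where

  insertBy-sorted : ∀ s es → AllPairs _≼_ es → AllPairs _≼_ (insertBy le s es)
  insertBy-sorted s [] [] = [] ∷ []
  insertBy-sorted s (e ∷ es) (e≼ ∷ sorted) with le s e in eq
  ... | true  = All-resp-↭ (Perm.↭-sym (insertBy-↭ le e es))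
                  (yes≼ eq ∷ All.map (≼-trans (yes≼ eq)) e≼) ∷ insertBy-sorted e es sorted
  ... | false = All-resp-↭ (Perm.↭-sym (insertBy-↭ le s es)) (no≼ eq ∷ e≼) ∷ insertBy-sorted s es sorted

  sortBy-sorted : ∀ es → AllPairs _≼_ (sortBy le es)
  sortBy-sorted []       = []
  sortBy-sorted (e ∷ es) = insertBy-sorted e (sortBy le es) (sortBy-sorted es)

-- The terms are moved across so that no truncated subtraction enters the comparison; `Longer-span`
-- returns to the spans.
longer : Agent → Agent → Bool
longer (α , β) (α′ , β′) = β′ + α ≤ᵇ β + α′

Longer : Agent → Agent → Set
Longer (α , β) (α′ , β′) = β′ + α ≤ β + α′

Longer-trans : ∀ {i j k} → Longer i j → Longer j k → Longer i k
Longer-trans {α , β} {α′ , β′} {α″ , β″} h h′ = +-cancelʳ-≤ (β′ + α′) _ _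
  (≤-trans (≤-reflexive (lem₁ β″ α β′ α′)) (≤-trans (+-mono-≤ h h′) (≤-reflexive (lem₂ β α′ β′ α″))))
  where
  lem₁ : ∀ b a b′ a′ → b + a + (b′ + a′) ≡ (b′ + a) + (b + a′)
  lem₁ = NatSolver.solve-∀
  lem₂ : ∀ b a′ b′ a → (b + a′) + (b′ + a) ≡ b + a + (b′ + a′)
  lem₂ = NatSolver.solve-∀

Longer-span : ∀ {j k} → proj₁ j ≤ proj₂ j → proj₁ k ≤ proj₂ k → Longer j k → span k ≤ span j
Longer-span {α , β} {α′ , β′} le le′ h = +-cancelʳ-≤ (α + α′) _ _
  (≤-trans (≤-reflexive (trans (lem (β′ ∸ α′) α α′) (cong (λ b → b + α) (m∸n+n≡m le′))))
    (≤-trans h (≤-reflexive (trans (cong (λ b → b + α′) (sym (m∸n+n≡m le))) (+-assoc (β ∸ α) α α′)))))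
  where
  lem : ∀ s a a′ → s + (a + a′) ≡ s + a′ + a
  lem = NatSolver.solve-∀

-- The grid

points : List Agent → List ℕ
points = List.foldr (λ j ts → endˡ j ∷ midˡ j ∷ midʳ j ∷ endʳ j ∷ ts) []

segments : ℕ → List ℕ → List Seg
segments p []       = []
segments p (t ∷ ts) = seg p t free ∷ segments t ts

segments-free : ∀ p ts → AllFree (segments p ts)
segments-free p []       = []
segments-free p (t ∷ ts) = refl ∷ segments-free t ts

lastOf : ℕ → List ℕ → ℕ
lastOf p []       = p
lastOf p (t ∷ ts) = lastOf t ts

segments-links : ∀ p ts → AllPairs _≤_ (p ∷ ts) → Links p (segments p ts) (lastOf p ts)
segments-links p []       _                    = refl
segments-links p (t ∷ ts) ((p≤t ∷ _) ∷ sorted) = refl , p≤t , segments-links t ts sorted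

lastOf-≤ : ∀ {N} p ts → All (_≤ N) (p ∷ ts) → lastOf p ts ≤ N
lastOf-≤ p []       (h ∷ [])  = h
lastOf-≤ p (t ∷ ts) (_ ∷ hs) = lastOf-≤ t ts hs

≤-lastOf : ∀ p ts → AllPairs _≤_ (p ∷ ts) → All (_≤ lastOf p ts) (p ∷ ts)
≤-lastOf p []       _                     = ≤-refl ∷ []
≤-lastOf p (t ∷ ts) ((p≤t ∷ _) ∷ sorted) with ≤-lastOf t ts sorted
... | t≤ ∷ rest = ≤-trans p≤t t≤ ∷ t≤ ∷ rest

Clears-below : ∀ {k p q} xs → k ≤ p → Links p xs q → Clears k xs
Clears-below []       k≤p c              = []
Clears-below (x ∷ xs) k≤p (refl , h , c) = inj₁ k≤p ∷ Clears-below xs (≤-trans k≤p h) c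

segments-clear : ∀ p ts → AllPairs _≤_ (p ∷ ts) → All (λ t → Clears t (segments p ts)) (p ∷ ts)
segments-clear p []       _ = [] ∷ []
segments-clear p (t ∷ ts) ((p≤t ∷ p≤ts) ∷ t≤ ∷ sorted) =
  Clears-below (segments p (t ∷ ts)) ≤-refl (segments-links p (t ∷ ts) ((p≤t ∷ p≤ts) ∷ t≤ ∷ sorted))
  ∷ All.zipWith (λ (h , c) → inj₂ h ∷ c) (≤-refl ∷ t≤ , segments-clear t ts (t≤ ∷ sorted))

points-All⁺ : ∀ {P : ℕ → Set} js →
  All (λ j → P (endˡ j) × P (midˡ j) × P (midʳ j) × P (endʳ j)) js → All P (points js)
points-All⁺ []       []                          = []
points-All⁺ (j ∷ js) ((a , b , c , d) ∷ h) = a ∷ b ∷ c ∷ d ∷ points-All⁺ js h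

points-All⁻ : ∀ {P : ℕ → Set} js → All P (points js) →
  All (λ j → P (endˡ j) × P (midˡ j) × P (midʳ j) × P (endʳ j)) js
points-All⁻ []       []                    = []
points-All⁻ (j ∷ js) (a ∷ b ∷ c ∷ d ∷ h) = (a , b , c , d) ∷ points-All⁻ js h

-- The chain starts at the least grid point. All blocks lie between the extreme grid points, so the
-- stretches beyond them merely prolong the first and the last piece.
grid : List ℕ → List Seg
grid ts = segments (headOr0 ts) (List.drop 1 ts)
  where
  headOr0 : List ℕ → ℕ
  headOr0 []      = 0
  headOr0 (t ∷ _) = t

solve : List Agent → List Seg
solve js = run (sortBy longer js) (grid (sortBy _≤ᵇ_ (points js)))

record Halved (N : ℕ) (js : List Agent) (ys : List Seg) : Set where
  field
    {first last} : ℕ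
    links    : Links first ys last
    valid    : All Valid ys
    last≤    : last ≤ 4 * N
    few-cuts : List.length (cutsOf ys) ≤ List.length js
    halved   : All (λ j → first ≤ endˡ j × endʳ j ≤ last × Clears (endˡ j) ys × Clears (endʳ j) ys
                 × ∣ spanSum (endˡ j) (endʳ j) false ys ∣ ≤ 4 * span j) js

Block : ℕ → Agent → Set
Block N (α , β) = α ≤ β × β ≤ N

ordered-points : ∀ {N} j → Block N j → endˡ j ≤ 4 * N × midˡ j ≤ 4 * N × midʳ j ≤ 4 * N × endʳ j ≤ 4 * N
ordered-points {N} j@(α , β) (α≤β , β≤N) =
  ≤-trans l≤m (≤-trans m≤m′ (≤-trans m′≤r r≤)) , ≤-trans m≤m′ (≤-trans m′≤r r≤) , ≤-trans m′≤r r≤ , r≤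
  where
  l≤m : endˡ j ≤ midˡ j
  l≤m = ≤-trans (m≤m+n _ _) (≤-reflexive (sym (endˡ-span j α≤β)))
  m≤m′ : midˡ j ≤ midʳ j
  m≤m′ = ≤-trans (m≤m+n _ _) (≤-reflexive (sym (midˡ-span j α≤β)))
  m′≤r : midʳ j ≤ endʳ j
  m′≤r = ≤-trans (m≤m+n _ _) (≤-reflexive (sym (midʳ-span j α≤β)))
  r≤ : endʳ j ≤ 4 * N
  r≤ = ≤-trans (≤-reflexive (sym (*-assoc 2 2 β))) (*-monoʳ-≤ 4 β≤N)

solve-halves : ∀ N js → All (Block N) js → Halved N js (solve js)
solve-halves N js blocks with sortBy _≤ᵇ_ (points js) in eqT
  | sortBy-↭ _≤ᵇ_ (points js)
  | sortBy-sorted _≤ᵇ_ _≤_ (λ {x} {y} → ≤ᵇ-true⁻ {x} {y}) (λ e → <⇒≤ (≤ᵇ-false⁻ e)) ≤-trans (points js)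
solve-halves N [] blocks | [] | perm | sorted = record
  { links = refl ; valid = [] ; last≤ = z≤n ; few-cuts = z≤n ; halved = [] }
solve-halves N (j ∷ js) blocks | [] | perm | sorted with () ← ↭-length perm
solve-halves N js blocks | p ∷ ts | perm | sorted = record
  { links    = Invariant.links inv
  ; valid    = Invariant.valid inv
  ; last≤    = lastOf-≤ p ts (All-resp-↭ (Perm.↭-sym perm)
                 (points-All⁺ js (All.map (λ {j} → ordered-points j) blocks)))
  ; few-cuts = ≤-trans (Invariant.few-cuts inv) (≤-reflexive (↭-length permJ))
  ; halved   = All.zipWith
      (λ {j} (g , h) → let g′ = Invariant.grid inv g in
        OnGrid.first g , OnGrid.last g , OnGrid.clear-endˡ g′ , OnGrid.clear-endʳ g′ , h)
      (grids , All-resp-↭ permJ (run-halves (sortBy longer js) links free′ sortedJ gridsJ))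
  }
  where
  xs = segments p ts
  links = segments-links p ts sorted
  free′ = segments-free p ts
  permJ = sortBy-↭ longer js
  Located : ℕ → Set
  Located t = p ≤ t × t ≤ lastOf p ts × Clears t xs
  located : All Located (p ∷ ts)
  located = All.zipWith (λ (p≤ , r) → p≤ , r)
    (≤-refl ∷ head sorted , All.zip (≤-lastOf p ts sorted , segments-clear p ts sorted))
    where
    head : AllPairs _≤_ (p ∷ ts) → All (p ≤_) ts
    head (h ∷ _) = h
  grids : All (OnGrid p (lastOf p ts) xs) js
  grids = All.zipWith
    (λ { ((le , _) , (l≤ , _ , cl) , (_ , _ , cl′) , (_ , _ , cr′) , (_ , r≤ , cr)) → record
      { ordered = le ; first = l≤ ; last = r≤
      ; clear-endˡ = cl ; clear-midˡ = cl′ ; clear-midʳ = cr′ ; clear-endʳ = cr } })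
    (blocks , points-All⁻ js (All-resp-↭ perm located))
  gridsJ = All-resp-↭ (Perm.↭-sym permJ) grids
  sortedJ : AllPairs (λ j k → span k ≤ span j) (sortBy longer js)
  sortedJ = spans (All-resp-↭ (Perm.↭-sym permJ) blocks)
    (sortBy-sorted longer Longer (λ {j} {k} → yes≼ {j} {k}) (λ {j} {k} → no≼ {j} {k})
      (λ {i} {j} {k} → Longer-trans {i} {j} {k}) js)
    where
    yes≼ : ∀ {j k} → longer j k ≡ true → Longer j k
    yes≼ = ≤ᵇ-true⁻
    no≼ : ∀ {j k} → longer j k ≡ false → Longer k j
    no≼ {α , β} {α′ , β′} e = <⇒≤ (≤ᵇ-false⁻ e)
    spans : ∀ {ks} → All (Block N) ks → AllPairs Longer ks → AllPairs (λ j k → span k ≤ span j) ks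
    spans []       []       = []
    spans (b ∷ bs) (h ∷ hs) = All.zipWith
      (λ {k} (b′ , h′) → Longer-span (proj₁ b) (proj₁ b′) h′) (bs , h) ∷ spans bs hs
  inv : Invariant p (lastOf p ts) (sortBy longer js) xs (run (sortBy longer js) xs)
  inv = invariant-run (sortBy longer js) links free′ sortedJ gridsJ

-- Common denominators: a raw agent is ((p , q) , (p′ , q′)) for the block [p/q , p′/q′].

Raw : Set
Raw = (ℕ × ℕ) × (ℕ × ℕ)

rescale : ℕ → Agent → Agent
rescale k (α , β) = k * α , k * β

-- The common denominator is the product of all denominators: its number of digits stays linear in
-- the size of the input.
addRaw : Raw → ℕ × List Agent → ℕ × List Agent
addRaw ((p , q) , (p′ , q′)) (D , js) =
  (q * q′) * D , (p * (q′ * D) , p′ * (q * D)) ∷ map (rescale (q * q′)) js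

commonDenominator : List Raw → ℕ × List Agent
commonDenominator = List.foldr addRaw (1 , [])

Scaled : ℕ → Raw → Agent → Set
Scaled D ((p , q) , (p′ , q′)) (α , β) = α * q ≡ p * D × β * q′ ≡ p′ * D

commonDenominator-scaled : ∀ rs → let (D , js) = commonDenominator rs in Pointwise (Scaled D) rs js
commonDenominator-scaled [] = []
commonDenominator-scaled (((p , q) , (p′ , q′)) ∷ rs) with commonDenominator rs | commonDenominator-scaled rs
... | D , js | h = (lem₁ p q q′ D , lem₂ p′ q q′ D) ∷ rescaled rs js h
  where
  lem₁ : ∀ p q q′ D → p * (q′ * D) * q ≡ p * (q * q′ * D)
  lem₁ = NatSolver.solve-∀
  lem₂ : ∀ p′ q q′ D → p′ * (q * D) * q′ ≡ p′ * (q * q′ * D)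
  lem₂ = NatSolver.solve-∀
  scaled : ∀ k a q p → a * q ≡ p * D → k * a * q ≡ p * (k * D)
  scaled k a q p eq = trans (*-assoc k a q) (trans (cong (λ b → k * b) eq) (lem k p D))
    where
    lem : ∀ k p D → k * (p * D) ≡ p * (k * D)
    lem = NatSolver.solve-∀
  rescaled : ∀ rs js → Pointwise (Scaled D) rs js →
    Pointwise (Scaled (q * q′ * D)) rs (map (rescale (q * q′)) js)
  rescaled [] [] [] = []
  rescaled (((p , q₁) , (p′ , q₂)) ∷ rs) ((α , β) ∷ js) ((e , e′) ∷ h) =
    (scaled (q * q′) α q₁ p e , scaled (q * q′) β q₂ p′ e′) ∷ rescaled rs js h

-- Coordinates as rationals with the common denominator suc k

ι : ℕ → ℕ → ℚᵘ
ι k m = mkℚᵘ (+ m) k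

ι-mono : ∀ k {m n} → m ≤ n → ι k m ℚ.≤ ι k n
ι-mono k le = *≤* (ℤₚ.*-monoʳ-≤-nonNeg (+ suc k) (+≤+ le))

ι-0 : ∀ k → ι k 0 ≃ 0ℚᵘ
ι-0 k = *≡* refl

ι-+ : ∀ k m n → ι k (m + n) ≃ ι k m ℚ.+ ι k n
ι-+ k m n = *≡* (lem (+ m) (+ n) (+ suc k))
  where
  lem : ∀ m n d → (m ℤ.+ n) ℤ.* (d ℤ.* d) ≡ (m ℤ.* d ℤ.+ n ℤ.* d) ℤ.* d
  lem = IntSolver.solve-∀

ι-∸ : ∀ k {m n} → n ≤ m → ι k m ℚ.- ι k n ≃ ι k (m ∸ n)
ι-∸ k {m} {n} n≤m = *≡* (trans (lem (+ m) (+ n) (+ suc k))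
  (cong (λ i → i ℤ.* (+ suc k ℤ.* + suc k)) (sym (+-∸ n≤m))))
  where
  lem : ∀ m n d → (m ℤ.* d ℤ.+ (ℤ.- n) ℤ.* d) ℤ.* d ≡ (m ℤ.- n) ℤ.* (d ℤ.* d)
  lem = IntSolver.solve-∀

ι-⊓ : ∀ k m n → ι k m ℚ.⊓ ι k n ≃ ι k (m ℕ.⊓ n)
ι-⊓ k m n with ≤-total m n
... | inj₁ le = ℚₚ.≃-trans (ℚₚ.p≤q⇒p⊓q≃p (ι-mono k le)) (ℚₚ.≃-reflexive (cong (ι k) (sym (m≤n⇒m⊓n≡m le))))
... | inj₂ ge = ℚₚ.≃-trans (ℚₚ.p≥q⇒p⊓q≃q (ι-mono k ge)) (ℚₚ.≃-reflexive (cong (ι k) (sym (m≥n⇒m⊓n≡n ge))))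

ι-⊔ : ∀ k m n → ι k m ℚ.⊔ ι k n ≃ ι k (m ⊔ n)
ι-⊔ k m n with ≤-total m n
... | inj₁ le = ℚₚ.≃-trans (ℚₚ.p≤q⇒p⊔q≃q (ι-mono k le)) (ℚₚ.≃-reflexive (cong (ι k) (sym (m≤n⇒m⊔n≡n le))))
... | inj₂ ge = ℚₚ.≃-trans (ℚₚ.p≥q⇒p⊔q≃p (ι-mono k ge)) (ℚₚ.≃-reflexive (cong (ι k) (sym (m≥n⇒m⊔n≡m ge))))

ι-positive-part : ∀ k m n → 0ℚᵘ ℚ.⊔ (ι k m ℚ.- ι k n) ≃ ι k (m ∸ n)
ι-positive-part k m n with ≤-total n m
... | inj₁ n≤m = ℚₚ.≃-trans (ℚₚ.p≤q⇒p⊔q≃q (ℚₚ.p≤q⇒0≤q-p (ι-mono k n≤m))) (ι-∸ k n≤m)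
... | inj₂ m≤n = ℚₚ.≃-trans (ℚₚ.p≥q⇒p⊔q≃p (ℚₚ.p≤q⇒p-q≤0 (ι-mono k m≤n)))
  (ℚₚ.≃-trans (ℚₚ.≃-sym (ι-0 k)) (ℚₚ.≃-reflexive (cong (ι k) (sym (m≤n⇒m∸n≡0 m≤n)))))

-- Lengths of intersections and the measures of the two parts

common : ℕ → ℕ → ℕ → ℕ → ℕ
common A B x y = (B ℕ.⊓ y) ∸ (A ⊔ x)

measureInterval-common : ∀ k μ {A B x y x′ y′} → left μ ≃ ι k A → right μ ≃ ι k B →
  x ≃ ι k x′ → y ≃ ι k y′ → measureInterval μ (x , y) ≃ height μ ℚ.* ι k (common A B x′ y′)
measureInterval-common k μ {A} {B} {x′ = x′} {y′} l≃ r≃ x≃ y≃ = ℚₚ.*-congˡ {height μ} (ℚₚ.≃-trans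
  (ℚₚ.⊔-congˡ 0ℚᵘ (ℚₚ.+-cong
    (ℚₚ.≃-trans (ℚₚ.⊓-cong r≃ y≃) (ι-⊓ k B y′))
    (ℚₚ.-‿cong (ℚₚ.≃-trans (ℚₚ.⊔-cong l≃ x≃) (ι-⊔ k A x′)))))
  (ι-positive-part k (B ℕ.⊓ y′) (A ⊔ x′)))

clamp : ℕ → ℕ → ℕ → ℕ
clamp A B x = A ⊔ (B ℕ.⊓ x)

clamp-mono : ∀ A B {x y} → x ≤ y → clamp A B x ≤ clamp A B y
clamp-mono A B le = ⊔-monoʳ-≤ A (⊓-monoʳ-≤ B le)

-- `clamp` projects the line onto [A , B], and the intersection with [x , y] is what lies between
-- the projections of x and y. In this form additivity telescopes.
common-clamp : ∀ {A B} → A ≤ B → ∀ {x y} → x ≤ y → common A B x y ≡ clamp A B y ∸ clamp A B x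
common-clamp {A} {B} A≤B {x} {y} x≤y with ≤-total y A | ≤-total B x
... | inj₁ y≤A | _ = trans (m≤n⇒m∸n≡0 (≤-trans (m⊓n≤n B y) (≤-trans y≤A (m≤m⊔n A x))))
  (sym (m≤n⇒m∸n≡0 (≤-trans (≤-reflexive (m≥n⇒m⊔n≡m (≤-trans (m⊓n≤n B y) y≤A))) (m≤m⊔n A _))))
... | inj₂ A≤y | inj₁ B≤x = trans (m≤n⇒m∸n≡0 (≤-trans (m⊓n≤m B y) (≤-trans B≤x (m≤n⊔m A x))))
  (sym (m≤n⇒m∸n≡0 (≤-trans (⊔-lub A≤B (m⊓n≤m B y)) (≤-trans (≤-reflexive (sym (m≤n⇒m⊓n≡m B≤x))) (m≤n⊔m A _)))))
... | inj₂ A≤y | inj₂ x≤B = cong₂ _∸_ (sym (m≤n⇒m⊔n≡n (⊓-glb A≤B A≤y)))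
  (cong (A ⊔_) (sym (m≥n⇒m⊓n≡n x≤B)))

common-+ : ∀ {A B} → A ≤ B → ∀ {x y z} → x ≤ y → y ≤ z →
  common A B x z ≡ common A B x y + common A B y z
common-+ {A} {B} A≤B {x} {y} {z} x≤y y≤z
  rewrite common-clamp A≤B (≤-trans x≤y y≤z) | common-clamp A≤B x≤y | common-clamp A≤B y≤z =
  trans (cong (_∸ clamp A B x) (sym (m∸n+n≡m (clamp-mono A B y≤z))))
    (trans (+-∸-assoc (clamp A B z ∸ clamp A B y) (clamp-mono A B x≤y))
      (+-comm (clamp A B z ∸ clamp A B y) _))

common-below : ∀ {A B x y} → y ≤ A → common A B x y ≡ 0
common-below {A} {B} {x} {y} y≤A = m≤n⇒m∸n≡0 (≤-trans (m⊓n≤n B y) (≤-trans y≤A (m≤m⊔n A x)))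

common-above : ∀ {A B x y} → B ≤ x → common A B x y ≡ 0
common-above {A} {B} {x} {y} B≤x = m≤n⇒m∸n≡0 (≤-trans (m⊓n≤m B y) (≤-trans B≤x (m≤n⊔m A x)))

common-inside : ∀ {A B x y} → A ≤ x → y ≤ B → common A B x y ≡ y ∸ x
common-inside A≤x y≤B = cong₂ _∸_ (m≥n⇒m⊓n≡n y≤B) (m≤n⇒m⊔n≡n A≤x)

toSign : Bool → Sign
toSign true  = Sign.-
toSign false = Sign.+

alternate : Bool → ∀ n → Vec Sign (suc n)
alternate s zero    = toSign s ∷ []
alternate s (suc n) = toSign s ∷ alternate (not s) n

cutVec : ℕ → (cs : List ℕ) → Vec ℚᵘ (List.length cs)
cutVec k []       = []
cutVec k (c ∷ cs) = ι k c ∷ cutVec k cs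

-- The lengths of I⁺ ∩ [A , B] and I⁻ ∩ [A , B], where the last piece ends at N.
parts : (A B N : ℕ) → Bool → ℕ → List ℕ → ℕ × ℕ
parts A B N true  x []       = 0 , common A B x N
parts A B N false x []       = common A B x N , 0
parts A B N true  x (c ∷ cs) = let (p , n) = parts A B N false c cs in p , common A B x c + n
parts A B N false x (c ∷ cs) = let (p , n) = parts A B N true c cs in common A B x c + p , n

partOf : Sign → ℚᵘ → (k : ℕ) → List ℕ → Bool → List Interval
partOf s x k cs b = List.map proj₂
  (List.filter (λ piece → proj₁ piece Signₚ.≟ s) (labelledPieces x (cutVec k cs) (alternate b (List.length cs))))

measure-∷ : ∀ k μ {i is m n} → measureInterval μ i ≃ height μ ℚ.* ι k m →
  measure μ is ≃ height μ ℚ.* ι k n → measure μ (i ∷ is) ≃ height μ ℚ.* ι k (m + n)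
measure-∷ k μ {m = m} {n} h h′ = ℚₚ.≃-trans (ℚₚ.+-cong h h′)
  (ℚₚ.≃-trans (ℚₚ.≃-sym (ℚₚ.*-distribˡ-+ (height μ) (ι k m) (ι k n)))
    (ℚₚ.*-congˡ {height μ} (ℚₚ.≃-sym (ι-+ k m n))))

measure-[] : ∀ k μ → 0ℚᵘ ≃ height μ ℚ.* ι k 0
measure-[] k μ = ℚₚ.≃-trans (ℚₚ.≃-sym (ℚₚ.*-zeroʳ (height μ))) (ℚₚ.*-congˡ {height μ} (ℚₚ.≃-sym (ι-0 k)))

measure-parts : ∀ k μ {A B x x′} → left μ ≃ ι k A → right μ ≃ ι k B → ∀ s cs → x ≃ ι k x′ →
  let (p , n) = parts A B (suc k) s x′ cs in
  measure μ (partOf Sign.+ x k cs s) ≃ height μ ℚ.* ι k p ×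
  measure μ (partOf Sign.- x k cs s) ≃ height μ ℚ.* ι k n
measure-parts k μ {A} {B} {x} {x′} l≃ r≃ s [] x≃ with s
... | true  = measure-[] k μ , singleton
  where
  singleton : measure μ ((x , 1ℚᵘ) ∷ []) ≃ height μ ℚ.* ι k (common A B x′ (suc k))
  singleton = ℚₚ.≃-trans (ℚₚ.+-identityʳ _) (measureInterval-common k μ l≃ r≃ x≃ (*≡* (ℤₚ.*-comm (+ 1) (+ suc k))))
... | false = singleton , measure-[] k μ
  where
  singleton : measure μ ((x , 1ℚᵘ) ∷ []) ≃ height μ ℚ.* ι k (common A B x′ (suc k))
  singleton = ℚₚ.≃-trans (ℚₚ.+-identityʳ _) (measureInterval-common k μ l≃ r≃ x≃ (*≡* (ℤₚ.*-comm (+ 1) (+ suc k))))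
measure-parts k μ {A} {B} {x} {x′} l≃ r≃ true (c ∷ cs) x≃ =
  let (p , n) = measure-parts k μ l≃ r≃ false cs ℚₚ.≃-refl in
  p , measure-∷ k μ {i = x , ι k c} {is = partOf Sign.- (ι k c) k cs false} (measureInterval-common k μ l≃ r≃ x≃ ℚₚ.≃-refl) n
measure-parts k μ {A} {B} {x} {x′} l≃ r≃ false (c ∷ cs) x≃ =
  let (p , n) = measure-parts k μ l≃ r≃ true cs ℚₚ.≃-refl in
  measure-∷ k μ {i = x , ι k c} {is = partOf Sign.+ (ι k c) k cs true} (measureInterval-common k μ l≃ r≃ x≃ ℚₚ.≃-refl) p , n

pieceSum : (A B N : ℕ) → Bool → ℕ → List ℕ → ℤ
pieceSum A B N s x []       = signed s (+ common A B x N)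
pieceSum A B N s x (c ∷ cs) = signed s (+ common A B x c) ℤ.+ pieceSum A B N (not s) c cs

parts-pieceSum : ∀ A B N s x cs → let (p , n) = parts A B N s x cs in
  + p ℤ.- + n ≡ pieceSum A B N s x cs
parts-pieceSum A B N true  x []       = ℤₚ.+-identityˡ _
parts-pieceSum A B N false x []       = ℤₚ.+-identityʳ _
parts-pieceSum A B N true  x (c ∷ cs) with parts A B N false c cs | parts-pieceSum A B N false c cs
... | p , n | eq = trans (lem (+ p) (+ common A B x c) (+ n)) (cong (λ k → ℤ.- (+ common A B x c) ℤ.+ k) eq)
  where
  lem : ∀ p o n → p ℤ.- (o ℤ.+ n) ≡ ℤ.- o ℤ.+ (p ℤ.- n)
  lem = IntSolver.solve-∀
parts-pieceSum A B N false x (c ∷ cs) with parts A B N true c cs | parts-pieceSum A B N true c cs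
... | p , n | eq = trans (ℤₚ.+-assoc (+ common A B x c) (+ p) (ℤ.- + n)) (cong (λ k → + common A B x c ℤ.+ k) eq)

commonDisp : (A B : ℕ) → Bool → Seg → ℤ
commonDisp A B s (seg l r (cutAt X)) = signed s (+ common A B (2 * l) X) ℤ.+ signed (not s) (+ common A B X (2 * r))
commonDisp A B s (seg l r _)         = signed s (+ common A B (2 * l) (2 * r))

commonSum : (A B : ℕ) → Bool → List Seg → ℤ
commonSum A B s []       = 0ℤ
commonSum A B s (x ∷ xs) = commonDisp A B s x ℤ.+ commonSum A B (exit s x) xs

signed-+ : ∀ s m n → signed s (+ (m + n)) ≡ signed s (+ m) ℤ.+ signed s (+ n)
signed-+ false m n = refl
signed-+ true  m n = ℤₚ.neg-distrib-+ (+ m) (+ n)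

signed-0 : ∀ s → signed s 0ℤ ≡ 0ℤ
signed-0 true  = refl
signed-0 false = refl

signed-common-+ : ∀ {A B} → A ≤ B → ∀ s {x y z} → x ≤ y → y ≤ z →
  signed s (+ common A B x z) ≡ signed s (+ common A B x y) ℤ.+ signed s (+ common A B y z)
signed-common-+ A≤B s x≤y y≤z = trans (cong (λ k → signed s (+ k)) (common-+ A≤B x≤y y≤z)) (signed-+ s _ _)

module _ {A B N : ℕ} (A≤B : A ≤ B) (B≤N : B ≤ N) where

  uncut : ∀ s {x l r} ys → x ≤ 2 * l → l ≤ r →
    signed s (+ common A B x (2 * r)) ℤ.+ commonSum A B s ys
      ≡ signed s (+ common A B x (2 * l))
        ℤ.+ (signed s (+ common A B (2 * l) (2 * r)) ℤ.+ commonSum A B (s xor false) ys)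
  uncut s {x} {l} ys x≤l l≤r = trans
    (cong₂ ℤ._+_ (signed-common-+ A≤B s x≤l (*-monoʳ-≤ 2 l≤r)) (cong (λ b → commonSum A B b ys) (sym (xor-false s))))
    (ℤₚ.+-assoc (signed s (+ common A B x (2 * l))) _ _)

  -- Regroups a sum over pieces between cuts as a sum over segments. The current piece began at `x`,
  -- possibly several segments back, and the first summand accounts for what has been passed of it.
  -- The last piece goes on to `N`, but beyond 2q it no longer meets the block.
  pieceSum-common : ∀ {p q} s x ys → Links p ys q → All Valid ys → x ≤ 2 * p → B ≤ 2 * q → 2 * q ≤ N →
    pieceSum A B N s x (cutsOf ys) ≡ signed s (+ common A B x (2 * p)) ℤ.+ commonSum A B s ys
  pieceSum-common {p} s x [] refl [] x≤p B≤q q≤N = trans (signed-common-+ A≤B s x≤p q≤N)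
    (cong (λ k → signed s (+ common A B x (2 * p)) ℤ.+ k)
      (trans (cong (λ k → signed s (+ k)) (common-above {A} {B} {2 * p} {N} B≤q)) (signed-0 s)))
  pieceSum-common s x (seg l r free ∷ ys) (refl , l≤r , c) (_ ∷ vs) x≤p B≤q q≤N =
    trans (pieceSum-common s x ys c vs (≤-trans x≤p (*-monoʳ-≤ 2 l≤r)) B≤q q≤N) (uncut s ys x≤p l≤r)
  pieceSum-common s x (seg l r kept ∷ ys) (refl , l≤r , c) (_ ∷ vs) x≤p B≤q q≤N =
    trans (pieceSum-common s x ys c vs (≤-trans x≤p (*-monoʳ-≤ 2 l≤r)) B≤q q≤N) (uncut s ys x≤p l≤r)
  pieceSum-common s x (seg l r (cutAt X) ∷ ys) (refl , l≤r , c) ((_ , l≤X , X≤r) ∷ vs) x≤p B≤q q≤N =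
    trans (cong₂ ℤ._+_ (signed-common-+ A≤B s x≤p l≤X) (pieceSum-common (not s) X ys c vs X≤r B≤q q≤N))
      (trans (cong (λ b → (a ℤ.+ b′) ℤ.+ (c′ ℤ.+ commonSum A B b ys)) (sym (xor-true s)))
        (lem a b′ c′ _))
    where
    a = signed s (+ common A B x (2 * l))
    b′ = signed s (+ common A B (2 * l) X)
    c′ = signed (not s) (+ common A B X (2 * r))
    lem : ∀ a b c d → (a ℤ.+ b) ℤ.+ (c ℤ.+ d) ≡ a ℤ.+ ((b ℤ.+ c) ℤ.+ d)
    lem = IntSolver.solve-∀

commonDisp-inside : ∀ a b s x → Valid x → a ≤ lo x → hi x ≤ b →
  commonDisp (2 * a) (2 * b) s x ≡ disp s x
commonDisp-inside a b s (seg l r free) v h h′ =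
  cong (λ k → signed s (+ k)) (common-inside (*-monoʳ-≤ 2 h) (*-monoʳ-≤ 2 h′))
commonDisp-inside a b s (seg l r kept) v h h′ =
  cong (λ k → signed s (+ k)) (common-inside (*-monoʳ-≤ 2 h) (*-monoʳ-≤ 2 h′))
commonDisp-inside a b s (seg l r (cutAt X)) (_ , l≤X , X≤r) h h′ = trans
  (cong₂ (λ j k → signed s (+ j) ℤ.+ signed (not s) (+ k))
    (common-inside (*-monoʳ-≤ 2 h) (≤-trans X≤r (*-monoʳ-≤ 2 h′)))
    (common-inside (≤-trans (*-monoʳ-≤ 2 h) l≤X) (*-monoʳ-≤ 2 h′)))
  (lem s (+ (X ∸ 2 * l)) (+ (2 * r ∸ X)))
  where
  lem : ∀ s i j → signed s i ℤ.+ signed (not s) j ≡ signed s (i ℤ.- j)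
  lem true  i j = sym (trans (ℤₚ.neg-distrib-+ i (ℤ.- j)) (cong (λ k → ℤ.- i ℤ.+ k) (ℤₚ.neg-involutive j)))
  lem false i j = refl

signed-common-outside : ∀ {A B x y} s → y ≤ A ⊎ B ≤ x → signed s (+ common A B x y) ≡ 0ℤ
signed-common-outside {A} {B} {x} s h = trans (cong (λ k → signed s (+ k)) (outside h)) (signed-0 s)
  where
  outside : ∀ {y} → y ≤ A ⊎ B ≤ x → common A B x y ≡ 0
  outside (inj₁ y≤A) = common-below {A} {B} {x} y≤A
  outside (inj₂ B≤x) = common-above {A} {B} {x} B≤x

commonDisp-outside : ∀ {A B} s x → Valid x → 2 * hi x ≤ A ⊎ B ≤ 2 * lo x → commonDisp A B s x ≡ 0ℤ
commonDisp-outside s (seg l r free) v h = signed-common-outside s h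
commonDisp-outside s (seg l r kept) v h = signed-common-outside s h
commonDisp-outside s (seg l r (cutAt X)) (_ , l≤X , X≤r) h = cong₂ ℤ._+_
  (signed-common-outside s (Sum.map₁ (≤-trans X≤r) h))
  (signed-common-outside (not s) (Sum.map₂ (λ B≤ → ≤-trans B≤ l≤X) h))

commonSum-spanSum : ∀ a b s ys → All Valid ys → Clears a ys → Clears b ys →
  commonSum (2 * a) (2 * b) s ys ≡ spanSum a b s ys
commonSum-spanSum a b s [] [] [] [] = refl
commonSum-spanSum a b s (y ∷ ys) (v ∷ vs) (ca ∷ cas) (cb ∷ cbs) =
  cong₂ ℤ._+_ (head ca cb) (commonSum-spanSum a b (exit s y) ys vs cas cbs)
  where
  -- A segment of length zero at a or b can be outside and inside at once, hence the case
  -- distinction.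
  outside : hi y ≤ a ⊎ b ≤ lo y → commonDisp (2 * a) (2 * b) s y ≡ (when inside a b y then disp s y else 0ℤ)
  outside h with inside a b y in eq
  ... | false = commonDisp-outside s y v (Sum.map (*-monoʳ-≤ 2) (*-monoʳ-≤ 2) h)
  ... | true  = commonDisp-inside a b s y v (≤ᵇ-true⁻ {a} (∧-trueˡ eq)) (≤ᵇ-true⁻ {hi y} (∧-trueʳ {a ≤ᵇ lo y} eq))
  head : a ≤ lo y ⊎ hi y ≤ a → b ≤ lo y ⊎ hi y ≤ b →
    commonDisp (2 * a) (2 * b) s y ≡ (when inside a b y then disp s y else 0ℤ)
  head (inj₂ h) _ = outside (inj₁ h)
  head (inj₁ _) (inj₁ h) = outside (inj₂ h)
  head (inj₁ h) (inj₂ h′) rewrite inside-true y h h′ = commonDisp-inside a b s y v h h′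

parts-spanSum : ∀ {p q a b N} ys → Links p ys q → All Valid ys → Clears a ys → Clears b ys →
  p ≤ a → a ≤ b → b ≤ q → 2 * q ≤ N → let (m , n) = parts (2 * a) (2 * b) N false 0 (cutsOf ys) in
  + m ℤ.- + n ≡ spanSum a b false ys
parts-spanSum {p} {q} {a} {b} {N} ys links vs ca cb p≤a a≤b b≤q q≤N = begin
    + proj₁ (parts A B N false 0 (cutsOf ys)) ℤ.- + proj₂ (parts A B N false 0 (cutsOf ys))
      ≡⟨ parts-pieceSum A B N false 0 (cutsOf ys) ⟩
    pieceSum A B N false 0 (cutsOf ys)
      ≡⟨ pieceSum-common (*-monoʳ-≤ 2 a≤b) (≤-trans (*-monoʳ-≤ 2 b≤q) q≤N) false 0 ys links vs z≤n (*-monoʳ-≤ 2 b≤q) q≤N ⟩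
    + common A B 0 (2 * p) ℤ.+ commonSum A B false ys
      ≡⟨ cong₂ (λ i j → + i ℤ.+ j) (common-below {A} {B} {0} (*-monoʳ-≤ 2 p≤a)) (commonSum-spanSum a b false ys vs ca cb) ⟩
    0ℤ ℤ.+ spanSum a b false ys
      ≡⟨ ℤₚ.+-identityˡ _ ⟩
    spanSum a b false ys ∎
  where
  open ≡-Reasoning
  A = 2 * a
  B = 2 * b

height-nonNeg : ∀ μ → ℚ.NonNegative (height μ)
height-nonNeg μ = ℚₚ.pos⇒nonNeg (height μ) {{ℚ.positive (0<height μ)}}

∣difference∣ : ∀ k μ {m n x y} → n ≤ m → x ≃ height μ ℚ.* ι k m → y ≃ height μ ℚ.* ι k n →
  ℚ.∣ x ℚ.- y ∣ ≃ height μ ℚ.* ι k (m ∸ n)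
∣difference∣ k μ {m} {n} n≤m x≃ y≃ = ℚₚ.≃-trans
  (ℚₚ.∣-∣-cong (ℚₚ.≃-trans (ℚₚ.+-cong x≃ (ℚₚ.-‿cong y≃))
    (ℚₚ.≃-trans (ℚₚ.+-congʳ (height μ ℚ.* ι k m) (ℚₚ.neg-distribʳ-* (height μ) (ι k n)))
      (ℚₚ.≃-trans (ℚₚ.≃-sym (ℚₚ.*-distribˡ-+ (height μ) (ι k m) (ℚ.- ι k n)))
        (ℚₚ.*-congˡ {height μ} (ι-∸ k n≤m))))))
  (ℚₚ.0≤p⇒∣p∣≃p (ℚₚ.nonNegative⁻¹ _ {{ℚₚ.nonNeg*nonNeg⇒nonNeg (height μ) {{height-nonNeg μ}} (ι k (m ∸ n))}}))

height-half : ∀ k μ {A B} → left μ ≃ ι k A → right μ ≃ ι k B → A ≤ B →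
  ∀ {d} → 2 * d ≤ B ∸ A → height μ ℚ.* ι k d ℚ.≤ ½
height-half k μ {A} {B} l≃ r≃ A≤B {d} h = halve (ℚₚ.≤-respˡ-≃ twice (ℚₚ.≤-trans bounded (ℚₚ.≤-reflexive whole)))
  where
  instance
    nonNeg : ℚ.NonNegative (height μ)
    nonNeg = height-nonNeg μ
  bounded : height μ ℚ.* ι k (2 * d) ℚ.≤ height μ ℚ.* ι k (B ∸ A)
  bounded = ℚₚ.*-monoʳ-≤-nonNeg (height μ) (ι-mono k h)
  whole : height μ ℚ.* ι k (B ∸ A) ≃ 1ℚᵘ
  whole = ℚₚ.≃-trans (ℚₚ.*-congˡ {height μ} (ℚₚ.≃-trans (ℚₚ.≃-sym (ι-∸ k A≤B))
    (ℚₚ.+-cong (ℚₚ.≃-sym r≃) (ℚₚ.-‿cong (ℚₚ.≃-sym l≃))))) (total-mass μ)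
  twice : height μ ℚ.* ι k (2 * d) ≃ height μ ℚ.* ι k d ℚ.+ height μ ℚ.* ι k d
  twice = ℚₚ.≃-trans (ℚₚ.*-congˡ {height μ} (ℚₚ.≃-trans
      (ℚₚ.≃-reflexive (cong (λ e → ι k (d + e)) (+-identityʳ d))) (ι-+ k d d)))
    (ℚₚ.*-distribˡ-+ (height μ) (ι k d) (ι k d))
  halve : ∀ {x} → x ℚ.+ x ℚ.≤ 1ℚᵘ → x ℚ.≤ ½
  halve {x} le with x ℚₚ.≤? ½
  ... | yes x≤½ = x≤½
  ... | no x≰½ = ⊥-elim (ℚₚ.<⇒≱ (ℚₚ.<-respˡ-≃ (*≡* refl) (ℚₚ.+-mono-< (ℚₚ.≰⇒> x≰½) (ℚₚ.≰⇒> x≰½))) le)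

height-difference : ∀ k μ {A B} → left μ ≃ ι k A → right μ ≃ ι k B → A ≤ B →
  ∀ {m n x y} → x ≃ height μ ℚ.* ι k m → y ≃ height μ ℚ.* ι k n →
  2 * ∣ + m ℤ.- + n ∣ ≤ B ∸ A → ℚ.∣ x ℚ.- y ∣ ℚ.≤ ½
height-difference k μ {A} {B} l≃ r≃ A≤B {m} {n} {x} {y} x≃ y≃ h with ≤-total n m
... | inj₁ n≤m = ℚₚ.≤-respˡ-≃ (ℚₚ.≃-sym (∣difference∣ k μ n≤m x≃ y≃))
  (height-half k μ l≃ r≃ A≤B (≤-trans (≤-reflexive (cong (λ i → 2 * ∣ i ∣) (+-∸ n≤m))) h))
... | inj₂ m≤n = ℚₚ.≤-respˡ-≃ (ℚₚ.≃-sym (ℚₚ.≃-trans (flip x y) (∣difference∣ k μ m≤n y≃ x≃)))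
  (height-half k μ l≃ r≃ A≤B (≤-trans (≤-reflexive (cong (λ i → 2 * i)
    (trans (cong ∣_∣ (+-∸ m≤n)) (ℤₚ.∣i-j∣≡∣j-i∣ (+ n) (+ m))))) h))
  where
  flip : ∀ x y → ℚ.∣ x ℚ.- y ∣ ≃ ℚ.∣ y ℚ.- x ∣
  flip x y = ℚₚ.≃-trans (ℚₚ.≃-sym (ℚₚ.∣-p∣≃∣p∣ (x ℚ.- y))) (ℚₚ.∣-∣-cong
    (ℚₚ.≃-trans (ℚₚ.≃-reflexive (ℚₚ.neg-distrib-+ x (ℚ.- y)))
      (ℚₚ.≃-trans (ℚₚ.+-congʳ (ℚ.- x) (ℚₚ.neg-involutive y))
        (ℚₚ.+-comm (ℚ.- x) y))))

cuts-ordered : ∀ k {p q x} ys → Links p ys q → All Valid ys → x ℚ.≤ ι k (2 * p) → 2 * q ≤ suc k →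
  Linked ℚ._≤_ (x ∷ (cutVec k (cutsOf ys) ∷ʳ 1ℚᵘ))
cuts-ordered k [] refl [] x≤ q≤ =
  ℚₚ.≤-trans x≤ (ℚₚ.≤-trans (ι-mono k q≤) (ℚₚ.≤-reflexive (*≡* (ℤₚ.*-comm (+ suc k) (+ 1))))) ∷ [-]
cuts-ordered k (seg l r free ∷ ys) (refl , h , c) (_ ∷ vs) x≤ q≤ =
  cuts-ordered k ys c vs (ℚₚ.≤-trans x≤ (ι-mono k (*-monoʳ-≤ 2 h))) q≤
cuts-ordered k (seg l r kept ∷ ys) (refl , h , c) (_ ∷ vs) x≤ q≤ =
  cuts-ordered k ys c vs (ℚₚ.≤-trans x≤ (ι-mono k (*-monoʳ-≤ 2 h))) q≤
cuts-ordered k (seg l r (cutAt X) ∷ ys) (refl , h , c) ((_ , l≤X , X≤r) ∷ vs) x≤ q≤ =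
  ℚₚ.≤-trans x≤ (ι-mono k l≤X) ∷ cuts-ordered k ys c vs (ι-mono k X≤r) q≤

-- The input blocks on a common grid, and the resulting partition

rawOf : SingleBlock → Raw
rawOf μ = (∣ ℚ.↥ left μ ∣ , ℚ.↧ₙ left μ) , (∣ ℚ.↥ right μ ∣ , ℚ.↧ₙ right μ)

rawsOf : ∀ {n} → Vec SingleBlock n → List Raw
rawsOf []       = []
rawsOf (μ ∷ μs) = rawOf μ ∷ rawsOf μs

numerator-≥0 : ∀ {x} → 0ℚᵘ ℚ.≤ x → + ∣ ℚ.↥ x ∣ ≡ ℚ.↥ x
numerator-≥0 {mkℚᵘ (+ n) d} _ = refl
numerator-≥0 {mkℚᵘ ℤ.-[1+ n ] d} (*≤* ())

cross-≤ : ∀ {x y} → 0ℚᵘ ℚ.≤ x → x ℚ.≤ y → ∣ ℚ.↥ x ∣ * ℚ.↧ₙ y ≤ ∣ ℚ.↥ y ∣ * ℚ.↧ₙ x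
cross-≤ {x@record{}} {y@record{}} 0≤x x≤y@(*≤* le) = ℤₚ.drop‿+≤+ (begin
    + (∣ ℚ.↥ x ∣ * ℚ.↧ₙ y)      ≡⟨ ℤₚ.pos-* (∣ ℚ.↥ x ∣) (ℚ.↧ₙ y) ⟩
    + ∣ ℚ.↥ x ∣ ℤ.* ℚ.↧ y       ≡⟨ cong (λ i → i ℤ.* ℚ.↧ y) (numerator-≥0 0≤x) ⟩
    ℚ.↥ x ℤ.* ℚ.↧ y             ≤⟨ le ⟩
    ℚ.↥ y ℤ.* ℚ.↧ x             ≡⟨ cong (λ i → i ℤ.* ℚ.↧ x) (numerator-≥0 (ℚₚ.≤-trans 0≤x x≤y)) ⟨
    + ∣ ℚ.↥ y ∣ ℤ.* ℚ.↧ x       ≡⟨ ℤₚ.pos-* (∣ ℚ.↥ y ∣) (ℚ.↧ₙ x) ⟨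
    + (∣ ℚ.↥ y ∣ * ℚ.↧ₙ x) ∎)
  where open ℤₚ.≤-Reasoning

0≤right : ∀ μ → 0ℚᵘ ℚ.≤ right μ
0≤right μ = ℚₚ.≤-trans (0≤left μ) (left≤right μ)

Scaled-Block : ∀ {D j} μ → Scaled D (rawOf μ) j → Block D j
Scaled-Block {D} {α , β} μ (eq , eq′) = α≤β , β≤D
  where
  p = ∣ ℚ.↥ left μ ∣
  q = ℚ.↧ₙ left μ
  p′ = ∣ ℚ.↥ right μ ∣
  q′ = ℚ.↧ₙ right μ
  lem : ∀ a b c → a * (b * c) ≡ a * b * c
  lem = NatSolver.solve-∀
  lem′ : ∀ p D q′ → p * D * q′ ≡ p * q′ * D
  lem′ = NatSolver.solve-∀
  lem″ : ∀ b q q′ → b * (q * q′) ≡ b * q′ * q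
  lem″ = NatSolver.solve-∀
  α≤β : α ≤ β
  α≤β = *-cancelʳ-≤ α β (q * q′) (begin
      α * (q * q′)   ≡⟨ lem α q q′ ⟩
      α * q * q′     ≡⟨ cong (λ k → k * q′) eq ⟩
      p * D * q′     ≡⟨ lem′ p D q′ ⟩
      p * q′ * D     ≤⟨ *-monoˡ-≤ D (cross-≤ (0≤left μ) (left≤right μ)) ⟩
      p′ * q * D     ≡⟨ lem′ p′ D q ⟨
      p′ * D * q     ≡⟨ cong (λ k → k * q) eq′ ⟨
      β * q′ * q     ≡⟨ lem″ β q q′ ⟨
      β * (q * q′) ∎)
    where open ≤-Reasoning
  β≤D : β ≤ D
  β≤D = *-cancelʳ-≤ β D q′ (begin
      β * q′         ≡⟨ eq′ ⟩
      p′ * D         ≡⟨ cong (λ k → k * D) (*-identityʳ p′) ⟨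
      p′ * 1 * D     ≤⟨ *-monoˡ-≤ D (cross-≤ (0≤right μ) (right≤1 μ)) ⟩
      1 * q′ * D     ≡⟨ trans (cong (λ k → k * D) (*-identityˡ q′)) (*-comm q′ D) ⟩
      D * q′ ∎)
    where open ≤-Reasoning

ι-scaled : ∀ k {D x a} → 0ℚᵘ ℚ.≤ x → suc k ≡ 8 * D → a * ℚ.↧ₙ x ≡ ∣ ℚ.↥ x ∣ * D →
  x ≃ ι k (2 * (2 * (2 * a)))
ι-scaled k {D} {x@record{}} {a} 0≤x k≡ eq = *≡* (begin
    ℚ.↥ x ℤ.* + suc k
      ≡⟨ cong₂ ℤ._*_ (sym (numerator-≥0 0≤x)) (cong +_ k≡) ⟩
    + ∣ ℚ.↥ x ∣ ℤ.* + (8 * D)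
      ≡⟨ ℤₚ.pos-* (∣ ℚ.↥ x ∣) (8 * D) ⟨
    + (∣ ℚ.↥ x ∣ * (8 * D))
      ≡⟨ cong +_ (trans (lem (∣ ℚ.↥ x ∣) D) (trans (cong (λ k → 8 * k) (sym eq)) (lem′ a (ℚ.↧ₙ x)))) ⟩
    + (2 * (2 * (2 * a)) * ℚ.↧ₙ x)
      ≡⟨ ℤₚ.pos-* (2 * (2 * (2 * a))) (ℚ.↧ₙ x) ⟩
    + (2 * (2 * (2 * a))) ℤ.* ℚ.↧ x ∎)
  where
  open ≡-Reasoning
  lem : ∀ p D → p * (8 * D) ≡ 8 * (p * D)
  lem = NatSolver.solve-∀
  lem′ : ∀ a q → 8 * (a * q) ≡ 2 * (2 * (2 * a)) * q
  lem′ = NatSolver.solve-∀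

denominator-positive : ∀ {n} (μs : Vec SingleBlock n) → 1 ≤ proj₁ (commonDenominator (rawsOf μs))
denominator-positive []       = ≤-refl
denominator-positive (μ ∷ μs) = *-mono-≤ {1} {ℚ.↧ₙ left μ * ℚ.↧ₙ right μ} {1} (s≤s z≤n) (denominator-positive μs)

blocks : ∀ {n D js} (μs : Vec SingleBlock n) → Pointwise (Scaled D) (rawsOf μs) js → All (Block D) js
blocks []       []       = []
blocks (μ ∷ μs) (s ∷ ss) = Scaled-Block μ s ∷ blocks μs ss

length-scaled : ∀ {n D js} (μs : Vec SingleBlock n) → Pointwise (Scaled D) (rawsOf μs) js → List.length js ≡ n
length-scaled []       []       = refl
length-scaled (μ ∷ μs) (s ∷ ss) = cong suc (length-scaled μs ss)

lookup-scaled : ∀ {n D js} {Q : Agent → Set} (μs : Vec SingleBlock n) →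
  Pointwise (Scaled D) (rawsOf μs) js → All Q js →
  ∀ i → ∃[ j ] Scaled D (rawOf (Vec.lookup μs i)) j × Q j
lookup-scaled (μ ∷ μs) (s ∷ ss) (h ∷ hs) zero    = _ , s , h
lookup-scaled (μ ∷ μs) (s ∷ ss) (h ∷ hs) (suc i) = lookup-scaled μs ss hs i

module _ {n : ℕ} (μs : Vec SingleBlock n) where

  private
    D = proj₁ (commonDenominator (rawsOf μs))
    js = proj₂ (commonDenominator (rawsOf μs))

    solved : List Seg
    solved = solve js

    scaled : Pointwise (Scaled D) (rawsOf μs) js
    scaled = commonDenominator-scaled (rawsOf μs)

    open Halved (solve-halves D js (blocks μs scaled))

    -- Grid points count units of 1/(4D) and cuts half of these, so positions have denominator 8D;
    -- `mkℚᵘ` takes its predecessor.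
    k : ℕ
    k = ℕ.pred (8 * D)

    k≡ : suc k ≡ 8 * D
    k≡ = suc-pred (8 * D) {{ℕ.>-nonZero (≤-trans (denominator-positive μs) (m≤n*m D 8))}}

    within : 2 * last ≤ suc k
    within = ≤-trans (*-monoʳ-≤ 2 last≤) (≤-reflexive (trans (sym (*-assoc 2 4 D)) (sym k≡)))

  partition : Partition n
  partition = record
    { cutCount≤n = ≤-trans few-cuts (≤-reflexive (length-scaled μs scaled))
    ; cuts       = cutVec k (cutsOf solved)
    ; ordered    = cuts-ordered k solved links valid (ℚₚ.≤-trans (ℚₚ.≤-reflexive (ℚₚ.≃-sym (ι-0 k))) (ι-mono k z≤n)) within
    ; labels     = alternate false (List.length (cutsOf solved))
    }

  partition-halves : ∀ i → ℚ.∣ measure (Vec.lookup μs i) (I⁺ partition) ℚ.- measure (Vec.lookup μs i) (I⁻ partition) ∣ ℚ.≤ ½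
  partition-halves i with lookup-scaled μs scaled (All.zip (blocks μs scaled , halved)) i
  ... | j@(α , β) , (eq , eq′) , (α≤β , _) , (first≤ , ≤last , cl , cr , bound) =
    height-difference k μ l≃ r≃ (*-monoʳ-≤ 2 end≤)
      (proj₁ (measure-parts k μ l≃ r≃ false (cutsOf solved) (ℚₚ.≃-sym (ι-0 k))))
      (proj₂ (measure-parts k μ l≃ r≃ false (cutsOf solved) (ℚₚ.≃-sym (ι-0 k))))
      (≤-trans (*-monoʳ-≤ 2 (≤-trans (≤-reflexive (cong ∣_∣
          (parts-spanSum solved links valid cl cr first≤ end≤ ≤last within))) bound))
        (≤-reflexive width≡))
    where
    μ = Vec.lookup μs i
    l≃ : left μ ≃ ι k (2 * endˡ j)
    l≃ = ι-scaled k {a = α} (0≤left μ) k≡ eq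
    r≃ : right μ ≃ ι k (2 * endʳ j)
    r≃ = ι-scaled k {a = β} (0≤right μ) k≡ eq′
    end≤ : endˡ j ≤ endʳ j
    end≤ = *-monoʳ-≤ 2 (*-monoʳ-≤ 2 α≤β)
    width≡ : 2 * (4 * span j) ≡ 2 * endʳ j ∸ 2 * endˡ j
    width≡ = trans (lem (β ∸ α)) (trans (cong (λ k → 2 * k) (trans (cong (λ k → 2 * k) (*-distribˡ-∸ 2 β α)) (*-distribˡ-∸ 2 (2 * β) (2 * α))))
      (*-distribˡ-∸ 2 (endʳ j) (endˡ j)))
      where
      lem : ∀ s → 2 * (4 * s) ≡ 2 * (2 * (2 * s))
      lem = NatSolver.solve-∀

-- The algorithm on trees

toList : Tree → List Tree
toList nil     = []
toList (e ∙ t) = e ∷ toList t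

dbl : Tree → Tree
dbl t = nil ∙ t

notT : Tree → Tree
notT b = ite b nil one

-- Block ends are nonnegative, so the absolute value of the numerator is the numerator itself.
parseRational : Tree → Tree
parseRational r = fromBijective (tlT (hdT r)) ∙ fromBijective (tlT r)

parseBlock : Tree → Tree
parseBlock e = parseRational (hdT e) ∙ parseRational (hdT (tlT e))

rescaleT : Tree → Tree → Tree
rescaleT k j = mulT k (hdT j) ∙ mulT k (tlT j)

addRawT : Tree → Tree → Tree
addRawT e r =
  mulT (mulT (tlT (hdT e)) (tlT (tlT e))) (hdT r) ∙
  (mulT (hdT (hdT e)) (mulT (tlT (tlT e)) (hdT r)) ∙ mulT (hdT (tlT e)) (mulT (tlT (hdT e)) (hdT r))) ∙
  mapT (rescaleT (mulT (tlT (hdT e)) (tlT (tlT e)))) (tlT r)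

commonT : Tree → Tree
commonT = fr addRawT ((one ∙ nil) ∙ nil)

endˡT midˡT midʳT endʳT : Tree → Tree
endˡT j = dbl (dbl (hdT j))
midˡT j = addT (addT (hdT j) (dbl (hdT j))) (tlT j)
midʳT j = addT (hdT j) (addT (tlT j) (dbl (tlT j)))
endʳT j = dbl (dbl (tlT j))

pointsT : Tree → Tree
pointsT = fr (λ j ts → endˡT j ∙ midˡT j ∙ midʳT j ∙ endʳT j ∙ ts) nil

insertT : (Tree → Tree → Tree) → Tree → Tree → Tree
insertT le = transduce (λ e s → ite (le s e) s e) (λ e s → ite (le s e) e s) (λ s → s ∙ nil)

sortT : (Tree → Tree → Tree) → Tree → Tree
sortT le = fr (insertT le) nil

longerT : Tree → Tree → Tree
longerT j k = leT (addT (tlT k) (hdT j)) (addT (tlT j) (hdT k))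

gridT : Tree → Tree
gridT ts = transduce (λ e s → s ∙ e ∙ nil) (λ e s → e) (λ s → nil) (hdT ts) (tlT ts)

-- A status is `nil` for a free segment, `one` for a kept one and `one ∙ X` for a cut at X: being
-- `nil` decides freeness, and the head decides whether there is a cut.
statusT : Tree → Tree
statusT e = tlT (tlT e)

activeT : Tree → Tree → Tree
activeT w e = andT (andT (leT (hdT w) (hdT e)) (leT (hdT (tlT e)) (tlT w))) (notT (statusT e))

exitT : Tree → Tree → Tree
exitT s e = xorT s (hdT (statusT e))

-- z is the triple of a sign and the two sums.
sumStep : Tree → Tree → Tree → Tree
sumStep w e z = ite (activeT w e)
  (hdT z ∙ ite (hdT z)
    (addT (hdT (tlT z)) (hdT e) ∙ addT (tlT (tlT z)) (hdT (tlT e)))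
    (addT (hdT (tlT z)) (hdT (tlT e)) ∙ addT (tlT (tlT z)) (hdT e)))
  (exitT (hdT z) e ∙ tlT z)

sumsT : Tree → Tree → Tree
sumsT w t = st (sumStep w) (nil ∙ nil ∙ nil) t

-- z consists of whether the cut has been placed, a sign, and the two potentials.
lower upper : Tree → Tree
lower z = ite (hdT (tlT z)) (tlT (tlT (tlT z))) (hdT (tlT (tlT z)))
upper z = ite (hdT (tlT z)) (hdT (tlT (tlT z))) (tlT (tlT (tlT z)))

crossT : Tree → Tree → Tree
crossT e z = andT (leT (lower z) (upper z))
  (leT (addT (upper z) (dbl (hdT e))) (addT (lower z) (dbl (hdT (tlT e)))))

placeOut : Tree → Tree → Tree → Tree
placeOut w e z = ite (activeT w e)
  (hdT e ∙ hdT (tlT e) ∙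
    ite (hdT z) one (ite (crossT e z) (one ∙ addT (dbl (hdT e)) (subT (upper z) (lower z))) one))
  e

placeNext : Tree → Tree → Tree → Tree
placeNext w e z = ite (activeT w e)
  (ite (hdT z) z (ite (crossT e z) (one ∙ tlT z)
    (hdT z ∙ hdT (tlT z) ∙
      addT (hdT (tlT (tlT z))) (dbl (ite (hdT (tlT z)) (hdT e) (hdT (tlT e)))) ∙
      addT (tlT (tlT (tlT z))) (dbl (ite (hdT (tlT z)) (hdT (tlT e)) (hdT e))))))
  (hdT z ∙ exitT (hdT (tlT z)) e ∙ tlT (tlT z))

placeT : Tree → Tree → Tree → Tree
placeT w z t = transduce (placeOut w) (placeNext w) (λ _ → nil) z t

stepT : Tree → Tree → Tree
stepT j t = placeT (midˡT j ∙ midʳT j)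
  (nil ∙ nil ∙ tlT (tlT (sumsT (midˡT j ∙ midʳT j) t)) ∙ hdT (tlT (sumsT (midˡT j ∙ midʳT j) t))) t

runT : Tree → Tree → Tree
runT js t = fr stepT t js

cutsT : Tree → Tree → Tree
cutsT den = fr (λ e r → ite (hdT (statusT e))
  (((nil ∙ toBijective (tlT (statusT e))) ∙ den) ∙ r) r) nil

labelsT : Tree → Tree
labelsT = transduce (λ e s → s) (λ e s → notT s) (λ s → s ∙ nil) nil

scaleStage solveStage cutStage labelStage algorithmT : Tree → Tree
scaleStage x = commonT (mapT parseBlock x)
solveStage c = hdT c ∙ runT (sortT longerT (tlT c)) (gridT (sortT leT (pointsT (tlT c))))
cutStage y   = cutsT (toBijective (dbl (dbl (dbl (hdT y))))) (tlT y)
labelStage c = c ∙ labelsT c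
algorithmT x = labelStage (cutStage (solveStage (scaleStage x)))

-- Programs for the stages of the algorithm

dblᵖ : ∀ {f} → PT f → PT (λ x → dbl (f x))
dblᵖ F = nilᵖ ∙ᵖ F

notᵖ : ∀ {f} → PT f → PT (λ x → notT (f x))
notᵖ F = iteᵖ F nilᵖ oneᵖ

parseRationalᵖ : PT parseRational
parseRationalᵖ = fromBijectiveᵖ ∘ᵖ tlᵖ ∘ᵖ hdᵖ ∙ᵖ fromBijectiveᵖ ∘ᵖ tlᵖ

parseBlockᵖ : PT parseBlock
parseBlockᵖ = parseRationalᵖ ∘ᵖ hdᵖ ∙ᵖ parseRationalᵖ ∘ᵖ hdᵖ ∘ᵖ tlᵖ

rescaleᵖ : PT₂ rescaleT
rescaleᵖ = uncurried ((mulᵖ $₂ hdᵖ , hdᵖ ∘ᵖ tlᵖ) ∙ᵖ (mulᵖ $₂ hdᵖ , tlᵖ ∘ᵖ tlᵖ))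

addRawᵖ : PT₂ addRawT
addRawᵖ = uncurried
  ((mulᵖ $₂ Q , D) ∙ᵖ
   ((mulᵖ $₂ hdᵖ ∘ᵖ hdᵖ ∘ᵖ hdᵖ , (mulᵖ $₂ q′ , D)) ∙ᵖ (mulᵖ $₂ hdᵖ ∘ᵖ tlᵖ ∘ᵖ hdᵖ , (mulᵖ $₂ q , D))) ∙ᵖ
   mapᵖ {f = λ x → rescaleT (mulT (tlT (hdT (hdT x))) (tlT (tlT (hdT x))))}
     (uncurried (rescaleᵖ $₂ Q ∘ᵖ hdᵖ , tlᵖ)) (tlᵖ ∘ᵖ tlᵖ))
  where
  q = tlᵖ ∘ᵖ hdᵖ ∘ᵖ hdᵖ
  q′ = tlᵖ ∘ᵖ tlᵖ ∘ᵖ hdᵖ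
  D = hdᵖ ∘ᵖ tlᵖ
  Q : PT (λ x → mulT (tlT (hdT (hdT x))) (tlT (tlT (hdT x))))
  Q = mulᵖ $₂ q , q′

endˡᵖ : PT endˡT
endˡᵖ = dblᵖ (dblᵖ hdᵖ)

midˡᵖ : PT midˡT
midˡᵖ = addᵖ $₂ (addᵖ $₂ hdᵖ , dblᵖ hdᵖ) , tlᵖ

midʳᵖ : PT midʳT
midʳᵖ = addᵖ $₂ hdᵖ , (addᵖ $₂ tlᵖ , dblᵖ tlᵖ)

endʳᵖ : PT endʳT
endʳᵖ = dblᵖ (dblᵖ tlᵖ)

pointsᵖ : PT pointsT
pointsᵖ = frᵖ-additive {g = λ _ j ts → endˡT j ∙ midˡT j ∙ midʳT j ∙ endʳT j ∙ ts}
  (uncurried (endˡᵖ ∘ᵖ e ∙ᵖ midˡᵖ ∘ᵖ e ∙ᵖ midʳᵖ ∘ᵖ e ∙ᵖ endʳᵖ ∘ᵖ e ∙ᵖ tlᵖ ∘ᵖ tlᵖ))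
  nilᵖ idᵖ (PT.bound four) λ x j ts → ≤-trans (n≤1+n _) (≤-trans
    (≤-reflexive (lem (size (endˡT j)) (size (midˡT j)) (size (midʳT j)) (size (endʳT j)) (size ts)))
    (+-monoʳ-≤ (size ts) (≤-trans (size-PT four j)
      (⟦⟧-mono (PT.bound four) (m≤n+m (size j) (size x))))))
  where
  e = hdᵖ ∘ᵖ tlᵖ
  four : PT (λ j → endˡT j ∙ midˡT j ∙ midʳT j ∙ endʳT j ∙ nil)
  four = endˡᵖ ∙ᵖ midˡᵖ ∙ᵖ midʳᵖ ∙ᵖ endʳᵖ ∙ᵖ nilᵖ
  lem : ∀ a b c d t → suc (suc (a + suc (b + suc (c + suc (d + t))))) ≡ t + suc (a + suc (b + suc (c + suc (d + 1))))
  lem = NatSolver.solve-∀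

size-choose : ∀ c x y → size (ite c x y) + size (ite c y x) ≡ size x + size y
size-choose nil     x y = +-comm (size y) (size x)
size-choose (_ ∙ _) x y = refl

-- At each position one of the two elements is written and the other carried on, so nothing is
-- duplicated.
size-insert : ∀ le s t → size (insertT le s t) ≡ suc (size s + size t)
size-insert le s nil     = refl
size-insert le s (e ∙ t) = cong suc (begin
    size (ite (le s e) s e) + size (insertT le (ite (le s e) e s) t)
      ≡⟨ cong (λ k → size (ite (le s e) s e) + k) (size-insert le (ite (le s e) e s) t) ⟩
    size (ite (le s e) s e) + suc (size (ite (le s e) e s) + size t)
      ≡⟨ lem (size (ite (le s e) s e)) (size (ite (le s e) e s)) (size t) ⟩
    suc (size (ite (le s e) s e) + size (ite (le s e) e s) + size t)
      ≡⟨ cong (λ k → suc (k + size t)) (size-choose (le s e) s e) ⟩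
    suc (size s + size e + size t)
      ≡⟨ lem′ (size s) (size e) (size t) ⟩
    size s + suc (size e + size t) ∎)
  where
  open ≡-Reasoning
  lem : ∀ a b t → a + suc (b + t) ≡ suc (a + b + t)
  lem = NatSolver.solve-∀
  lem′ : ∀ a b t → suc (a + b + t) ≡ a + suc (b + t)
  lem′ = NatSolver.solve-∀

insertᵖ : ∀ {le} → PT₂ le → PT₂ (insertT le)
insertᵖ {le} L = uncurried (transduceᵖ-additive
  {o = λ _ e s → ite (le s e) s e} {nx = λ _ e s → ite (le s e) e s} {fin = λ _ s → s ∙ nil}
  (uncurried (iteᵖ (L $₂ s , e) s e)) (uncurried (iteᵖ (L $₂ s , e) e s))
  (uncurried (tlᵖ ∙ᵖ nilᵖ)) hdᵖ tlᵖ var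
  λ x e s → size-ite≤ (le s e) e s (m≤n⇒m≤o+n (size s) (m≤n+m (size e) (size x))) (m≤m+n (size s) _))
  where
  e = hdᵖ ∘ᵖ tlᵖ
  s = tlᵖ ∘ᵖ tlᵖ

sortᵖ : ∀ {le} → PT₂ le → PT (sortT le)
sortᵖ {le} L = frᵖ-additive {g = λ _ e r → insertT le e r}
  (uncurried (insertᵖ L $₂ hdᵖ ∘ᵖ tlᵖ , tlᵖ ∘ᵖ tlᵖ)) nilᵖ idᵖ (con 1 ⊕ var)
  λ x e r → ≤-trans (≤-reflexive (trans (size-insert le e r) (+-comm (suc (size e)) (size r))))
    (+-monoʳ-≤ (size r) (s≤s (m≤n+m (size e) (size x))))

longerᵖ : PT₂ longerT
longerᵖ = uncurried (leᵖ $₂ (addᵖ $₂ tlᵖ ∘ᵖ tlᵖ , hdᵖ ∘ᵖ hdᵖ) , (addᵖ $₂ tlᵖ ∘ᵖ hdᵖ , hdᵖ ∘ᵖ tlᵖ))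

gridᵖ : PT gridT
gridᵖ = transduceᵖ-additive {o = λ _ e s → s ∙ e ∙ nil} {nx = λ _ e s → e} {fin = λ _ s → nil}
  (uncurried (tlᵖ ∘ᵖ tlᵖ ∙ᵖ hdᵖ ∘ᵖ tlᵖ ∙ᵖ nilᵖ)) (uncurried (hdᵖ ∘ᵖ tlᵖ)) (uncurried nilᵖ) hdᵖ tlᵖ var
  λ x e s → m≤n⇒m≤o+n (size s) (m≤n+m (size e) (size x))

cutsᵖ : PT₂ cutsT
cutsᵖ = uncurried (frᵖ-additive
  {g = λ x e r → ite (hdT (statusT e)) (((nil ∙ toBijective (tlT (statusT e))) ∙ hdT x) ∙ r) r}
  (uncurried (iteᵖ (hdᵖ ∘ᵖ statusᵖ ∘ᵖ hdᵖ ∘ᵖ tlᵖ)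
    (((nilᵖ ∙ᵖ toBijectiveᵖ ∘ᵖ tlᵖ ∘ᵖ statusᵖ ∘ᵖ hdᵖ ∘ᵖ tlᵖ) ∙ᵖ hdᵖ ∘ᵖ hdᵖ) ∙ᵖ tlᵖ ∘ᵖ tlᵖ)
    (tlᵖ ∘ᵖ tlᵖ)))
  nilᵖ tlᵖ (con 1 ⊕ PT.bound cut [ con 1 ⊕ var ]) λ x e r → size-ite≤ (hdT (statusT e)) _ _
    (≤-trans (s≤s (+-monoˡ-≤ (size r) (≤-trans (size-PT cut (x ∙ e))
        (≤-reflexive (sym (⟦⟧-subst (PT.bound cut) (con 1 ⊕ var) (size x + size e)))))))
      (≤-reflexive (+-comm (suc _) (size r))))
    (m≤m+n (size r) _))
  where
  statusᵖ : PT statusT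
  statusᵖ = tlᵖ ∘ᵖ tlᵖ
  cut : PT (λ y → (nil ∙ toBijective (tlT (statusT (tlT y)))) ∙ hdT (hdT y))
  cut = (nilᵖ ∙ᵖ toBijectiveᵖ ∘ᵖ tlᵖ ∘ᵖ statusᵖ ∘ᵖ tlᵖ) ∙ᵖ hdᵖ ∘ᵖ hdᵖ

labelsᵖ : PT labelsT
labelsᵖ = transduceᵖ-additive {o = λ _ e s → s} {nx = λ _ e s → notT s} {fin = λ _ s → s ∙ nil}
  (uncurried (tlᵖ ∘ᵖ tlᵖ)) (uncurried (notᵖ (tlᵖ ∘ᵖ tlᵖ))) (uncurried (tlᵖ ∙ᵖ nilᵖ)) nilᵖ idᵖ (con 3)
  λ x e s → size-ite≤ s _ _ (m≤n⇒m≤o+n (size s) (s≤s z≤n)) (m≤n+m 3 (size s))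

-- The size of a sum may be twice the size of the longer summand, its length is only one
-- more, so bounds that survive iteration are stated for lengths.

Num : ℕ → Tree → Set
Num K t = len t ≤ K × size t ≤ 1 + 4 * K

Num-mono : ∀ {K L t} → K ≤ L → Num K t → Num L t
Num-mono K≤L (l , s) = ≤-trans l K≤L , ≤-trans s (s≤s (*-monoʳ-≤ 4 K≤L))

Num-size : ∀ t → Num (size t) t
Num-size t = len≤size t , m≤n⇒m≤1+n (m≤n*m (size t) 4)

Num-add : ∀ {K} a b → len a ≤ K → len b ≤ K → Num (suc K) (addT a b)
Num-add {K} a b la lb = len-add a b la lb , ≤-trans (size-add a b) (s≤s (*-monoʳ-≤ 4 (len-add a b la lb)))

Num-mul : ∀ {K L} a b → len a ≤ K → len b ≤ L → Num (L + 2 * K) (mulT a b)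
Num-mul {K} {L} a b la lb = l , ≤-trans (size-mul a b) (s≤s (*-monoʳ-≤ 4 l))
  where
  l : len (mulT a b) ≤ L + 2 * K
  l = ≤-trans (len-mul a b) (+-mono-≤ lb (*-monoʳ-≤ 2 la))

size-hd-tl : ∀ t → size t ≤ 1 + size (hdT t) + size (tlT t)
size-hd-tl nil     = s≤s z≤n
size-hd-tl (x ∙ y) = ≤-refl

size-elements : ∀ {M} t → All (λ e → size e ≤ M) (toList t) → size t ≤ 1 + len t * suc M
size-elements nil []           = ≤-refl
size-elements {M} (e ∙ t) (h ∷ hs) = s≤s (≤-trans (+-mono-≤ h (size-elements t hs))
  (≤-reflexive (+-suc M (len t * suc M))))

elements-size : ∀ {M} t → size t ≤ M → All (λ e → size e ≤ M) (toList t)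
elements-size nil     h = []
elements-size (e ∙ t) h = ≤-trans (size-left e t) h
  ∷ elements-size t (≤-trans (size-right e t) h)

len-mapT : ∀ f t → len (mapT f t) ≡ len t
len-mapT f nil     = refl
len-mapT f (e ∙ t) = cong suc (len-mapT f t)

All-mapT : ∀ {P Q : Tree → Set} f t → (∀ e → P e → Q (f e)) → All P (toList t) → All Q (toList (mapT f t))
All-mapT f nil     h []       = []
All-mapT f (e ∙ t) h (p ∷ ps) = h e p ∷ All-mapT f t h ps

NumPair : ℕ → Tree → Set
NumPair K j = Num K (hdT j) × Num K (tlT j)

NumPair-size : ∀ {K} j → NumPair K j → size j ≤ 3 + 8 * K
NumPair-size {K} j ((_ , s) , (_ , s′)) = ≤-trans (size-hd-tl j) (≤-trans (s≤s (+-mono-≤ s s′))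
  (≤-reflexive (lem K)))
  where
  lem : ∀ K → 1 + ((1 + 4 * K) + (1 + 4 * K)) ≡ 3 + 8 * K
  lem = NatSolver.solve-∀

record Common (K : ℕ) (r : Tree) : Set where
  field
    denominator : Num K (hdT r)
    count       : len (tlT r) ≤ K
    agents      : All (NumPair K) (toList (tlT r))

-- `mulT` yields at most the digits of the second factor plus twice those of the first. So the
-- product Q of the two new denominators has at most 3σ digits, and multiplying by Q adds at most
-- 6σ. The increment is independent of `K` and adds up linearly over the list.
addRaw-Common : ∀ {K} e r → Common K r → Common (K + 6 * size e) (addRawT e r)
addRaw-Common {K} e r c = record
  { denominator = Num-mono (≤-reflexive (lem K σ)) (Num-mul Q D (proj₁ Q≤) (proj₁ denominator))
  ; count       = ≤-trans (≤-reflexive (cong suc (len-mapT (rescaleT Q) (tlT r))))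
                    (≤-trans (≤-reflexive (+-comm 1 _)) (+-mono-≤ count (≤-trans (0<size e) (m≤n*m σ 6))))
  ; agents      = (product p q′ p≤ q′≤ , product p′ q p′≤ q≤)
                  ∷ All-mapT (rescaleT Q) (tlT r) (λ j (h , h′) → rescaled (hdT j) h , rescaled (tlT j) h′) agents
  }
  where
  open Common c
  σ = size e
  D = hdT r
  p = hdT (hdT e)
  q = tlT (hdT e)
  p′ = hdT (tlT e)
  q′ = tlT (tlT e)
  Q = mulT q q′
  within : ∀ x {y} → size x ≤ size y → size y ≤ σ → len x ≤ σ
  within x h h′ = ≤-trans (len≤size x) (≤-trans h h′)
  p≤ = within p (size-hd (hdT e)) (size-hd e)
  q≤ = within q (size-tl (hdT e)) (size-hd e)
  p′≤ = within p′ (size-hd (tlT e)) (size-tl e)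
  q′≤ = within q′ (size-tl (tlT e)) (size-tl e)
  Q≤ = Num-mul q q′ q≤ q′≤
  lem : ∀ K σ → K + 2 * (σ + 2 * σ) ≡ K + 6 * σ
  lem = NatSolver.solve-∀
  product : ∀ x y → len x ≤ σ → len y ≤ σ → Num (K + 6 * σ) (mulT x (mulT y D))
  product x y hx hy = Num-mono {K + 2 * σ + 2 * σ} {K + 6 * σ} {mulT x (mulT y D)} (≤-trans (≤-reflexive (lem₁ K σ)) (+-monoʳ-≤ K (*-monoˡ-≤ σ (m≤m+n 4 2))))
    (Num-mul {σ} {K + 2 * σ} x (mulT y D) hx (proj₁ (Num-mul {σ} {K} y D hy (proj₁ denominator))))
    where
    lem₁ : ∀ K σ → (K + 2 * σ) + 2 * σ ≡ K + 4 * σ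
    lem₁ = NatSolver.solve-∀
  rescaled : ∀ x → Num K x → Num (K + 6 * σ) (mulT Q x)
  rescaled x h = Num-mono (≤-reflexive (lem K σ)) (Num-mul Q x (proj₁ Q≤) (proj₁ h))

common-Common : ∀ t → Common (1 + 6 * size t) (commonT t)
common-Common nil = record
  { denominator = s≤s z≤n , s≤s (s≤s (s≤s (s≤s (s≤s z≤n)))) ; count = z≤n ; agents = [] }
common-Common (e ∙ t) = weaken (addRaw-Common e (commonT t) (common-Common t)) mono
  where
  mono : (1 + 6 * size t) + 6 * size e ≤ 1 + 6 * size (e ∙ t)
  mono = s≤s (≤-trans (≤-reflexive (trans (+-comm (6 * size t) (6 * size e)) (sym (*-distribˡ-+ 6 (size e) (size t)))))
    (*-monoʳ-≤ 6 (n≤1+n _)))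
  weaken : ∀ {K L r} → Common K r → K ≤ L → Common L r
  weaken c h = record
    { denominator = Num-mono h denominator ; count = ≤-trans count h
    ; agents = All.map (λ (x , y) → Num-mono h x , Num-mono h y) agents }
    where open Common c

commonᵖ : PT commonT
commonᵖ = frᵖ {g = λ _ → addRawT} (uncurried (addRawᵖ $₂ hdᵖ ∘ᵖ tlᵖ , tlᵖ ∘ᵖ tlᵖ)) ((oneᵖ ∙ᵖ nilᵖ) ∙ᵖ nilᵖ) idᵖ
  (B [ con 1 ⊕ con 6 ⊗ var ]) λ x t → ≤-trans (bounded (commonT t) (common-Common t))
    (⟦⟧-mono-subst B (con 1 ⊕ con 6 ⊗ var) (size x + size t)
      (s≤s (*-monoʳ-≤ 6 (m≤n+m (size t) (size x)))))
  where
  B : Poly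
  B = con 1 ⊕ (con 1 ⊕ con 4 ⊗ var) ⊕ (con 1 ⊕ var ⊗ (con 4 ⊕ con 8 ⊗ var))
  bounded : ∀ {K} r → Common K r → size r ≤ ⟦ B ⟧ K
  bounded {K} r c = ≤-trans (size-hd-tl r) (+-mono-≤ (s≤s (proj₂ denominator))
    (≤-trans (size-elements (tlT r) (All.map (λ {j} → NumPair-size j) agents))
      (s≤s (*-monoˡ-≤ (4 + 8 * K) count))))
    where open Common c

LenPair : ℕ → Tree → Set
LenPair K e = len (hdT e) ≤ K × len (hdT (tlT e)) ≤ K

LenPair-mono : ∀ {K L e} → K ≤ L → LenPair K e → LenPair L e
LenPair-mono h (x , y) = ≤-trans x h , ≤-trans y h

LenPair-size : ∀ {K} e → size e ≤ K → LenPair K e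
LenPair-size e h = ≤-trans (len≤size (hdT e)) (≤-trans (size-hd e) h) ,
  ≤-trans (len≤size (hdT (tlT e))) (≤-trans (size-hd (tlT e)) (≤-trans (size-tl e) h))

size-exit : ∀ s e → size (exitT s e) ≤ 3
size-exit s e = size-xor s (hdT (statusT e))

ite-elim : (P : Tree → Set) → ∀ c {x y} → P x → P y → P (ite c x y)
ite-elim P nil     px py = py
ite-elim P (_ ∙ _) px py = px

record Sums (K : ℕ) (z : Tree) : Set where
  constructor mkSums
  field
    sign  : size (hdT z) ≤ 3 + K
    plus  : Num K (hdT (tlT z))
    minus : Num K (tlT (tlT z))

sumStep-Sums : ∀ {K} w e z → LenPair K e → Sums K z → Sums (suc K) (sumStep w e z)
sumStep-Sums {K} w e z (lo , hi) (mkSums s p n) = ite-elim (Sums (suc K)) (activeT w e)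
  (mkSums (m≤n⇒m≤1+n s)
    (ite-elim (λ y → Num (suc K) (hdT y)) (hdT z) (Num-add _ _ (proj₁ p) lo) (Num-add _ _ (proj₁ p) hi))
    (ite-elim (λ y → Num (suc K) (tlT y)) (hdT z) (Num-add _ _ (proj₁ n) hi) (Num-add _ _ (proj₁ n) lo)))
  (mkSums (≤-trans (size-exit (hdT z) e) (m≤m+n 3 (suc K))) (Num-mono (n≤1+n K) p) (Num-mono (n≤1+n K) n))

st-Sums : ∀ {K} w z t → All (LenPair K) (toList t) → Sums K z → Sums (len t + K) (st (sumStep w) z t)
st-Sums w z nil [] h = h
st-Sums {K} w z (e ∙ t) (p ∷ ps) h = subst (λ L → Sums L (st (sumStep w) (sumStep w e z) t)) (+-suc (len t) K)
  (st-Sums w (sumStep w e z) t (All.map (λ {e} → LenPair-mono {e = e} (n≤1+n K)) ps) (sumStep-Sums w e z p h))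

size-Sums : ∀ {K} z → Sums K z → size z ≤ 7 + 9 * K
size-Sums {K} z (mkSums s (_ , p) (_ , n)) = ≤-trans (size-hd-tl z) (≤-trans
  (+-mono-≤ (s≤s s) (≤-trans (size-hd-tl (tlT z)) (s≤s (+-mono-≤ p n))))
  (≤-reflexive (lem K)))
  where
  lem : ∀ K → (4 + K) + (1 + ((1 + 4 * K) + (1 + 4 * K))) ≡ 7 + 9 * K
  lem = NatSolver.solve-∀

Sums-start : ∀ {K} → Sums K (nil ∙ nil ∙ nil)
Sums-start = mkSums (s≤s z≤n) (z≤n , s≤s z≤n) (z≤n , s≤s z≤n)

activeᵖ : PT₂ activeT
activeᵖ = uncurried (andᵖ $₂
  (andᵖ $₂ (leᵖ $₂ hdᵖ ∘ᵖ hdᵖ , hdᵖ ∘ᵖ tlᵖ) , (leᵖ $₂ hdᵖ ∘ᵖ tlᵖ ∘ᵖ tlᵖ , tlᵖ ∘ᵖ hdᵖ)) ,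
  notᵖ (tlᵖ ∘ᵖ tlᵖ ∘ᵖ tlᵖ))

exitᵖ : PT₂ exitT
exitᵖ = uncurried (xorᵖ $₂ hdᵖ , hdᵖ ∘ᵖ tlᵖ ∘ᵖ tlᵖ ∘ᵖ tlᵖ)

sumStepᵖ : PT₃ sumStep
sumStepᵖ = uncurried (iteᵖ (activeᵖ $₂ hdᵖ , e)
  (s ∙ᵖ iteᵖ s
    ((addᵖ $₂ P , loᵖ) ∙ᵖ (addᵖ $₂ N , hiᵖ))
    ((addᵖ $₂ P , hiᵖ) ∙ᵖ (addᵖ $₂ N , loᵖ)))
  ((exitᵖ $₂ s , e) ∙ᵖ tlᵖ ∘ᵖ z))
  where
  e = hdᵖ ∘ᵖ tlᵖ
  z = tlᵖ ∘ᵖ tlᵖ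
  s = hdᵖ ∘ᵖ z
  P = hdᵖ ∘ᵖ tlᵖ ∘ᵖ z
  N = tlᵖ ∘ᵖ tlᵖ ∘ᵖ z
  loᵖ = hdᵖ ∘ᵖ e
  hiᵖ = hdᵖ ∘ᵖ tlᵖ ∘ᵖ e

sumsᵖ : PT₂ sumsT
sumsᵖ = uncurried (stᵖ {f = λ y → sumStep (hdT y)}
  (uncurried (sumStepᵖ $₃ hdᵖ ∘ᵖ hdᵖ , hdᵖ ∘ᵖ tlᵖ , tlᵖ ∘ᵖ tlᵖ)) (nilᵖ ∙ᵖ nilᵖ ∙ᵖ nilᵖ) tlᵖ
  (con 7 ⊕ con 9 ⊗ (var ⊕ var)) λ x t → ≤-trans
    (size-Sums _ (st-Sums (hdT x) (nil ∙ nil ∙ nil) t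
      (All.map (λ {e} → LenPair-size e) (elements-size t ≤-refl)) (Sums-start {size t})))
    (+-monoʳ-≤ 7 (*-monoʳ-≤ 9 (+-mono-≤ (≤-trans (len≤size t) (m≤n+m (size t) (size x))) (m≤n+m (size t) (size x))))))

record Placing (K : ℕ) (z : Tree) : Set where
  constructor mkPlacing
  field
    found : size (hdT z) ≤ 3 + K
    sign  : size (hdT (tlT z)) ≤ 3 + K
    potˡ  : Num K (hdT (tlT (tlT z)))
    potʳ  : Num K (tlT (tlT (tlT z)))

Placing-mono : ∀ {K L z} → K ≤ L → Placing K z → Placing L z
Placing-mono h (mkPlacing f s a b) =
  mkPlacing (≤-trans f (+-monoʳ-≤ 3 h)) (≤-trans s (+-monoʳ-≤ 3 h)) (Num-mono h a) (Num-mono h b)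

Placing-size : ∀ z → Placing (size z) z
Placing-size z = mkPlacing
  (m≤n⇒m≤o+n 3 (size-hd z)) (m≤n⇒m≤o+n 3 (≤-trans (size-hd (tlT z)) (size-tl z)))
  (num (≤-trans (size-hd (tlT (tlT z))) tl₂)) (num (≤-trans (size-tl (tlT (tlT z))) tl₂))
  where
  tl₂ : size (tlT (tlT z)) ≤ size z
  tl₂ = ≤-trans (size-tl (tlT z)) (size-tl z)
  num : ∀ {t} → size t ≤ size z → Num (size z) t
  num {t} h = Num-mono h (Num-size t)

placeNext-Placing : ∀ {K} w e z → LenPair K (dbl (hdT e) ∙ dbl (hdT (tlT e)) ∙ nil) → Placing K z →
  Placing (suc K) (placeNext w e z)
placeNext-Placing {K} w e z (lo , hi) h@(mkPlacing f s a b) = ite-elim (Placing (suc K)) (activeT w e)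
  (ite-elim (Placing (suc K)) (hdT z) (Placing-mono (n≤1+n K) h)
    (ite-elim (Placing (suc K)) (crossT e z)
      (mkPlacing (m≤m+n 3 (suc K)) (m≤n⇒m≤1+n s) (Num-mono (n≤1+n K) a) (Num-mono (n≤1+n K) b))
      (mkPlacing (m≤n⇒m≤1+n f) (m≤n⇒m≤1+n s)
        (Num-add _ _ (proj₁ a) (ite-elim (λ t → len (dbl t) ≤ K) (hdT (tlT z)) lo hi))
        (Num-add _ _ (proj₁ b) (ite-elim (λ t → len (dbl t) ≤ K) (hdT (tlT z)) hi lo)))))
  (mkPlacing (m≤n⇒m≤1+n f) (≤-trans (size-exit (hdT (tlT z)) e) (m≤m+n 3 (suc K)))
    (Num-mono (n≤1+n K) a) (Num-mono (n≤1+n K) b))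

Doubles : ℕ → Tree → Set
Doubles K e = LenPair K (dbl (hdT e) ∙ dbl (hdT (tlT e)) ∙ nil)

Doubles-mono : ∀ {K L} e → K ≤ L → Doubles K e → Doubles L e
Doubles-mono e = LenPair-mono {e = dbl (hdT e) ∙ dbl (hdT (tlT e)) ∙ nil}

Doubles-size : ∀ {K} e → size e ≤ K → Doubles (suc K) e
Doubles-size e h = s≤s (proj₁ (LenPair-size e h)) , s≤s (proj₂ (LenPair-size e h))

st-Placing : ∀ {K} w z t → All (Doubles K) (toList t) → Placing K z → Placing (len t + K) (st (placeNext w) z t)
st-Placing w z nil [] h = h
st-Placing {K} w z (e ∙ t) (p ∷ ps) h =
  subst (λ L → Placing L (st (placeNext w) (placeNext w e z) t)) (+-suc (len t) K)
    (st-Placing w (placeNext w e z) t (All.map (λ {e} → Doubles-mono e (n≤1+n K)) ps) (placeNext-Placing w e z p h))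

size-Placing : ∀ {K} z → Placing K z → size z ≤ 11 + 10 * K
size-Placing {K} z (mkPlacing f s (_ , a) (_ , b)) = ≤-trans (size-hd-tl z) (≤-trans
  (+-mono-≤ (s≤s f) (≤-trans (size-hd-tl (tlT z)) (+-mono-≤ (s≤s s)
    (≤-trans (size-hd-tl (tlT (tlT z))) (s≤s (+-mono-≤ a b))))))
  (≤-reflexive (lem K)))
  where
  lem : ∀ K → (4 + K) + ((4 + K) + (1 + ((1 + 4 * K) + (1 + 4 * K)))) ≡ 11 + 10 * K
  lem = NatSolver.solve-∀

lowerᵖ : PT lower
lowerᵖ = iteᵖ (hdᵖ ∘ᵖ tlᵖ) (tlᵖ ∘ᵖ tlᵖ ∘ᵖ tlᵖ) (hdᵖ ∘ᵖ tlᵖ ∘ᵖ tlᵖ)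

upperᵖ : PT upper
upperᵖ = iteᵖ (hdᵖ ∘ᵖ tlᵖ) (hdᵖ ∘ᵖ tlᵖ ∘ᵖ tlᵖ) (tlᵖ ∘ᵖ tlᵖ ∘ᵖ tlᵖ)

crossᵖ : PT₂ crossT
crossᵖ = uncurried (andᵖ $₂ (leᵖ $₂ lowerᵖ ∘ᵖ tlᵖ , upperᵖ ∘ᵖ tlᵖ) ,
  (leᵖ $₂ (addᵖ $₂ upperᵖ ∘ᵖ tlᵖ , dblᵖ (hdᵖ ∘ᵖ hdᵖ)) , (addᵖ $₂ lowerᵖ ∘ᵖ tlᵖ , dblᵖ (hdᵖ ∘ᵖ tlᵖ ∘ᵖ hdᵖ))))

placeOutᵖ : PT₃ placeOut
placeOutᵖ = uncurried (iteᵖ (activeᵖ $₂ hdᵖ , e)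
  (hdᵖ ∘ᵖ e ∙ᵖ hdᵖ ∘ᵖ tlᵖ ∘ᵖ e ∙ᵖ
    iteᵖ (hdᵖ ∘ᵖ z) oneᵖ (iteᵖ (crossᵖ $₂ e , z)
      (oneᵖ ∙ᵖ (addᵖ $₂ dblᵖ (hdᵖ ∘ᵖ e) , (subᵖ $₂ upperᵖ ∘ᵖ z , lowerᵖ ∘ᵖ z))) oneᵖ))
  e)
  where
  e = hdᵖ ∘ᵖ tlᵖ
  z = tlᵖ ∘ᵖ tlᵖ

placeNextᵖ : PT₃ placeNext
placeNextᵖ = uncurried (iteᵖ (activeᵖ $₂ hdᵖ , e)
  (iteᵖ (hdᵖ ∘ᵖ z) z (iteᵖ (crossᵖ $₂ e , z) (oneᵖ ∙ᵖ tlᵖ ∘ᵖ z)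
    (hdᵖ ∘ᵖ z ∙ᵖ s ∙ᵖ
      (addᵖ $₂ hdᵖ ∘ᵖ tlᵖ ∘ᵖ tlᵖ ∘ᵖ z , dblᵖ (iteᵖ s loᵖ hiᵖ)) ∙ᵖ
      (addᵖ $₂ tlᵖ ∘ᵖ tlᵖ ∘ᵖ tlᵖ ∘ᵖ z , dblᵖ (iteᵖ s hiᵖ loᵖ)))))
  (hdᵖ ∘ᵖ z ∙ᵖ (exitᵖ $₂ s , e) ∙ᵖ tlᵖ ∘ᵖ tlᵖ ∘ᵖ z))
  where
  e = hdᵖ ∘ᵖ tlᵖ
  z = tlᵖ ∘ᵖ tlᵖ
  s = hdᵖ ∘ᵖ tlᵖ ∘ᵖ z
  loᵖ = hdᵖ ∘ᵖ e
  hiᵖ = hdᵖ ∘ᵖ tlᵖ ∘ᵖ e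

placeᵖ : PT₃ placeT
placeᵖ = uncurried (transduceᵖ
  {o = λ y → placeOut (hdT y)} {nx = λ y → placeNext (hdT y)} {fin = λ _ _ → nil}
  (uncurried (placeOutᵖ $₃ hdᵖ ∘ᵖ hdᵖ , hdᵖ ∘ᵖ tlᵖ , tlᵖ ∘ᵖ tlᵖ))
  (uncurried (placeNextᵖ $₃ hdᵖ ∘ᵖ hdᵖ , hdᵖ ∘ᵖ tlᵖ , tlᵖ ∘ᵖ tlᵖ))
  (uncurried nilᵖ) (hdᵖ ∘ᵖ tlᵖ) (tlᵖ ∘ᵖ tlᵖ)
  (con 11 ⊕ con 10 ⊗ (var ⊕ (con 1 ⊕ var))) λ x t → ≤-trans
    (size-Placing _ (st-Placing (hdT x) (hdT (tlT x)) t
      (All.map (λ {e} → Doubles-size e) (elements-size t (m≤n+m (size t) (size x))))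
      (Placing-mono (≤-trans (≤-trans (size-hd (tlT x)) (size-tl x)) (m≤n⇒m≤1+n (m≤m+n (size x) (size t))))
        (Placing-size (hdT (tlT x))))))
    (+-monoʳ-≤ 11 (*-monoʳ-≤ 10 (+-monoˡ-≤ (suc (size x + size t))
      (≤-trans (len≤size t) (m≤n+m (size t) (size x)))))))

stepᵖ : PT₂ stepT
stepᵖ = uncurried (placeᵖ $₃ w , (nilᵖ ∙ᵖ nilᵖ ∙ᵖ tlᵖ ∘ᵖ tlᵖ ∘ᵖ sumᵖ ∙ᵖ hdᵖ ∘ᵖ tlᵖ ∘ᵖ sumᵖ) , tlᵖ)
  where
  w : PT (λ x → midˡT (hdT x) ∙ midʳT (hdT x))
  w = midˡᵖ ∘ᵖ hdᵖ ∙ᵖ midʳᵖ ∘ᵖ hdᵖ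
  sumᵖ : PT (λ x → sumsT (midˡT (hdT x) ∙ midʳT (hdT x)) (tlT x))
  sumᵖ = sumsᵖ $₂ w , tlᵖ

-- Iterating the step does not change the ends of the segments, and the new cut positions
-- are bounded in terms of these ends alone.

record SegBound (K S : ℕ) (e : Tree) : Set where
  constructor mkSegBound
  field
    lo≤     : size (hdT e) ≤ K
    hi≤     : size (hdT (tlT e)) ≤ K
    status≤ : size (statusT e) ≤ S

SegBound-Doubles : ∀ {K S e} → SegBound K S e → Doubles (suc K) e
SegBound-Doubles {e = e} (mkSegBound l h _) =
  s≤s (≤-trans (len≤size (hdT e)) l) , s≤s (≤-trans (len≤size (hdT (tlT e))) h)

len-place : ∀ w z t → len (placeT w z t) ≡ len t
len-place w z nil     = refl
len-place w z (e ∙ t) = cong suc (len-place w (placeNext w e z) t)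

-- A new status `one ∙ X` has 4 nodes outside X, and X has at most L + 1 digits: 4 + (1 + 4 (L + 1))
-- = 9 + 4 L. No old status enters, so `S` survives repetition.
placeOut-bound : ∀ {K S L} w e z → Doubles L e → Placing L z → 9 + 4 * L ≤ S →
  SegBound K S e → SegBound K S (placeOut w e z)
placeOut-bound {K} {S} {L} w e z (dl , _) (mkPlacing _ _ a b) L≤S (mkSegBound l h s) =
  ite-elim (SegBound K S) (activeT w e)
    (mkSegBound l h (ite-elim (λ t → size t ≤ S) (hdT z) kept≤ (ite-elim (λ t → size t ≤ S) (crossT e z) cut≤ kept≤)))
    (mkSegBound l h s)
  where
  kept≤ : 3 ≤ S
  kept≤ = ≤-trans (s≤s (s≤s (s≤s z≤n))) L≤S
  upper≤ : len (upper z) ≤ L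
  upper≤ = ite-elim (λ t → len t ≤ L) (hdT (tlT z)) (proj₁ a) (proj₁ b)
  cut≤ : size (one ∙ addT (dbl (hdT e)) (subT (upper z) (lower z))) ≤ S
  cut≤ = ≤-trans (s≤s (s≤s (s≤s (s≤s (proj₂ (Num-add (dbl (hdT e)) (subT (upper z) (lower z)) dl
    (≤-trans (≤-reflexive (len-subWith (lower z ∙ nil) (upper z))) upper≤))))))) (≤-trans (≤-reflexive (lem L)) L≤S)
    where
    lem : ∀ L → 4 + (1 + 4 * suc L) ≡ 9 + 4 * L
    lem = NatSolver.solve-∀

place-bound : ∀ {K S L} w z t → All (Doubles L) (toList t) → Placing L z → 9 + 4 * (len t + L) ≤ S →
  All (SegBound K S) (toList t) → All (SegBound K S) (toList (placeT w z t))
place-bound w z nil [] h L≤S [] = []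
place-bound {L = L} w z (e ∙ t) (d ∷ ds) h L≤S (b ∷ bs) =
  placeOut-bound w e z d h (≤-trans (+-monoʳ-≤ 9 (*-monoʳ-≤ 4 (m≤n+m L (suc (len t))))) L≤S) b
  ∷ place-bound w (placeNext w e z) t (All.map (λ {e} → Doubles-mono e (n≤1+n L)) ds) (placeNext-Placing w e z d h)
      (≤-trans (≤-reflexive (cong (λ k → 9 + 4 * k) (+-suc (len t) L))) L≤S) bs

-- Sums over at most K segments whose ends have at most K digits have at most 2K digits, so L = 2K +
-- 1 covers the initial potentials and the doubled ends. Each segment passed may add a digit: 9 + 4
-- (K + 2K + 1) = 13 + 12 K.
step-bound : ∀ {K S} j t → len t ≤ K → 13 + 12 * K ≤ S →
  All (SegBound K S) (toList t) → All (SegBound K S) (toList (stepT j t))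
step-bound {K} {S} j t t≤ K≤S bs = place-bound {L = suc (K + K)} w (nil ∙ nil ∙ tlT (tlT (sumsT w t)) ∙ hdT (tlT (sumsT w t))) t
  (All.map (λ {e} b → Doubles-mono e (s≤s (m≤m+n K K)) (SegBound-Doubles b)) bs)
  (mkPlacing (s≤s z≤n) (s≤s z≤n) (Num-mono big (Sums.minus sums≤)) (Num-mono big (Sums.plus sums≤)))
  (≤-trans (+-monoʳ-≤ 9 (*-monoʳ-≤ 4 (+-monoˡ-≤ (suc (K + K)) t≤))) (≤-trans (≤-reflexive (lem K)) K≤S)) bs
  where
  w = midˡT j ∙ midʳT j
  sums≤ : Sums (len t + K) (sumsT w t)
  sums≤ = st-Sums w (nil ∙ nil ∙ nil) t
    (All.map (λ {e} (mkSegBound l h _) → ≤-trans (len≤size (hdT e)) l , ≤-trans (len≤size (hdT (tlT e))) h) bs) Sums-start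
  big : len t + K ≤ suc (K + K)
  big = m≤n⇒m≤1+n (+-monoˡ-≤ K t≤)
  lem : ∀ K → 9 + 4 * (K + suc (K + K)) ≡ 13 + 12 * K
  lem = NatSolver.solve-∀

len-step : ∀ j t → len (stepT j t) ≡ len t
len-step j t = len-place (midˡT j ∙ midʳT j)
  (nil ∙ nil ∙ tlT (tlT (sumsT (midˡT j ∙ midʳT j) t)) ∙ hdT (tlT (sumsT (midˡT j ∙ midʳT j) t))) t

len-run : ∀ js t → len (runT js t) ≡ len t
len-run nil      t = refl
len-run (j ∙ js) t = trans (len-step j (runT js t)) (len-run js t)

run-bound : ∀ {K S} js t → len t ≤ K → 13 + 12 * K ≤ S →
  All (SegBound K S) (toList t) → All (SegBound K S) (toList (runT js t))
run-bound nil      t t≤ K≤S bs = bs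
run-bound (j ∙ js) t t≤ K≤S bs =
  step-bound j (runT js t) (≤-trans (≤-reflexive (len-run js t)) t≤) K≤S (run-bound js t t≤ K≤S bs)

size-SegBound : ∀ {K S} e → SegBound K S e → size e ≤ 2 + 2 * K + S
size-SegBound {K} {S} e (mkSegBound l h s) = ≤-trans (size-hd-tl e) (≤-trans
  (+-mono-≤ (s≤s l) (≤-trans (size-hd-tl (tlT e)) (+-mono-≤ (s≤s h) s))) (≤-reflexive (lem K S)))
  where
  lem : ∀ K S → suc K + (suc K + S) ≡ 2 + 2 * K + S
  lem = NatSolver.solve-∀

runᵖ : PT₂ runT
runᵖ = uncurried (frᵖ {g = λ _ → stepT} (uncurried (stepᵖ $₂ hdᵖ ∘ᵖ tlᵖ , tlᵖ ∘ᵖ tlᵖ)) tlᵖ hdᵖ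
  (con 1 ⊕ var ⊗ (con 1 ⊕ (con 2 ⊕ con 2 ⊗ var ⊕ (con 13 ⊕ con 12 ⊗ var)))) λ x js →
    bounded (size x + size js) js (tlT x) (≤-trans (size-tl x) (m≤m+n (size x) (size js))))
  where
  bounded : ∀ K js t → size t ≤ K → size (runT js t) ≤ 1 + K * suc (2 + 2 * K + (13 + 12 * K))
  bounded K js t t≤ = ≤-trans (size-elements (runT js t) (All.map (λ {e} → size-SegBound e)
      (run-bound {K} {13 + 12 * K} js t (≤-trans (len≤size t) t≤) ≤-refl (All.map initial (elements-size t t≤)))))
    (s≤s (*-monoˡ-≤ (suc (2 + 2 * K + (13 + 12 * K)))
      (≤-trans (≤-reflexive (len-run js t)) (≤-trans (len≤size t) t≤))))
    where
    initial : ∀ {e} → size e ≤ K → SegBound K (13 + 12 * K) e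
    initial {e} h = mkSegBound (≤-trans (size-hd e) h) (≤-trans (≤-trans (size-hd (tlT e)) (size-tl e)) h)
      (≤-trans (≤-trans (size-tl (tlT e)) (size-tl e)) (≤-trans h (≤-trans (m≤n*m K 12) (m≤n+m (12 * K) 13))))

abstract
  algorithmᵖ : PT algorithmT
  algorithmᵖ = labelStageᵖ ∘ᵖ cutStageᵖ ∘ᵖ solveStageᵖ ∘ᵖ scaleStageᵖ
    where
    scaleStageᵖ : PT scaleStage
    scaleStageᵖ = commonᵖ ∘ᵖ mapᵖ {f = λ _ → parseBlock} (uncurried (parseBlockᵖ ∘ᵖ tlᵖ)) idᵖ
    solveStageᵖ : PT solveStage
    solveStageᵖ = hdᵖ ∙ᵖ (runᵖ $₂ sortᵖ longerᵖ ∘ᵖ tlᵖ , gridᵖ ∘ᵖ sortᵖ leᵖ ∘ᵖ pointsᵖ ∘ᵖ tlᵖ)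
    cutStageᵖ : PT cutStage
    cutStageᵖ = cutsᵖ $₂ toBijectiveᵖ ∘ᵖ dblᵖ (dblᵖ (dblᵖ hdᵖ)) , tlᵖ
    labelStageᵖ : PT labelStage
    labelStageᵖ = idᵖ ∙ᵖ labelsᵖ

-- Decoding: the functions on trees compute the functions on numbers and segments

decodeStatus : Tree → Status
decodeStatus nil             = free
decodeStatus (nil ∙ _)       = kept
decodeStatus ((_ ∙ _) ∙ X) = cutAt (val X)

decodeSeg : Tree → Seg
decodeSeg e = seg (val (hdT e)) (val (hdT (tlT e))) (decodeStatus (statusT e))

decodeAgent : Tree → Agent
decodeAgent j = val (hdT j) , val (tlT j)

decodeRaw : Tree → Raw
decodeRaw e = decodeAgent (hdT e) , decodeAgent (tlT e)

segs : Tree → List Seg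
segs t = map decodeSeg (toList t)

agents : Tree → List Agent
agents t = map decodeAgent (toList t)

truth-and : ∀ a b → truth (andT a b) ≡ truth a ∧ truth b
truth-and nil     b       = refl
truth-and (_ ∙ _) nil     = refl
truth-and (_ ∙ _) (_ ∙ _) = refl

truth-xor : ∀ a b → truth (xorT a b) ≡ truth a xor truth b
truth-xor nil     nil     = refl
truth-xor nil     (_ ∙ _) = refl
truth-xor (_ ∙ _) nil     = refl
truth-xor (_ ∙ _) (_ ∙ _) = refl

decode-active : ∀ w e → active (val (hdT w)) (val (tlT w)) (decodeSeg e) ≡ truth (activeT w e)
decode-active w e = sym (trans
  (truth-and (andT (leT (hdT w) (hdT e)) (leT (hdT (tlT e)) (tlT w))) (notT (statusT e)))
  (cong₂ _∧_
    (trans (truth-and (leT (hdT w) (hdT e)) (leT (hdT (tlT e)) (tlT w))) (cong₂ _∧_ (truth-le (hdT w) (hdT e)) (truth-le (hdT (tlT e)) (tlT w))))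
    (free-status (statusT e))))
  where
  free-status : ∀ s → truth (notT s) ≡ isFree (decodeStatus s)
  free-status nil             = refl
  free-status (nil ∙ _)       = refl
  free-status ((_ ∙ _) ∙ _) = refl

decode-exit : ∀ s e → exit (truth s) (decodeSeg e) ≡ truth (exitT s e)
decode-exit s e = sym (trans (truth-xor s (hdT (statusT e))) (cong (truth s xor_) (cut-status (statusT e))))
  where
  cut-status : ∀ s → truth (hdT s) ≡ isCut (decodeStatus s)
  cut-status nil             = refl
  cut-status (nil ∙ _)       = refl
  cut-status ((_ ∙ _) ∙ _) = refl

decode-sums : ∀ w s P N t → let r = st (sumStep w) (s ∙ P ∙ N) t in
  (val (hdT (tlT r)) , val (tlT (tlT r)))
    ≡ sums (val (hdT w)) (val (tlT w)) (truth s) (val P) (val N) (segs t)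
decode-sums w s P N nil = refl
decode-sums w s P N (e ∙ t) rewrite decode-active w e with activeT w e
... | nil rewrite decode-exit s e = decode-sums w (exitT s e) P N t
decode-sums w nil P N (e ∙ t) | _ ∙ _
  rewrite sym (val-add P (hdT (tlT e))) | sym (val-add N (hdT e)) = decode-sums w nil _ _ t
decode-sums w (x ∙ y) P N (e ∙ t) | _ ∙ _
  rewrite sym (val-add P (hdT e)) | sym (val-add N (hdT (tlT e))) = decode-sums w (x ∙ y) _ _ t

val-ite : ∀ s x y → val (ite s x y) ≡ (when truth s then val x else val y)
val-ite nil     x y = refl
val-ite (_ ∙ _) x y = refl

decode-cross : ∀ e f s A B →
  let U = when truth s then val B else val A
      V = when truth s then val A else val B in
  (U ≤ᵇ V) ∧ (V + 2 * val (hdT e) ≤ᵇ U + 2 * val (hdT (tlT e))) ≡ truth (crossT e (f ∙ s ∙ A ∙ B))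
decode-cross e f s A B
  rewrite sym (val-ite s A B) | sym (val-ite s B A) = sym (trans
  (truth-and (leT (ite s B A) (ite s A B))
    (leT (addT (ite s A B) (dbl (hdT e))) (addT (ite s B A) (dbl (hdT (tlT e)))))) (cong₂ _∧_
    (truth-le (ite s B A) (ite s A B))
    (trans (truth-le (addT (ite s A B) (dbl (hdT e))) (addT (ite s B A) (dbl (hdT (tlT e)))))
      (cong₂ _≤ᵇ_ (val-add (ite s A B) (dbl (hdT e))) (val-add (ite s B A) (dbl (hdT (tlT e))))))))

-- The first half of the crossing test rules out an underflow of the subtraction.
decode-cut : ∀ e f s A B → truth (crossT e (f ∙ s ∙ A ∙ B)) ≡ true →
  val (addT (dbl (hdT e)) (subT (ite s A B) (ite s B A)))
    ≡ 2 * val (hdT e) + ((when truth s then val A else val B) ∸ (when truth s then val B else val A))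
decode-cut e f s A B eq = trans (val-add (dbl (hdT e)) (subT (ite s A B) (ite s B A))) (cong (λ k → 2 * val (hdT e) + k)
  (trans (val-sub (ite s A B) (ite s B A)
      (≤ᵇ-true⁻ (trans (sym (truth-le (ite s B A) (ite s A B))) (∧-trueˡ (trans (sym (truth-and (leT (ite s B A) (ite s A B))
        (leT (addT (ite s A B) (dbl (hdT e))) (addT (ite s B A) (dbl (hdT (tlT e))))))) eq)))))
    (cong₂ _∸_ (val-ite s A B) (val-ite s B A))))

val-add-dbl : ∀ A s x y → val (addT A (dbl (ite s x y))) ≡ val A + 2 * (when truth s then val x else val y)
val-add-dbl A s x y = trans (val-add A (dbl (ite s x y))) (cong (λ k → val A + 2 * k) (val-ite s x y))

decode-place : ∀ w f s A B t →
  segs (placeT w (f ∙ s ∙ A ∙ B) t)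
    ≡ place (val (hdT w)) (val (tlT w)) (truth f) (truth s) (val A) (val B) (segs t)
decode-place w f s A B nil = refl
decode-place w f s A B (e ∙ t) rewrite decode-active w e with activeT w e
... | nil rewrite decode-exit s e = cong (decodeSeg e ∷_) (decode-place w f (exitT s e) A B t)
decode-place w (x ∙ y) s A B (e ∙ t) | _ ∙ _ = cong (_ ∷_) (decode-place w (x ∙ y) s A B t)
decode-place w nil s A B (e ∙ t) | _ ∙ _
  rewrite decode-cross e nil s A B with crossT e (nil ∙ s ∙ A ∙ B) in eq
... | _ ∙ _ = cong₂ _∷_
  (cong (λ X → seg (val (hdT e)) (val (hdT (tlT e))) (cutAt X)) (decode-cut e nil s A B (cong truth eq)))
  (decode-place w one s A B t)
... | nil rewrite sym (val-add-dbl A s (hdT e) (hdT (tlT e))) | sym (val-add-dbl B s (hdT (tlT e)) (hdT e)) =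
  cong (_ ∷_) (decode-place w nil s _ _ t)

midˡ-val : ∀ j → val (midˡT j) ≡ midˡ (decodeAgent j)
midˡ-val j = trans (val-add (addT (hdT j) (dbl (hdT j))) (tlT j))
  (cong (λ k → k + val (tlT j)) (val-add (hdT j) (dbl (hdT j))))

midʳ-val : ∀ j → val (midʳT j) ≡ midʳ (decodeAgent j)
midʳ-val j = trans (val-add (hdT j) (addT (tlT j) (dbl (tlT j))))
  (cong (λ k → val (hdT j) + k) (val-add (tlT j) (dbl (tlT j))))

decode-step : ∀ j t → segs (stepT j t) ≡ step (midˡ (decodeAgent j)) (midʳ (decodeAgent j)) (segs t)
decode-step j t
  rewrite sym (midˡ-val j) | sym (midʳ-val j)
        | sym (decode-sums (midˡT j ∙ midʳT j) nil nil nil t)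
  = decode-place (midˡT j ∙ midʳT j) nil nil _ _ t

decode-run : ∀ js t → segs (runT js t) ≡ run (agents js) (segs t)
decode-run nil      t = refl
decode-run (j ∙ js) t = trans (decode-step j (runT js t))
  (cong (step (midˡ (decodeAgent j)) (midʳ (decodeAgent j))) (decode-run js t))

decode-insert : ∀ {A : Set} (decode : Tree → A) leᵀ le → (∀ x y → le (decode x) (decode y) ≡ truth (leᵀ x y)) →
  ∀ s t → map decode (toList (insertT leᵀ s t)) ≡ insertBy le (decode s) (map decode (toList t))
decode-insert decode leᵀ le h s nil = refl
decode-insert decode leᵀ le h s (e ∙ t) rewrite h s e with leᵀ s e
... | nil     = cong (decode e ∷_) (decode-insert decode leᵀ le h s t)
... | (_ ∙ _) = cong (decode s ∷_) (decode-insert decode leᵀ le h e t)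

decode-sort : ∀ {A : Set} (decode : Tree → A) leᵀ le → (∀ x y → le (decode x) (decode y) ≡ truth (leᵀ x y)) →
  ∀ t → map decode (toList (sortT leᵀ t)) ≡ sortBy le (map decode (toList t))
decode-sort decode leᵀ le h nil     = refl
decode-sort decode leᵀ le h (e ∙ t) = trans (decode-insert decode leᵀ le h e (sortT leᵀ t))
  (cong (insertBy le (decode e)) (decode-sort decode leᵀ le h t))

decode-longer : ∀ j k → longer (decodeAgent j) (decodeAgent k) ≡ truth (longerT j k)
decode-longer j k = sym (trans (truth-le (addT (tlT k) (hdT j)) (addT (tlT j) (hdT k)))
  (cong₂ _≤ᵇ_ (val-add (tlT k) (hdT j)) (val-add (tlT j) (hdT k))))

decode-points : ∀ t → map val (toList (pointsT t)) ≡ points (agents t)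
decode-points nil     = refl
decode-points (j ∙ t)
  rewrite val-add (addT (hdT j) (dbl (hdT j))) (tlT j) | val-add (hdT j) (dbl (hdT j))
        | val-add (hdT j) (addT (tlT j) (dbl (tlT j))) | val-add (tlT j) (dbl (tlT j))
        | decode-points t = refl

decode-grid : ∀ t → segs (gridT t) ≡ grid (map val (toList t))
decode-grid nil     = refl
decode-grid (p ∙ t) = go p t
  where
  go : ∀ p t → segs (gridT (p ∙ t)) ≡ segments (val p) (map val (toList t))
  go p nil     = refl
  go p (e ∙ t) = cong (_ ∷_) (go e t)

decode-rescale : ∀ k t → agents (mapT (rescaleT k) t) ≡ map (rescale (val k)) (agents t)
decode-rescale k nil     = refl
decode-rescale k (j ∙ t) = cong₂ _∷_ (cong₂ _,_ (val-mul k (hdT j)) (val-mul k (tlT j))) (decode-rescale k t)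

decode-common : ∀ t → (val (hdT (commonT t)) , agents (tlT (commonT t))) ≡ commonDenominator (map decodeRaw (toList t))
decode-common nil = refl
decode-common (e ∙ t)
  rewrite sym (decode-common t)
        | val-mul (mulT (tlT (hdT e)) (tlT (tlT e))) (hdT (commonT t))
        | val-mul (hdT (hdT e)) (mulT (tlT (tlT e)) (hdT (commonT t)))
        | val-mul (hdT (tlT e)) (mulT (tlT (hdT e)) (hdT (commonT t)))
        | val-mul (tlT (tlT e)) (hdT (commonT t)) | val-mul (tlT (hdT e)) (hdT (commonT t))
        | decode-rescale (mulT (tlT (hdT e)) (tlT (tlT e))) (tlT (commonT t))
        | val-mul (tlT (hdT e)) (tlT (tlT e)) = refl

val-encodeℕ : ∀ m → val (fromBijective (encodeℕ m)) ≡ m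
val-encodeℕ m = trans (val-fromBijective (ℕᵇ.fromℕ m)) (toℕ-fromℕ m)

decode-input : ∀ {n} (μs : Vec SingleBlock n) →
  map decodeRaw (toList (mapT parseBlock (encodeInput μs))) ≡ rawsOf μs
decode-input []       = refl
decode-input (μ ∷ μs) = cong₂ _∷_
  (cong₂ _,_ (cong₂ _,_ (val-encodeℕ (∣ ℚ.↥ left μ ∣)) (val-encodeℕ (ℚ.↧ₙ left μ)))
    (cong₂ _,_ (val-encodeℕ (∣ ℚ.↥ right μ ∣)) (val-encodeℕ (ℚ.↧ₙ right μ))))
  (decode-input μs)

-- A number has exactly one bijective numeral, so the output agrees literally with `encodeℕ`,
-- whatever leading zeros the binary computation left.
cuts-encode : ∀ k {den} t → den ≡ encodeℕ (suc k) →
  cutsT den t ≡ encodeVec encodeℚᵘ (cutVec k (cutsOf (segs t)))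
cuts-encode k nil refl = refl
cuts-encode k (e ∙ t) refl with statusT e
... | nil             = cuts-encode k t refl
... | nil ∙ _         = cuts-encode k t refl
... | (_ ∙ _) ∙ X   = cong₂ _∙_ (cong (λ x → (nil ∙ x) ∙ encodeℕ (suc k)) (toBijective-correct X))
  (cuts-encode k t refl)

labels-encode : ∀ {n} s (cs : Vec ℚᵘ n) →
  transduce (λ e s → s) (λ e s → notT s) (λ s → s ∙ nil) (encodeSign (toSign s)) (encodeVec encodeℚᵘ cs)
    ≡ encodeVec encodeSign (alternate s n)
labels-encode s     []       = refl
labels-encode true  (c ∷ cs) = cong (_ ∙_) (labels-encode false cs)
labels-encode false (c ∷ cs) = cong (_ ∙_) (labels-encode true cs)

algorithm-correct : ∀ {n} (μs : Vec SingleBlock n) → algorithmT (encodeInput μs) ≡ encodePartition (partition μs)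
algorithm-correct μs = trans
  (cong labelStage (trans (cuts-encode k (tlT solvedᵀ) den≡)
    (cong (λ ys → encodeVec encodeℚᵘ (cutVec k (cutsOf ys))) solvedᵀ≡)))
  (cong (encodeVec encodeℚᵘ (cutVec k (cutsOf (solve (proj₂ input)))) ∙_) (labels-encode false (cutVec k (cutsOf (solve (proj₂ input))))))
  where
  input = commonDenominator (rawsOf μs)
  k = ℕ.pred (8 * proj₁ input)
  agentsᵀ = scaleStage (encodeInput μs)
  solvedᵀ = solveStage agentsᵀ
  agentsᵀ≡ : (val (hdT agentsᵀ) , agents (tlT agentsᵀ)) ≡ input
  agentsᵀ≡ = trans (decode-common (mapT parseBlock (encodeInput μs))) (cong commonDenominator (decode-input μs))
  den≡ : toBijective (dbl (dbl (dbl (hdT agentsᵀ)))) ≡ encodeℕ (suc k)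
  den≡ = trans (toBijective-correct (dbl (dbl (dbl (hdT agentsᵀ))))) (cong encodeℕ (trans (trans (lem (val (hdT agentsᵀ))) (cong (λ r → 8 * proj₁ r) agentsᵀ≡))
    (sym (suc-pred (8 * proj₁ input) {{ℕ.>-nonZero (≤-trans (denominator-positive μs) (m≤n*m (proj₁ input) 8))}}))))
    where
    lem : ∀ D → 2 * (2 * (2 * D)) ≡ 8 * D
    lem = NatSolver.solve-∀
  solvedᵀ≡ : segs (tlT solvedᵀ) ≡ solve (proj₂ input)
  solvedᵀ≡ = trans (decode-run (sortT longerT (tlT agentsᵀ)) (gridT (sortT leT (pointsT (tlT agentsᵀ)))))
    (trans (cong₂ run
      (decode-sort decodeAgent longerT longer decode-longer (tlT agentsᵀ))
      (trans (decode-grid (sortT leT (pointsT (tlT agentsᵀ)))) (cong grid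
        (trans (decode-sort val leT _≤ᵇ_ (λ x y → sym (truth-le x y)) (pointsT (tlT agentsᵀ)))
          (cong (sortBy _≤ᵇ_) (decode-points (tlT agentsᵀ)))))))
      (cong (λ r → solve (proj₂ r)) agentsᵀ≡))

-- From polynomial bounds to a single power of the input size

polynomial-time : ∀ {f} → PT f → ∃[ p ] ∃[ c ] ∃[ d ]
  (∀ x → ∃[ t ] (p on x ⇓ f x ⟨ t ⟩) × t ≤ c * size x ^ d)
polynomial-time F with ⟦⟧-monomial (PT.bound F)
... | c , d , monomial = PT.prog F , c , d , λ x →
  let (t , halts , t≤) = PT.runs F x in t , halts , ≤-trans t≤ (at-size x)
  where
  at-size : ∀ x → ⟦ PT.bound F ⟧ (size x) ≤ c * size x ^ d
  at-size nil     = monomial 0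
  at-size (x ∙ y) = monomial (size x + size y)

theorem7 : ∃[ algorithm ] ∃[ c ] ∃[ d ]
    ((n : ℕ) (μ : Vec SingleBlock n) →
    ∃[ P ] ∃[ t ]
    ((algorithm on encodeInput μ ⇓ encodePartition {n} P ⟨ t ⟩)
    × (t ℕ.≤ c ℕ.* size (encodeInput μ) ^ d)
    × ((j : Fin n) →
    ℚ.∣ measure (Vec.lookup μ j) (I⁺ P) ℚ.- measure (Vec.lookup μ j) (I⁻ P) ∣ ℚ.≤ ½)))
theorem7 =
  let (p , c , d , runs) = polynomial-time algorithmᵖ in
  p , c , d , λ n μ →
    let (t , halts , t≤) = runs (encodeInput μ) in
    partition μ , t ,
    subst (λ y → p on encodeInput μ ⇓ y ⟨ t ⟩) (algorithm-correct μ) halts ,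
    t≤ , partition-halves μ
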